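{- There is a deterministic algorithm $\mathcal{A}_{\mathrm{Online}}$ with the following guarantee. Given as input a randomized $q$-query algorithm $R:\{0,1\}^n\times\{0,1\}^m\to[0,1]$ with description length $N$, an error parameter $\varepsilon\in(0,\frac12)$, and an input $\underline{x}\in\{0,1\}^n$, the algorithm $\mathcal{A}_{\mathrm{Online}}$ runs in time $\mathrm{poly}(N,q,1/\varepsilon)$, makes $O(q^2/\varepsilon^3)$ queries to $\underline{x}$, and returns a value $\mathcal{A}_{\mathrm{Online}}(\underline{x})\in[0,1]$. The output values of $\mathcal{A}_{\mathrm{Online}}$ (for fixed $R$ and $\varepsilon$, as a function of the input) satisfy $$\mathop{\mathbb{E}}_{x}\Big[\big(\mathcal{A}_{\mathrm{Online}}(x)-\mathop{\mathbb{E}}_{r}[R(x,r)]\big)^2\Big]\le\varepsilon,$$ where $x\sim\{0,1\}^n$ and $r\sim\{0,1\}^m$ are uniformly random.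
   Context: Query algorithms are represented as binary decision trees. An $n$-variable randomized decision tree (RDT) is a binary tree with two types of internal nodes: decision nodes, which branch on the value of one of the boolean variables $x_1,\dots,x_n$, and stochastic nodes, which branch on the outcome of an independent $\mathrm{Bernoulli}(\frac12)$ random bit. Leaves are labelled by values in $[0,1]$. Its query complexity is the maximum number of decision nodes on any root-to-leaf path, and its randomness complexity is the maximum number $m$ of stochastic nodes on any root-to-leaf path. The RDT computes a function $R:\{0,1\}^n\times\{0,1\}^m\to[0,1]$, where $R(x,r)$ is the label of the leaf reached on input $x$ when the stochastic nodes encountered branch according to the bits of $r$. A randomized $q$-query algorithm is an RDT of query complexity at most $q$. The description length is the length of the description of the tree. A query to $\underline{x}$ means reading one coordinate of $\underline{x}$.
   Formalization: The leaf labels of the randomized decision tree and the error parameter ε are taken to be rational numbers rather than arbitrary reals in [0,1] and (0,1/2). -}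

module Defs where

open import Data.Bool.Base using (Bool; true; false; if_then_else_)
open import Data.Fin.Base using (Fin; toℕ)
open import Data.Fin.Properties using (toℕ-injective)
open import Data.Integer.Base using (∣_∣)
import Data.Integer.Base as ℤ
open import Data.Nat.Base using (ℕ; zero; suc; _+_; _⊔_; _≤_; s≤s⁻¹; NonZero)
import Data.Nat.DivMod as ℕ
open import Data.Nat.Properties using (≤-refl; m⊔n≤o⇒m≤o; m⊔n≤o⇒n≤o)
open import Data.Nat.Binary.Base using (ℕᵇ; zero; 2[1+_]; 1+[2_]; fromℕ)
open import Data.Nat.Binary.Properties using (fromℕ-injective)
open import Data.Product.Base using (∃-syntax; _×_; _,_)
open import Data.Rational.Base as ℚ using (ℚ; 0ℚ; 1ℚ; ½; ↥_; ↧ₙ_)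
open import Data.Rational.Properties using (pos⇒nonZero)
open import Algebra.Definitions.RawSemiring ℚ.+-*-rawSemiring public using (_^_)
open import Data.Vec.Base using (Vec; []; _∷_; lookup; map)
open import Relation.Binary.PropositionalEquality.Core
  using (_≡_; refl; sym; trans; cong; cong₂)

------------------------------------------------------------------------
-- Rationals

record InUnit (p : ℚ) : Set where
  constructor _,_
  field
    0≤ : 0ℚ ℚ.≤ p
    ≤1 : p ℚ.≤ 1ℚ

ℕ→ℚ : ℕ → ℚ
ℕ→ℚ k = ℤ.+ k ℚ./ 1

infix 9 _⁻¹
_⁻¹ : (p : ℚ) .{{_ : ℚ.Positive p}} → ℚ
p ⁻¹ = ℚ.1/_ p {{pos⇒nonZero p}}

↥-nonZero : (p : ℚ) .{{_ : ℚ.Positive p}} → NonZero ∣ ↥ p ∣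
↥-nonZero (ℚ.mkℚ ℤ.+[1+ _ ] _ _) = _

------------------------------------------------------------------------
-- Expectation over a uniformly random point of the cube {0,1}ⁿ

∑ : ∀ {n} → (Vec Bool n → ℚ) → ℚ
∑ {zero}  f = f []
∑ {suc n} f = ∑ (λ x → f (false ∷ x)) ℚ.+ ∑ (λ x → f (true ∷ x))

𝔼 : ∀ {n} → (Vec Bool n → ℚ) → ℚ
𝔼 {n} f = ½ ^ n ℚ.* ∑ f

------------------------------------------------------------------------
-- Randomized decision trees

-- First subtree: the variable (or random bit) is 0; second: it is 1.
data RDT (n : ℕ) : Set where
  leaf   : (p : ℚ) → InUnit p → RDT n
  decide : Fin n → RDT n → RDT n → RDT n
  toss   : RDT n → RDT n → RDT n

queryComplexity : ∀ {n} → RDT n → ℕ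
queryComplexity (leaf _ _)       = 0
queryComplexity (decide _ T₀ T₁) = suc (queryComplexity T₀ ⊔ queryComplexity T₁)
queryComplexity (toss T₀ T₁)     = queryComplexity T₀ ⊔ queryComplexity T₁

randomness : ∀ {n} → RDT n → ℕ
randomness (leaf _ _)       = 0
randomness (decide _ T₀ T₁) = randomness T₀ ⊔ randomness T₁
randomness (toss T₀ T₁)     = suc (randomness T₀ ⊔ randomness T₁)

-- The i-th stochastic node met on the way down branches on the i-th bit
-- of r, so distinct stochastic nodes on a path use distinct bits.
eval : ∀ {n m} (T : RDT n) → randomness T ≤ m → Vec Bool n → Vec Bool m → ℚ
eval (leaf p _)       _ x r = p
eval (decide i T₀ T₁) h x r =
  if lookup x i
  then eval T₁ (m⊔n≤o⇒n≤o (randomness T₀) (randomness T₁) h) x r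
  else eval T₀ (m⊔n≤o⇒m≤o (randomness T₀) (randomness T₁) h) x r
eval (toss T₀ T₁)     h x (b ∷ r) =
  if b
  then eval T₁ (m⊔n≤o⇒n≤o (randomness T₀) (randomness T₁) (s≤s⁻¹ h)) x r
  else eval T₀ (m⊔n≤o⇒m≤o (randomness T₀) (randomness T₁) (s≤s⁻¹ h)) x r

⟦_⟧ : ∀ {n} (R : RDT n) → Vec Bool n → Vec Bool (randomness R) → ℚ
⟦ R ⟧ = eval R ≤-refl

------------------------------------------------------------------------
-- Model of computation
--
-- A program is a finite table of mutually recursive first-order
-- functions over binary trees (cf. Jones, "Computability and
-- Complexity"), with one extra instruction for querying the input x.
-- Every instruction does a bounded number of pointer operations when
-- trees are kept as shared immutable cells, so unit-cost time agrees with
-- Turing machine time up to a polynomial.  Trees can be inspected only by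
-- matching on their root; there is no built-in arithmetic or equality.

infixr 5 _∙_
data Tree : Set where
  nil : Tree
  _∙_ : Tree → Tree → Tree

size : Tree → ℕ
size nil     = 1
size (s ∙ t) = suc (size s + size t)

-- Expressions with k variables in scope (de Bruijn indices), over F
-- functions of the given arities.
data Expr {F : ℕ} (arity : Fin F → ℕ) (k : ℕ) : Set where
  var   : Fin k → Expr arity k
  nil   : Expr arity k
  cons  : Fin k → Fin k → Expr arity k
  match : Fin k → Expr arity k → Expr arity (suc (suc k)) → Expr arity k
  bind  : Expr arity k → Expr arity (suc k) → Expr arity k
  call  : (f : Fin F) → Vec (Fin k) (arity f) → Expr arity k
  query : Fin k → Expr arity k

record Program : Set where
  field
    F     : ℕ
    arity : Fin F → ℕ
    body  : (f : Fin F) → Expr arity (arity f)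
    main  : Expr arity 2

------------------------------------------------------------------------
-- Encodings

encodeBool : Bool → Tree
encodeBool false = nil
encodeBool true  = nil ∙ nil

-- Bijective binary numerals, least significant digit first.
encodeℕᵇ : ℕᵇ → Tree
encodeℕᵇ zero     = nil
encodeℕᵇ 1+[2 b ] = nil ∙ encodeℕᵇ b
encodeℕᵇ 2[1+ b ] = (nil ∙ nil) ∙ encodeℕᵇ b

encodeℕ : ℕ → Tree
encodeℕ k = encodeℕᵇ (fromℕ k)

encodeRDT : ∀ {n} → RDT n → Tree
encodeRDT (leaf p _)       = nil ∙ encodeℕ ∣ ↥ p ∣ ∙ encodeℕ (↧ₙ p)
encodeRDT (decide i T₀ T₁) =
  (nil ∙ nil) ∙ encodeℕ (toℕ i) ∙ encodeRDT T₀ ∙ encodeRDT T₁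
encodeRDT (toss T₀ T₁)     =
  (nil ∙ nil ∙ nil) ∙ encodeRDT T₀ ∙ encodeRDT T₁

descriptionLength : ∀ {n} → RDT n → ℕ
descriptionLength R = size (encodeRDT R)

-- A positive rational a / b is presented by its reciprocal, written as the
-- mixed number b / a = k + r / a.  Running times are to be bounded in
-- terms of the value 1 / ε only, not of the number of digits of ε; so the
-- order of magnitude of ε must be readable without scanning all digits of
-- a and b, as it would have to be if a and b were given separately.
encodeε : (ε : ℚ) .{{_ : ℚ.Positive ε}} → Tree
encodeε ε = encodeℕ (b ℕ./ a) ∙ encodeℕ (b ℕ.% a) ∙ encodeℕ a
  where
  a = ∣ ↥ ε ∣
  b = ↧ₙ ε
  instance
    a≢0 : NonZero a
    a≢0 = ↥-nonZero ε

-- Output format: any fraction, not necessarily in lowest terms.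
_Represents_ : Tree → ℚ → Set
t Represents p =
  ∃[ a ] ∃[ b ] (t ≡ encodeℕ a ∙ encodeℕ (suc b)) × (p ≡ ℤ.+ a ℚ./ suc b)

------------------------------------------------------------------------
-- Cost semantics

module Semantics (P : Program) {n : ℕ} (x : Vec Bool n) where
  open Program P

  private variable
    k s s′ q q′ : ℕ
    ρ : Vec Tree k
    t u v w : Tree
    e e′ : Expr arity k
    i j : Fin k

  -- ρ ⊢ e ⇓ v [ s , q ] : in environment ρ, e evaluates to v in s steps
  -- and with q queries to x (repeated queries are counted each time).
  infix 3 _⊢_⇓_[_,_]
  data _⊢_⇓_[_,_] {k} (ρ : Vec Tree k) : Expr arity k → Tree → ℕ → ℕ → Set where
    var   : ρ ⊢ var i ⇓ lookup ρ i [ 1 , 0 ]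
    nil   : ρ ⊢ nil ⇓ nil [ 1 , 0 ]
    cons  : ρ ⊢ cons i j ⇓ lookup ρ i ∙ lookup ρ j [ 1 , 0 ]
    match-nil  : lookup ρ i ≡ nil →
                 ρ ⊢ e ⇓ v [ s , q ] →
                 ρ ⊢ match i e e′ ⇓ v [ suc s , q ]
    match-cons : lookup ρ i ≡ t ∙ u →
                 t ∷ u ∷ ρ ⊢ e′ ⇓ v [ s , q ] →
                 ρ ⊢ match i e e′ ⇓ v [ suc s , q ]
    bind  : ρ ⊢ e ⇓ v [ s , q ] →
            v ∷ ρ ⊢ e′ ⇓ w [ s′ , q′ ] →
            ρ ⊢ bind e e′ ⇓ w [ suc (s + s′) , q + q′ ]
    call  : ∀ {f is} →
            map (lookup ρ) is ⊢ body f ⇓ v [ s , q ] →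
            ρ ⊢ call f is ⇓ v [ suc s , q ]
    query : ∀ {c : Fin n} →
            lookup ρ i ≡ encodeℕ (toℕ c) →
            ρ ⊢ query i ⇓ encodeBool (lookup x c) [ 1 , 1 ]

  private
    ∙-injectiveʳ : t ∙ u ≡ v ∙ w → u ≡ w
    ∙-injectiveʳ refl = refl

    encodeℕᵇ-injective : ∀ b c → encodeℕᵇ b ≡ encodeℕᵇ c → b ≡ c
    encodeℕᵇ-injective zero     zero     _  = refl
    encodeℕᵇ-injective 1+[2 b ] 1+[2 c ] eq =
      cong 1+[2_] (encodeℕᵇ-injective b c (∙-injectiveʳ eq))
    encodeℕᵇ-injective 2[1+ b ] 2[1+ c ] eq =
      cong 2[1+_] (encodeℕᵇ-injective b c (∙-injectiveʳ eq))

  ⇓-deterministic : ∀ {ρ : Vec Tree k} →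
                    ρ ⊢ e ⇓ v [ s , q ] → ρ ⊢ e ⇓ w [ s′ , q′ ] →
                    v ≡ w × s ≡ s′ × q ≡ q′
  ⇓-deterministic var  var  = refl , refl , refl
  ⇓-deterministic nil  nil  = refl , refl , refl
  ⇓-deterministic cons cons = refl , refl , refl
  ⇓-deterministic (match-nil _ d) (match-nil _ d′) with ⇓-deterministic d d′
  ... | refl , refl , refl = refl , refl , refl
  ⇓-deterministic (match-nil p _) (match-cons p′ _) with trans (sym p) p′
  ... | ()
  ⇓-deterministic (match-cons p _) (match-nil p′ _) with trans (sym p) p′
  ... | ()
  ⇓-deterministic (match-cons p d) (match-cons p′ d′) with trans (sym p) p′
  ... | refl with ⇓-deterministic d d′
  ... | refl , refl , refl = refl , refl , refl
  ⇓-deterministic (bind d₁ d₂) (bind d₁′ d₂′) with ⇓-deterministic d₁ d₁′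
  ... | refl , refl , refl with ⇓-deterministic d₂ d₂′
  ... | refl , refl , refl = refl , refl , refl
  ⇓-deterministic (call d) (call d′) with ⇓-deterministic d d′
  ... | refl , refl , refl = refl , refl , refl
  ⇓-deterministic (query {c = c} p) (query {c = c′} p′)
    with toℕ-injective {i = c} {j = c′} (fromℕ-injective
           (encodeℕᵇ-injective _ _ (trans (sym p) p′)))
  ... | refl = refl , refl , refl

-- Given the descriptions of R and ε, and query access to x, the program P
-- halts after s steps and q queries and returns the value p.
Returns : Program → ∀ {n} → RDT n → (ε : ℚ) .{{_ : ℚ.Positive ε}} →
          Vec Bool n → ℚ → ℕ → ℕ → Set
Returns P R ε x p s q =
  ∃[ t ] (encodeRDT R ∷ encodeε ε ∷ [] ⊢ main ⇓ t [ s , q ]) × t Represents p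
  where
  open Program P
  open Semantics P x

{-# OPTIONS --safe #-}
module Submission where

-- Averaging the trees obtained from R by fixing its random bits gives the
-- function f(x) = E_r R(x, r).  For K = floor(1/ε) + 1 independent choices of these
-- bits, the average of the K resulting deterministic trees has expected
-- squared distance at most 1/K ≤ ε from f, and evaluating it takes at most
-- Kq ≤ 2q/ε queries.  So it suffices to find K good choices without using
-- randomness, and since the whole tree R is given, this can be done by the
-- method of conditional expectations, before x is looked at.
--
-- The deterministic trees T₁, ..., T_K are chosen one after the other.
-- Write D for the sum of the trees chosen so far minus the same number of
-- copies of f.  If T is chosen so that 𝔼[D T] ≤ 𝔼[D f], then
--
--   𝔼[(D + T - f)²] = 𝔼[D²] + 2 𝔼[D (T - f)] + 𝔼[(T - f)²] ≤ 𝔼[D²] + 1,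
--
-- so K steps lead to 𝔼[D²] ≤ K and to a mean squared error of at most
-- K / K² = 1/K (energy-step, select-energy).  Such a T exists because
-- 𝔼[D f] is the average of 𝔼[D T] over all T that arise from R.  One is
-- found in a single pass over R: by linearity, the contribution of a toss
-- node is the average of those of its two subtrees, and the subtree with
-- the smaller contribution is kept (choose-improves).  A contribution is an
-- expectation over the inputs x that agree with the bits read on the way to
-- the node, and at a leaf with label p it is p times the conditional
-- expectation of D.  The latter is computed by averaging over a tree while
-- recording the bits that have been read (mean-≐, choose-exact).
--
-- All these quantities are exact fractions.  Their denominators are products
-- of denominators of labels and of powers of two, each factor being paid for
-- by a leaf or a node of some tree, so numerators and denominators have
-- polynomially many digits (mean-fits, choose-fits).  Each function of the
-- program makes a number of calls that is polynomial in this number of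
-- digits and in the sizes of the trees; main-runs collects the result.

open import Defs
open import Data.Bool.Base using (Bool; true; false; if_then_else_)
open import Data.Empty using (⊥-elim)
open import Data.Fin.Base as Fin using (Fin; zero; suc)
import Data.Fin.Properties as Fin
open import Data.Integer.Base as ℤ using (∣_∣)
import Data.Integer.Properties as ℤ
open import Data.List.Base using (List; []; _∷_; length)
open import Data.List.Relation.Unary.All using (All; []; _∷_)
open import Data.Maybe.Base using (Maybe; just; nothing)
open import Data.Nat.Base as ℕ using (ℕ; zero; suc; s≤s; z≤n)
import Data.Nat.DivMod as ℕ
import Data.Nat.Properties as ℕ
open import Data.Nat.Binary.Base as B using (ℕᵇ; zero; 2[1+_]; 1+[2_]; toℕ; fromℕ)
import Data.Nat.Binary.Properties as B
open import Data.Nat.Tactic.RingSolver using (solve-∀)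
open import Data.Product.Base using (Σ-syntax; ∃-syntax; _×_; _,_; proj₁; proj₂)
open import Data.Rational.Base as ℚ using (ℚ; 0ℚ; 1ℚ; ½; ↥_; ↧ₙ_; mkℚ; NonNegative; Positive)
import Data.Rational.Properties as ℚ
open import Data.Rational.Solver using (module +-*-Solver)
open +-*-Solver using (solve; _:+_; _:*_; _:-_; :-_; _:=_; con)
open import Data.Rational.Unnormalised.Base as ℚᵘ using (mkℚᵘ; *≡*; *≤*)
import Data.Rational.Unnormalised.Properties as ℚᵘ
open import Data.Vec.Base using (Vec; []; _∷_; lookup; map; _[_]≔_)
import Data.Vec.Properties as Vec
open import Function.Base using (_∘_)
open import Relation.Binary.PropositionalEquality
  using (_≡_; _≢_; refl; sym; trans; cong; cong₂; subst; subst₂; module ≡-Reasoning)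
open import Relation.Nullary.Decidable using (yes; no; toWitness)

private variable
  n : ℕ

module Computation where

  open import Data.Nat.Base using (_+_; _*_; _≤_; _<_)

  private variable
    k : ℕ

  -- Counting calls instead of steps

  -- A bound on the number of steps spent in an expression itself, outside the
  -- bodies of the functions that it calls.
  weight : ∀ {F} {arity : Fin F → ℕ} {k} → Expr arity k → ℕ
  weight (var _)        = 1
  weight nil            = 1
  weight (cons _ _)     = 1
  weight (match _ e e′) = suc (weight e + weight e′)
  weight (bind e e′)    = suc (weight e + weight e′)
  weight (call _ _)     = 1
  weight (query _)      = 1

  -- If the weights of all bodies are at most W, then each call contributes at
  -- most W steps of its own, so it suffices to count calls.  This keeps constant
  -- factors out of the recurrences below.
  module Calls (P : Program) (W : ℕ)
               (weight≤W : ∀ f → weight (Program.body P f) ≤ W)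
               {n} (x : Vec Bool n) where
    open Program P
    open Semantics P x

    infix 3 _⊢_↦_⟨_,_⟩
    -- The number q bounds the queries, and c bounds the calls made by e, directly
    -- or indirectly.
    record _⊢_↦_⟨_,_⟩ {k} (ρ : Vec Tree k) (e : Expr arity k) (v : Tree) (c q : ℕ) : Set where
      constructor runs
      field
        {steps queries} : ℕ
        derivation      : ρ ⊢ e ⇓ v [ steps , queries ]
        steps≤          : steps ≤ weight e + W * c
        queries≤        : queries ≤ q

    private variable
      c c′ q q′ : ℕ
      ρ : Vec Tree k
      t u v w : Tree
      e e′ : Expr arity k
      i j : Fin k

    private
      s≤s+ : ∀ {m} n a {k} → m ≤ n + k → suc m ≤ suc (a + n) + k
      s≤s+ n a {k} p = s≤s (ℕ.≤-trans p (ℕ.+-monoˡ-≤ k (ℕ.m≤n+m _ a)))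

      s≤s+′ : ∀ {m} n a {k} → m ≤ n + k → suc m ≤ suc (n + a) + k
      s≤s+′ n a {k} p = s≤s (ℕ.≤-trans p (ℕ.+-monoˡ-≤ k (ℕ.m≤m+n _ a)))

    weaken : c ≤ c′ → q ≤ q′ → ρ ⊢ e ↦ v ⟨ c , q ⟩ → ρ ⊢ e ↦ v ⟨ c′ , q′ ⟩
    weaken {e = e} c≤ q≤ (runs d s≤ r≤) =
      runs d (ℕ.≤-trans s≤ (ℕ.+-monoʳ-≤ (weight e) (ℕ.*-monoʳ-≤ W c≤))) (ℕ.≤-trans r≤ q≤)

    at-most : c ≤ c′ → ρ ⊢ e ↦ v ⟨ c , q ⟩ → ρ ⊢ e ↦ v ⟨ c′ , q ⟩
    at-most c≤ = weaken c≤ ℕ.≤-refl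

    returning : v ≡ w → ρ ⊢ e ↦ v ⟨ c , q ⟩ → ρ ⊢ e ↦ w ⟨ c , q ⟩
    returning refl r = r

    varᵣ : ρ ⊢ var i ↦ lookup ρ i ⟨ 0 , 0 ⟩
    varᵣ = runs var (ℕ.m≤m+n 1 _) ℕ.≤-refl

    var≡ᵣ : lookup ρ i ≡ v → ρ ⊢ var i ↦ v ⟨ 0 , 0 ⟩
    var≡ᵣ refl = varᵣ

    nilᵣ : ρ ⊢ nil ↦ nil ⟨ 0 , 0 ⟩
    nilᵣ = runs nil (ℕ.m≤m+n 1 _) ℕ.≤-refl

    consᵣ : ρ ⊢ cons i j ↦ lookup ρ i ∙ lookup ρ j ⟨ 0 , 0 ⟩
    consᵣ = runs cons (ℕ.m≤m+n 1 _) ℕ.≤-refl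

    match-nilᵣ : lookup ρ i ≡ nil → ρ ⊢ e ↦ v ⟨ c , q ⟩ → ρ ⊢ match i e e′ ↦ v ⟨ c , q ⟩
    match-nilᵣ {e = e} {e′ = e′} eq (runs d s≤ q≤) = runs (match-nil eq d) (s≤s+′ (weight e) (weight e′) s≤) q≤

    match-consᵣ : lookup ρ i ≡ t ∙ u → t ∷ u ∷ ρ ⊢ e′ ↦ v ⟨ c , q ⟩ →
                  ρ ⊢ match i e e′ ↦ v ⟨ c , q ⟩
    match-consᵣ {e′ = e′} {e = e} eq (runs d s≤ q≤) = runs (match-cons eq d) (s≤s+ (weight e′) (weight e) s≤) q≤

    -- The calls of the continuation come first in the sum: when it makes none,
    -- the sum reduces.
    bindᵣ : ρ ⊢ e ↦ v ⟨ c , q ⟩ → v ∷ ρ ⊢ e′ ↦ w ⟨ c′ , q′ ⟩ →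
            ρ ⊢ bind e e′ ↦ w ⟨ c′ + c , q + q′ ⟩
    bindᵣ {e = e} {c = c} {e′ = e′} {c′ = c′} (runs d s≤ q≤) (runs d′ s≤′ q≤′) =
      runs (bind d d′)
        (s≤s (ℕ.≤-trans (ℕ.+-mono-≤ s≤ s≤′)
          (ℕ.≤-reflexive (rearrange (weight e) (weight e′) W c c′))))
        (ℕ.+-mono-≤ q≤ q≤′)
      where
      rearrange : ∀ a b W c c′ → (a + W * c) + (b + W * c′) ≡ (a + b) + W * (c′ + c)
      rearrange = solve-∀

    -- One step goes to the call instruction, which weighs 1, and the local steps
    -- of the body are paid for by the factor W of the additional call.
    callᵣ : ∀ {f is} → map (lookup ρ) is ⊢ body f ↦ v ⟨ c , q ⟩ →
            ρ ⊢ call f is ↦ v ⟨ suc c , q ⟩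
    callᵣ {c = c} {f = f} (runs d s≤ q≤) = runs (call d)
      (s≤s (ℕ.≤-trans s≤ (ℕ.≤-trans (ℕ.+-monoˡ-≤ (W * c) (weight≤W f))
         (ℕ.≤-reflexive (sym (ℕ.*-suc W c))))))
      q≤

    queryᵣ : ∀ {c : Fin n} → lookup ρ i ≡ encodeℕ (Fin.toℕ c) →
             ρ ⊢ query i ↦ encodeBool (lookup x c) ⟨ 0 , 1 ⟩
    queryᵣ eq = runs (query eq) (ℕ.m≤m+n 1 _) ℕ.≤-refl

  -- The program

  -- De Bruijn indices.
  pattern v0  = zero
  pattern v1  = suc v0
  pattern v2  = suc v1
  pattern v3  = suc v2
  pattern v4  = suc v3
  pattern v5  = suc v4
  pattern v6  = suc v5
  pattern v7  = suc v6
  pattern v8  = suc v7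
  pattern v9  = suc v8
  pattern v10 = suc v9
  pattern v11 = suc v10
  pattern v12 = suc v11
  pattern v13 = suc v12
  pattern v14 = suc v13
  pattern v15 = suc v14
  pattern v16 = suc v15
  pattern v17 = suc v16
  pattern v18 = suc v17
  pattern v19 = suc v18
  pattern v20 = suc v19
  pattern v21 = suc v20

  -- Functions on numerals; on fractions, i.e. pairs of numerals, where FMID is the
  -- mean of two; on assignments, i.e. lists of pairs of a variable and a bit; on
  -- trees and lists of trees; on unary numbers; and the evaluation on the input.
  pattern SUC    = v0
  pattern DOUBLE = v1
  pattern ADD    = v2
  pattern MUL    = v3
  pattern CMP    = v4
  pattern FADD   = v5
  pattern FMUL   = v6
  pattern FMID   = v7
  pattern FCMP   = v8
  pattern FIND   = v9
  pattern FIX0   = v10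
  pattern FIX1   = v11
  pattern MEAN   = v12
  pattern SUM    = v13
  pattern JOIN   = v14
  pattern PICK   = v15
  pattern CHOOSE = v16
  pattern DUP    = v17
  pattern UNARY  = v18
  pattern LOOP   = v19
  pattern RUN    = v20
  pattern RUNALL = v21

  arity : Fin 22 → ℕ
  arity SUC    = 1
  arity DOUBLE = 1
  arity ADD    = 2
  arity MUL    = 2
  arity CMP    = 2
  arity FADD   = 2
  arity FMUL   = 2
  arity FMID   = 2
  arity FCMP   = 2
  arity FIND   = 2
  arity FIX0   = 2
  arity FIX1   = 2
  arity MEAN   = 2
  arity SUM    = 2
  arity JOIN   = 4
  arity PICK   = 2
  arity CHOOSE = 4
  arity DUP    = 1
  arity UNARY  = 1
  arity LOOP   = 4
  arity RUN    = 1
  arity RUNALL = 1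

  Code : ℕ → Set
  Code = Expr arity

  uncons : Fin k → Code (2 + k) → Code k
  uncons i = match i nil

  -- The encodings of two comparison results and of the fraction 0 / 1.
  returnLt returnGt returnZero : Code k
  returnLt   = bind nil (cons v0 v0)
  returnGt   = bind nil (bind (cons v0 v0) (cons v1 v0))
  returnZero = bind nil (bind (cons v0 v0) (cons v1 v0))

  -- Branches on the kind of a tree and brings its parts into scope: two
  -- variables at a leaf (the second is the label), and eight at an inner node,
  -- the first two being the subtrees and, at a decision node, the third being
  -- the queried variable.
  caseRDT : Fin k → Code (2 + k) → Code (8 + k) → Code (8 + k) → Code k
  caseRDT t onLeaf onDecide onToss =
    uncons t (match v0 onLeaf (match v1 (uncons v3 (uncons v1 onDecide))
                                        (uncons v5 onToss)))

  -- The comments list the variables in scope, v0 first.  A variable known to be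
  -- nil, or a tag or digit known to be a particular tree, is reused wherever this
  -- constant is needed.
  body : (f : Fin 22) → Code (arity f)
  body SUC =
    match v0 (cons v0 v0)
      (match v0 (bind (cons v0 v0) (cons v0 v2))
                (bind (call SUC (v3 ∷ [])) (cons v1 v0)))
  body DOUBLE =
    match v0 (var v0)
      (match v0 (bind (call DOUBLE (v1 ∷ [])) (bind (cons v1 v1) (cons v0 v1)))
                (bind (cons v0 v3) (cons v3 v0)))
  body ADD =
    match v0 (var v1)
      (match v3 (var v2)
        -- e y′ d x′ x y
        (bind (call ADD (v3 ∷ v1 ∷ []))
          -- z e y′ d x′ x y
          (match v1
            (match v3 (bind (cons v3 v3) (cons v0 v1))
                      (bind (call SUC (v2 ∷ [])) (cons v1 v0)))
            (match v5 (bind (call SUC (v2 ∷ [])) (cons v6 v0))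
                      (bind (call SUC (v4 ∷ [])) (cons v6 v0))))))
  body MUL =
    match v1 (var v1)
      (bind (call MUL (v2 ∷ v1 ∷ []))
        (match v1 (bind (call DOUBLE (v0 ∷ [])) (call ADD (v4 ∷ v0 ∷ [])))
                  (bind (call ADD (v5 ∷ v2 ∷ [])) (call DOUBLE (v0 ∷ [])))))
  body CMP =
    match v0 (match v1 nil returnLt)
      (match v3 returnGt
        (bind (call CMP (v3 ∷ v1 ∷ []))
          (match v0
            (match v3 (match v1 nil returnLt)
                      (match v3 returnGt nil))
            (var v2))))
  body FADD =
    uncons v0 (uncons v3
      -- c d a b f g
      (bind (call MUL (v2 ∷ v1 ∷ []))
      (bind (call MUL (v1 ∷ v4 ∷ []))
      (bind (call ADD (v1 ∷ v0 ∷ []))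
      (bind (call MUL (v6 ∷ v4 ∷ []))
      (cons v1 v0))))))
  body FMUL =
    uncons v0 (uncons v3
      (bind (call MUL (v2 ∷ v0 ∷ []))
      (bind (call MUL (v4 ∷ v2 ∷ []))
      (cons v1 v0))))
  body FMID =
    bind (call FADD (v0 ∷ v1 ∷ []))
    (uncons v0
    (bind (call DOUBLE (v1 ∷ []))
    (cons v1 v0)))
  body FCMP =
    uncons v0 (uncons v3
      (bind (call MUL (v2 ∷ v1 ∷ []))
      (bind (call MUL (v1 ∷ v4 ∷ []))
      (call CMP (v1 ∷ v0 ∷ [])))))
  body FIND =
    match v0 (var v0)
      -- e ρ′ ρ i
      (uncons v0
        -- j b e ρ′ ρ i
        (bind (call CMP (v5 ∷ v0 ∷ []))
          (match v0 (cons v0 v2)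
                    (call FIND (v6 ∷ v8 ∷ [])))))
  body FIX0 = bind nil (bind (cons v2 v0) (cons v0 v2))
  body FIX1 = bind nil (bind (cons v0 v0) (bind (cons v3 v0) (cons v0 v3)))
  body MEAN =
    -- ρ T
    caseRDT v1 (var v1)
      -- T₀ T₁ i _ _ _ _ _ ρ T
      (bind (call FIND (v8 ∷ v2 ∷ []))
        (match v0
          (bind (call FIX0 (v9 ∷ v3 ∷ []))
          (bind (call MEAN (v0 ∷ v2 ∷ []))
          (bind (call FIX1 (v11 ∷ v5 ∷ []))
          (bind (call MEAN (v0 ∷ v5 ∷ []))
          (call FMID (v2 ∷ v0 ∷ []))))))
          (match v1 (call MEAN (v11 ∷ v3 ∷ []))
                    (call MEAN (v13 ∷ v6 ∷ [])))))
      -- T₀ T₁ _ _ _ _ _ _ ρ T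
      (bind (call MEAN (v8 ∷ v0 ∷ []))
      (bind (call MEAN (v9 ∷ v2 ∷ []))
      (call FMID (v1 ∷ v0 ∷ []))))
  body SUM =
    match v1 returnZero
      (bind (call MEAN (v2 ∷ v0 ∷ []))
      (bind (call SUM (v3 ∷ v2 ∷ []))
      (call FADD (v1 ∷ v0 ∷ []))))
  body JOIN =
    -- tag i C₀ C₁
    uncons v2 (uncons v1 (uncons v7 (uncons v1
      -- P₁ Q₁ U₁ _ P₀ Q₀ U₀ _ tag i C₀ C₁
      (bind (call FMID (v4 ∷ v0 ∷ []))
      (bind (call FMID (v6 ∷ v2 ∷ []))
      (bind (cons v1 v0)
      (bind (cons v9 v5)
      (bind (cons v13 v0)
      (bind (cons v13 v0)
      (cons v0 v3))))))))))
  body PICK =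
    -- C₀ C₁
    uncons v0 (uncons v1 (uncons v5 (uncons v1
      -- P₁ Q₁ U₁ _ P₀ Q₀ U₀ _ C₀ C₁
      (bind (call FADD (v4 ∷ v1 ∷ []))
      (bind (call FADD (v1 ∷ v6 ∷ []))
      (bind (call FCMP (v1 ∷ v0 ∷ []))
      (match v0 (var v11)
        (match v1 (var v13) (var v16)))))))))
  body CHOOSE =
    -- ρ T Ts Rs
    caseRDT v1
      -- _ p ρ T Ts Rs
      (bind (call SUM (v2 ∷ v4 ∷ []))
      (bind (call FMUL (v2 ∷ v0 ∷ []))
      (bind (call SUM (v4 ∷ v7 ∷ []))
      (bind (call FMUL (v4 ∷ v0 ∷ []))
      (bind (cons v2 v0)
      (cons v8 v0))))))
      -- T₀ T₁ i _ _ _ tag _ ρ T Ts Rs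
      (bind (call FIND (v8 ∷ v2 ∷ []))
        (match v0
          (bind (call FIX0 (v9 ∷ v3 ∷ []))
          (bind (call CHOOSE (v0 ∷ v2 ∷ v12 ∷ v13 ∷ []))
          (bind (call FIX1 (v11 ∷ v5 ∷ []))
          (bind (call CHOOSE (v0 ∷ v5 ∷ v14 ∷ v15 ∷ []))
          (call JOIN (v11 ∷ v7 ∷ v2 ∷ v0 ∷ []))))))
          (match v1 (call CHOOSE (v11 ∷ v3 ∷ v13 ∷ v14 ∷ []))
                    (call CHOOSE (v13 ∷ v6 ∷ v15 ∷ v16 ∷ [])))))
      -- T₀ T₁ _ _ _ _ _ _ ρ T Ts Rs
      (bind (call CHOOSE (v8 ∷ v0 ∷ v10 ∷ v11 ∷ []))
      (bind (call CHOOSE (v9 ∷ v2 ∷ v11 ∷ v12 ∷ []))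
      (call PICK (v1 ∷ v0 ∷ []))))
  body DUP =
    match v0 (var v0)
      (bind (call DUP (v1 ∷ []))
      (bind (cons v1 v0)
      (cons v2 v0)))
  body UNARY =
    match v0 (var v0)
      (bind (call UNARY (v1 ∷ []))
      (bind (call DUP (v0 ∷ []))
      (match v2 (cons v2 v0)
                (bind (cons v0 v2) (cons v1 v0)))))
  body LOOP =
    -- u R Ts Rs
    match v0 (var v2)
      -- nil u′ u R Ts Rs
      (bind (call CHOOSE (v0 ∷ v3 ∷ v4 ∷ v5 ∷ []))
      (uncons v0
      (bind (cons v0 v7)
      (bind (cons v7 v9)
      (call LOOP (v6 ∷ v8 ∷ v1 ∷ v0 ∷ []))))))
  body RUN =
    caseRDT v0 (var v1)
      (bind (query v2)
        (match v0 (call RUN (v1 ∷ []))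
                  (call RUN (v4 ∷ []))))
      (call RUN (v0 ∷ []))
  body RUNALL =
    match v0 returnZero
      (bind (call RUN (v0 ∷ []))
      (bind (call RUNALL (v2 ∷ []))
      (call FADD (v1 ∷ v0 ∷ []))))

  program : Program
  program = record
    { F = 22
    ; arity = arity
    ; body = body
    ; main =
      uncons v1
      (bind (call SUC (v0 ∷ []))
      (bind (call UNARY (v0 ∷ []))
      (bind nil
      (bind (call LOOP (v1 ∷ v5 ∷ v0 ∷ v0 ∷ []))
      (bind (call RUNALL (v0 ∷ []))
      (uncons v0
      (bind (call MUL (v1 ∷ v6 ∷ []))
      (cons v1 v0))))))))
    }

  weight≤ : ∀ f → weight (body f) ≤ 50
  weight≤ = toWitness {a? = Fin.all? (λ f → weight (body f) ℕ.≤? 50)} _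

  -- Arithmetic on binary numerals

  -- Schoolbook multiplication, by recursion on the second factor only, as in the
  -- program: each digit costs one doubling and one addition.
  mul : ℕᵇ → ℕᵇ → ℕᵇ
  mul x zero     = zero
  mul x 1+[2 y ] = x B.+ B.double (mul x y)
  mul x 2[1+ y ] = B.double (x B.+ mul x y)

  toℕ-mul : ∀ x y → toℕ (mul x y) ≡ toℕ x * toℕ y
  toℕ-mul x zero     = sym (ℕ.*-zeroʳ (toℕ x))
  toℕ-mul x 1+[2 y ]
    rewrite B.toℕ-homo-+ x (B.double (mul x y)) | B.toℕ-double (mul x y) | toℕ-mul x y =
    lemma (toℕ x) (toℕ y)
    where
    lemma : ∀ a b → a + 2 * (a * b) ≡ a * suc (2 * b)
    lemma = solve-∀
  toℕ-mul x 2[1+ y ]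
    rewrite B.toℕ-double (x B.+ mul x y) | B.toℕ-homo-+ x (mul x y) | toℕ-mul x y =
    lemma (toℕ x) (toℕ y)
    where
    lemma : ∀ a b → 2 * (a + a * b) ≡ a * (2 * suc b)
    lemma = solve-∀

  data Order : Set where
    eq lt gt : Order

  infixl 5 _▷_
  -- The more significant digits decide first.
  _▷_ : Order → Order → Order
  eq ▷ o = o
  lt ▷ _ = lt
  gt ▷ _ = gt

  -- In bijective numerals, too, a difference in the higher digits outweighs the
  -- last digit, which is 1 or 2.
  compare : ℕᵇ → ℕᵇ → Order
  compare zero     zero     = eq
  compare zero     1+[2 _ ] = lt
  compare zero     2[1+ _ ] = lt
  compare 1+[2 _ ] zero     = gt
  compare 2[1+ _ ] zero     = gt
  compare 1+[2 x ] 1+[2 y ] = compare x y ▷ eq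
  compare 1+[2 x ] 2[1+ y ] = compare x y ▷ lt
  compare 2[1+ x ] 1+[2 y ] = compare x y ▷ gt
  compare 2[1+ x ] 2[1+ y ] = compare x y ▷ eq

  Means : Order → ℕ → ℕ → Set
  Means eq = _≡_
  Means lt = _<_
  Means gt a b = b < a

  private
    odd<even : ∀ {a b} → a ≤ b → suc (2 * a) < 2 * suc b
    odd<even {a} {b} p = subst (suc (suc (2 * a)) ≤_) (sym (ℕ.*-suc 2 b)) (s≤s (s≤s (ℕ.*-monoʳ-≤ 2 p)))

    even<odd : ∀ {a b} → a < b → 2 * suc a < suc (2 * b)
    even<odd p = s≤s (ℕ.*-monoʳ-≤ 2 p)

  compare-means : ∀ x y → Means (compare x y) (toℕ x) (toℕ y)
  compare-means zero     zero     = refl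
  compare-means zero     1+[2 _ ] = s≤s z≤n
  compare-means zero     2[1+ _ ] = s≤s z≤n
  compare-means 1+[2 _ ] zero     = s≤s z≤n
  compare-means 2[1+ _ ] zero     = s≤s z≤n
  compare-means 1+[2 x ] 1+[2 y ] with compare x y | compare-means x y
  ... | eq | p = cong (λ a → suc (2 * a)) p
  ... | lt | p = s≤s (ℕ.*-monoʳ-< 2 p)
  ... | gt | p = s≤s (ℕ.*-monoʳ-< 2 p)
  compare-means 1+[2 x ] 2[1+ y ] with compare x y | compare-means x y
  ... | eq | p = odd<even (ℕ.≤-reflexive p)
  ... | lt | p = odd<even (ℕ.<⇒≤ p)
  ... | gt | p = even<odd p
  compare-means 2[1+ x ] 1+[2 y ] with compare x y | compare-means x y
  ... | eq | p = odd<even (ℕ.≤-reflexive (sym p))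
  ... | lt | p = even<odd p
  ... | gt | p = odd<even (ℕ.<⇒≤ p)
  compare-means 2[1+ x ] 2[1+ y ] with compare x y | compare-means x y
  ... | eq | p = cong (λ a → 2 * suc a) p
  ... | lt | p = ℕ.*-monoʳ-< 2 (s≤s p)
  ... | gt | p = ℕ.*-monoʳ-< 2 (s≤s p)

  encodeOrder : Order → Tree
  encodeOrder eq = nil
  encodeOrder lt = nil ∙ nil
  encodeOrder gt = nil ∙ nil ∙ nil

  infix 4 _fits_
  -- The number x has at most L digits: a bijective numeral with L + 1 digits is at
  -- least 1 + 2 + ... + 2^L.  A bound on the value is easier to propagate through
  -- sums and products than a bound on the number of digits.
  record _fits_ (x : ℕᵇ) (L : ℕ) : Set where
    constructor fit
    field
      below : toℕ x < 2 ℕ.^ L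

  fits-mono : ∀ {x L M} → L ≤ M → x fits L → x fits M
  fits-mono L≤M (fit p) = fit (ℕ.<-≤-trans p (ℕ.^-monoʳ-≤ 2 L≤M))

  -- Each digit removed lowers the bound by one; this drives the inductions on
  -- the digits.
  odd-fits : ∀ {x L} → 1+[2 x ] fits L → ∃[ M ] L ≡ suc M × x fits M
  odd-fits {L = zero}  (fit (s≤s ()))
  odd-fits {x} {suc M} (fit p) =
    M , refl , fit (ℕ.*-cancelˡ-< 2 (toℕ x) (2 ℕ.^ M) (ℕ.<-trans (ℕ.n<1+n _) p))

  even-fits : ∀ {x L} → 2[1+ x ] fits L → ∃[ M ] L ≡ suc M × x fits M
  even-fits {L = zero}  (fit (s≤s ()))
  even-fits {x} {suc M} (fit p) =
    M , refl , fit (ℕ.<-trans (ℕ.n<1+n _) (ℕ.*-cancelˡ-< 2 (suc (toℕ x)) (2 ℕ.^ M) p))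

  +-fits : ∀ {x y L} → x fits L → y fits L → (x B.+ y) fits suc L
  +-fits {x} {y} {L} (fit p) (fit q) = fit goal
    where
    goal : toℕ (x B.+ y) < 2 ℕ.^ suc L
    goal rewrite B.toℕ-homo-+ x y | ℕ.+-identityʳ (2 ℕ.^ L) = ℕ.+-mono-< p q

  double-fits : ∀ {x L} → x fits L → B.double x fits suc L
  double-fits {x} {L} (fit p) =
    fit (subst (_< 2 ℕ.^ suc L) (sym (B.toℕ-double x)) (ℕ.*-monoʳ-< 2 p))

  mul-fits : ∀ {x y L M} → x fits L → y fits M → mul x y fits (L + M)
  mul-fits {x} {y} {L} {M} (fit p) (fit q) =
    fit (subst₂ _<_ (sym (toℕ-mul x y)) (sym (ℕ.^-distribˡ-+-* 2 L M)) (ℕ.*-mono-< p q))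

  module Arithmetic {n} (x : Vec Bool n) where
    open Calls program 50 weight≤ x public

    suc-runs : ∀ {L} a → a fits L → encodeℕᵇ a ∷ [] ⊢ body SUC ↦ encodeℕᵇ (B.suc a) ⟨ L , 0 ⟩
    suc-runs zero     p = at-most z≤n (match-nilᵣ refl consᵣ)
    suc-runs 1+[2 a ] p = at-most z≤n (match-consᵣ refl (match-nilᵣ refl (bindᵣ consᵣ consᵣ)))
    suc-runs 2[1+ a ] p with even-fits p
    ... | L , refl , p′ =
      match-consᵣ refl (match-consᵣ refl (bindᵣ (callᵣ (suc-runs a p′)) consᵣ))

    double-runs : ∀ {L} a → a fits L →
                  encodeℕᵇ a ∷ [] ⊢ body DOUBLE ↦ encodeℕᵇ (B.double a) ⟨ L , 0 ⟩
    double-runs zero     p = at-most z≤n (match-nilᵣ refl varᵣ)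
    double-runs 2[1+ a ] p = at-most z≤n (match-consᵣ refl (match-consᵣ refl (bindᵣ consᵣ consᵣ)))
    double-runs 1+[2 a ] p with odd-fits p
    ... | L , refl , p′ =
      match-consᵣ refl (match-nilᵣ refl (bindᵣ (callᵣ (double-runs a p′)) (bindᵣ consᵣ consᵣ)))

    compare-runs : ∀ {L} a b → a fits L →
                   encodeℕᵇ a ∷ encodeℕᵇ b ∷ [] ⊢ body CMP ↦ encodeOrder (compare a b) ⟨ L , 0 ⟩
    compare-runs zero zero     p = at-most z≤n (match-nilᵣ refl (match-nilᵣ refl nilᵣ))
    compare-runs zero 1+[2 _ ] p = at-most z≤n (match-nilᵣ refl (match-consᵣ refl (bindᵣ nilᵣ consᵣ)))
    compare-runs zero 2[1+ _ ] p = at-most z≤n (match-nilᵣ refl (match-consᵣ refl (bindᵣ nilᵣ consᵣ)))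
    compare-runs 1+[2 _ ] zero p =
      at-most z≤n (match-consᵣ refl (match-nilᵣ refl (bindᵣ nilᵣ (bindᵣ consᵣ consᵣ))))
    compare-runs 2[1+ _ ] zero p =
      at-most z≤n (match-consᵣ refl (match-nilᵣ refl (bindᵣ nilᵣ (bindᵣ consᵣ consᵣ))))
    compare-runs 1+[2 a ] 1+[2 b ] p with odd-fits p
    ... | L , refl , p′ with compare a b | compare-runs a b p′
    ... | eq | r = match-consᵣ refl (match-consᵣ refl (bindᵣ (callᵣ r)
                     (match-nilᵣ refl (match-nilᵣ refl (match-nilᵣ refl nilᵣ)))))
    ... | lt | r = match-consᵣ refl (match-consᵣ refl (bindᵣ (callᵣ r) (match-consᵣ refl varᵣ)))
    ... | gt | r = match-consᵣ refl (match-consᵣ refl (bindᵣ (callᵣ r) (match-consᵣ refl varᵣ)))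
    compare-runs 1+[2 a ] 2[1+ b ] p with odd-fits p
    ... | L , refl , p′ with compare a b | compare-runs a b p′
    ... | eq | r = match-consᵣ refl (match-consᵣ refl (bindᵣ (callᵣ r)
                     (match-nilᵣ refl (match-nilᵣ refl (match-consᵣ refl (bindᵣ nilᵣ consᵣ))))))
    ... | lt | r = match-consᵣ refl (match-consᵣ refl (bindᵣ (callᵣ r) (match-consᵣ refl varᵣ)))
    ... | gt | r = match-consᵣ refl (match-consᵣ refl (bindᵣ (callᵣ r) (match-consᵣ refl varᵣ)))
    compare-runs 2[1+ a ] 1+[2 b ] p with even-fits p
    ... | L , refl , p′ with compare a b | compare-runs a b p′
    ... | eq | r = match-consᵣ refl (match-consᵣ refl (bindᵣ (callᵣ r)
                     (match-nilᵣ refl (match-consᵣ refl (match-nilᵣ refl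
                       (bindᵣ nilᵣ (bindᵣ consᵣ consᵣ)))))))
    ... | lt | r = match-consᵣ refl (match-consᵣ refl (bindᵣ (callᵣ r) (match-consᵣ refl varᵣ)))
    ... | gt | r = match-consᵣ refl (match-consᵣ refl (bindᵣ (callᵣ r) (match-consᵣ refl varᵣ)))
    compare-runs 2[1+ a ] 2[1+ b ] p with even-fits p
    ... | L , refl , p′ with compare a b | compare-runs a b p′
    ... | eq | r = match-consᵣ refl (match-consᵣ refl (bindᵣ (callᵣ r)
                     (match-nilᵣ refl (match-consᵣ refl (match-consᵣ refl nilᵣ)))))
    ... | lt | r = match-consᵣ refl (match-consᵣ refl (bindᵣ (callᵣ r) (match-consᵣ refl varᵣ)))
    ... | gt | r = match-consᵣ refl (match-consᵣ refl (bindᵣ (callᵣ r) (match-consᵣ refl varᵣ)))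

    -- Each digit costs a recursive call and at most one call of the successor
    -- function on a partial sum, which fits into w digits.
    add-calls : ℕ → ℕ → ℕ
    add-calls w L = L * (2 + w)

    add-runs : ∀ {w L} a b → a fits L → b fits L → L ≤ w →
               encodeℕᵇ a ∷ encodeℕᵇ b ∷ [] ⊢ body ADD ↦ encodeℕᵇ (a B.+ b) ⟨ add-calls w L , 0 ⟩
    add-runs zero     b        p q _ = at-most z≤n (match-nilᵣ refl varᵣ)
    add-runs 1+[2 a ] zero     p q _ = at-most z≤n (match-consᵣ refl (match-nilᵣ refl varᵣ))
    add-runs 2[1+ a ] zero     p q _ = at-most z≤n (match-consᵣ refl (match-nilᵣ refl varᵣ))
    add-runs {w} 1+[2 a ] 1+[2 b ] p q l with odd-fits p | odd-fits q
    ... | L , refl , p′ | .L , refl , q′ =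
      at-most (s≤s (ℕ.m≤n+m _ (suc w))) (match-consᵣ refl (match-consᵣ refl
        (bindᵣ (callᵣ (add-runs {w} a b p′ q′ (ℕ.<⇒≤ l)))
               (match-nilᵣ refl (match-nilᵣ refl (bindᵣ consᵣ consᵣ))))))
    add-runs {w} 2[1+ a ] 1+[2 b ] p q l with even-fits p | odd-fits q
    ... | L , refl , p′ | .L , refl , q′ =
      at-most (ℕ.≤-reflexive (cong suc (ℕ.+-suc w _))) (match-consᵣ refl (match-consᵣ refl
        (bindᵣ (callᵣ (add-runs {w} a b p′ q′ (ℕ.<⇒≤ l)))
               (match-nilᵣ refl (match-consᵣ refl
                 (bindᵣ (callᵣ (suc-runs (a B.+ b) (fits-mono l (+-fits p′ q′)))) consᵣ))))))
    add-runs {w} 1+[2 a ] 2[1+ b ] p q l with odd-fits p | even-fits q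
    ... | L , refl , p′ | .L , refl , q′ =
      at-most (ℕ.≤-reflexive (cong suc (ℕ.+-suc w _))) (match-consᵣ refl (match-consᵣ refl
        (bindᵣ (callᵣ (add-runs {w} a b p′ q′ (ℕ.<⇒≤ l)))
               (match-consᵣ refl (match-nilᵣ refl
                 (bindᵣ (callᵣ (suc-runs (a B.+ b) (fits-mono l (+-fits p′ q′)))) consᵣ))))))
    add-runs {w} 2[1+ a ] 2[1+ b ] p q l with even-fits p | even-fits q
    ... | L , refl , p′ | .L , refl , q′ =
      at-most (ℕ.≤-reflexive (cong suc (ℕ.+-suc w _))) (match-consᵣ refl (match-consᵣ refl
        (bindᵣ (callᵣ (add-runs {w} a b p′ q′ (ℕ.<⇒≤ l)))
               (match-consᵣ refl (match-consᵣ refl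
                 (bindᵣ (callᵣ (suc-runs (a B.+ b) (fits-mono l (+-fits p′ q′)))) consᵣ))))))

  -- Fractions

  record Frac : Set where
    constructor _/_
    field
      num den : ℕᵇ

  open Frac public

  encodeFrac : Frac → Tree
  encodeFrac f = encodeℕᵇ (num f) ∙ encodeℕᵇ (den f)

  infixl 6 _⊕_
  infixl 7 _⊗_
  _⊕_ _⊗_ mid : Frac → Frac → Frac
  (a / b) ⊕ (c / d) = (mul a d B.+ mul c b) / mul b d
  (a / b) ⊗ (c / d) = mul a c / mul b d
  mid f g = num (f ⊕ g) / B.double (den (f ⊕ g))

  -- Cross multiplication.
  compareFrac : Frac → Frac → Order
  compareFrac (a / b) (c / d) = compare (mul a d) (mul c b)

  infix 4 _fitsᶠ_
  record _fitsᶠ_ (f : Frac) (L : ℕ) : Set where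
    constructor _,_
    field
      num-fits : num f fits L
      den-fits : den f fits L

  open _fitsᶠ_ public

  fitsᶠ-mono : ∀ {f L M} → L ≤ M → f fitsᶠ L → f fitsᶠ M
  fitsᶠ-mono L≤M (p , q) = fits-mono L≤M p , fits-mono L≤M q

  -- The numerator is a sum of two products, which costs one additional digit.
  ⊕-fits : ∀ {f g L M} → f fitsᶠ L → g fitsᶠ M → f ⊕ g fitsᶠ suc (L + M)
  ⊕-fits {L = L} {M} (a , b) (c , d) =
    +-fits (mul-fits a d) (fits-mono (ℕ.≤-reflexive (ℕ.+-comm M L)) (mul-fits c b)) ,
    fits-mono (ℕ.n≤1+n _) (mul-fits b d)

  ⊗-fits : ∀ {f g L M} → f fitsᶠ L → g fitsᶠ M → f ⊗ g fitsᶠ (L + M)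
  ⊗-fits (a , b) (c , d) = mul-fits a c , mul-fits b d

  mid-fits : ∀ {f g L M} → f fitsᶠ L → g fitsᶠ M → mid f g fitsᶠ suc (L + M)
  mid-fits p@(_ , b) q@(_ , d) = num-fits (⊕-fits p q) , double-fits (mul-fits b d)

  -- Bounds on the number of calls, the outermost call included, when all numbers
  -- in play fit into w digits.
  add-cost mul-step mul-cost ⊕-cost ⊗-cost mid-cost fcmp-cost : ℕ → ℕ
  add-cost  w = suc (w * (2 + w))
  mul-step  w = suc (add-cost w + suc w)
  mul-cost  w = suc (w * mul-step w)
  ⊕-cost    w = suc (mul-cost w + add-cost w + mul-cost w + mul-cost w)
  ⊗-cost    w = suc (mul-cost w + mul-cost w)
  mid-cost  w = suc (suc w + ⊕-cost w)
  fcmp-cost w = suc (suc w + mul-cost w + mul-cost w)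

  module FracArithmetic {n} (x : Vec Bool n) where
    open Arithmetic x public

    mul-runs : ∀ {w L M} a b → a fits L → b fits M → L + M ≤ w →
               encodeℕᵇ a ∷ encodeℕᵇ b ∷ [] ⊢ body MUL ↦ encodeℕᵇ (mul a b) ⟨ M * mul-step w , 0 ⟩
    mul-runs a zero p q l = at-most z≤n (match-nilᵣ refl varᵣ)
    mul-runs {w} {L} a 1+[2 b ] p q l with odd-fits q
    ... | M , refl , q′ = at-most (ℕ.≤-reflexive (ℕ.+-suc (add-cost w + suc w) _))
      (match-consᵣ refl
        (bindᵣ (callᵣ (mul-runs a b p q′ (ℕ.≤-trans (ℕ.+-monoʳ-≤ L (ℕ.n≤1+n M)) l)))
        (match-nilᵣ refl
          (bindᵣ (callᵣ (double-runs (mul a b) (fits-mono (ℕ.≤-trans (ℕ.+-monoʳ-≤ L (ℕ.n≤1+n M)) l) (mul-fits p q′))))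
          (callᵣ (add-runs a (B.double (mul a b))
            (fits-mono (ℕ.≤-trans (ℕ.m≤m+n L _) l) p)
            (fits-mono (ℕ.≤-trans (ℕ.≤-reflexive (sym (ℕ.+-suc L M))) l) (double-fits (mul-fits p q′)))
            ℕ.≤-refl))))))
    mul-runs {w} {L} a 2[1+ b ] p q l with even-fits q
    ... | M , refl , q′ =
      at-most (ℕ.≤-reflexive (trans (ℕ.+-suc (suc w + add-cost w) _)
                                    (cong (λ c → suc (c + M * mul-step w)) (ℕ.+-comm (suc w) (add-cost w)))))
      (match-consᵣ refl
        (bindᵣ (callᵣ (mul-runs a b p q′ (ℕ.<⇒≤ l′)))
        (match-consᵣ refl
          (bindᵣ (callᵣ (add-runs a (mul a b)
                   (fits-mono (ℕ.≤-trans (ℕ.m≤m+n L M) (ℕ.<⇒≤ l′)) p)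
                   (fits-mono (ℕ.<⇒≤ l′) (mul-fits p q′)) ℕ.≤-refl))
          (callᵣ (double-runs (a B.+ mul a b)
            (fits-mono l′ (+-fits (fits-mono (ℕ.m≤m+n L M) p) (mul-fits p q′)))))))))
      where
      l′ : suc (L + M) ≤ w
      l′ = ℕ.≤-trans (ℕ.≤-reflexive (sym (ℕ.+-suc L M))) l

    mul-call : ∀ {w L M} a b → a fits L → b fits M → L + M ≤ w →
               encodeℕᵇ a ∷ encodeℕᵇ b ∷ [] ⊢ body MUL ↦ encodeℕᵇ (mul a b) ⟨ w * mul-step w , 0 ⟩
    mul-call {w} {L} {M} a b p q l =
      at-most (ℕ.*-monoˡ-≤ (mul-step w) (ℕ.≤-trans (ℕ.m≤n+m M L) l)) (mul-runs a b p q l)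

    ⊕-runs : ∀ {w L M} f g → f fitsᶠ L → g fitsᶠ M → L + M < w →
             encodeFrac f ∷ encodeFrac g ∷ [] ⊢ body FADD ↦ encodeFrac (f ⊕ g)
             ⟨ mul-cost w + add-cost w + mul-cost w + mul-cost w , 0 ⟩
    ⊕-runs {w} {L} {M} f@(a / b) g@(c / d) (p , p′) (q , q′) l =
      match-consᵣ refl (match-consᵣ refl
        (bindᵣ (callᵣ (mul-call a d p q′ l₁))
        (bindᵣ (callᵣ (mul-call c b q p′ l₂))
        (bindᵣ (callᵣ (add-runs (mul a d) (mul c b)
                 (fits-mono l₁ (mul-fits p q′)) (fits-mono l₂ (mul-fits q p′)) ℕ.≤-refl))
        (bindᵣ (callᵣ (mul-call b d p′ q′ l₁))
        consᵣ)))))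
      where
      l₁ : L + M ≤ w
      l₁ = ℕ.<⇒≤ l
      l₂ : M + L ≤ w
      l₂ = ℕ.≤-trans (ℕ.≤-reflexive (ℕ.+-comm M L)) l₁

    ⊗-runs : ∀ {w L M} f g → f fitsᶠ L → g fitsᶠ M → L + M ≤ w →
             encodeFrac f ∷ encodeFrac g ∷ [] ⊢ body FMUL ↦ encodeFrac (f ⊗ g)
             ⟨ mul-cost w + mul-cost w , 0 ⟩
    ⊗-runs (a / b) (c / d) (p , p′) (q , q′) l =
      match-consᵣ refl (match-consᵣ refl
        (bindᵣ (callᵣ (mul-call a c p q l))
        (bindᵣ (callᵣ (mul-call b d p′ q′ l))
        consᵣ)))

    mid-runs : ∀ {w L M} f g → f fitsᶠ L → g fitsᶠ M → L + M < w →
               encodeFrac f ∷ encodeFrac g ∷ [] ⊢ body FMID ↦ encodeFrac (mid f g)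
               ⟨ suc w + ⊕-cost w , 0 ⟩
    mid-runs f g p q l =
      bindᵣ (callᵣ (⊕-runs f g p q l))
      (match-consᵣ refl
      (bindᵣ (callᵣ (double-runs (den (f ⊕ g)) (fits-mono (ℕ.<⇒≤ l) (mul-fits (den-fits p) (den-fits q)))))
      consᵣ))

    compareFrac-runs : ∀ {w L M} f g → f fitsᶠ L → g fitsᶠ M → L + M ≤ w →
      encodeFrac f ∷ encodeFrac g ∷ [] ⊢ body FCMP ↦ encodeOrder (compareFrac f g)
      ⟨ suc w + mul-cost w + mul-cost w , 0 ⟩
    compareFrac-runs {L = L} {M} (a / b) (c / d) (p , p′) (q , q′) l =
      match-consᵣ refl (match-consᵣ refl
        (bindᵣ (callᵣ (mul-call a d p q′ l))
        (bindᵣ (callᵣ (mul-call c b q p′ (ℕ.≤-trans (ℕ.≤-reflexive (ℕ.+-comm M L)) l)))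
        (callᵣ (compare-runs (mul a d) (mul c b) (fits-mono l (mul-fits p q′)))))))

  -- Conditional means of decision trees

  -- The bits read on the way to a node, the last one first.  No variable occurs
  -- twice, because a variable with a known value is not branched on again.
  Assignment : ℕ → Set
  Assignment n = List (Fin n × Bool)

  encodeAssignment : Assignment n → Tree
  encodeAssignment []            = nil
  encodeAssignment ((i , b) ∷ ρ) = (encodeℕ (Fin.toℕ i) ∙ encodeBool b) ∙ encodeAssignment ρ

  encodeMaybe : Maybe Bool → Tree
  encodeMaybe nothing  = nil
  encodeMaybe (just b) = nil ∙ encodeBool b

  index : Fin n → ℕᵇ
  index i = fromℕ (Fin.toℕ i)

  find : Assignment n → Fin n → Maybe Bool
  find []            i = nothing
  find ((j , b) ∷ ρ) i with compare (index i) (index j)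
  ... | eq = just b
  ... | lt = find ρ i
  ... | gt = find ρ i

  label : ℚ → Frac
  label p = fromℕ ∣ ↥ p ∣ / fromℕ (↧ₙ p)

  -- The expected label of the leaf reached by a random input that agrees with ρ:
  -- known variables are followed, the others and the random bits averaged over.
  mean : Assignment n → RDT n → Frac
  mean ρ (leaf p _)       = label p
  mean ρ (decide i T₀ T₁) with find ρ i
  ... | nothing    = mid (mean ((i , false) ∷ ρ) T₀) (mean ((i , true) ∷ ρ) T₁)
  ... | just false = mean ρ T₀
  ... | just true  = mean ρ T₁
  mean ρ (toss T₀ T₁)     = mid (mean ρ T₀) (mean ρ T₁)

  0ᶠ : Frac
  0ᶠ = zero / 1+[2 zero ]

  sumMeans : Assignment n → List (RDT n) → Frac
  sumMeans ρ []       = 0ᶠ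
  sumMeans ρ (T ∷ Ts) = mean ρ T ⊕ sumMeans ρ Ts

  -- A deterministic tree T together with the conditional expectations of S T
  -- and of F T, where S is the sum of the trees chosen so far and F is the same
  -- number of copies of R.  Two nonnegative numbers replace the signed
  -- expectation of D T for D = S - F.
  record Choice (n : ℕ) : Set where
    constructor choice
    field
      tree      : RDT n
      gain loss : Frac

  open Choice public

  join : Fin n → Choice n → Choice n → Choice n
  join i (choice T₀ P₀ Q₀) (choice T₁ P₁ Q₁) = choice (decide i T₀ T₁) (mid P₀ P₁) (mid Q₀ Q₁)

  pickBy : Order → Choice n → Choice n → Choice n
  pickBy eq C₀ C₁ = C₀
  pickBy lt C₀ C₁ = C₀
  pickBy gt C₀ C₁ = C₁

  -- Prefers the choice with the smaller difference gain - loss; the losses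
  -- are moved to the other side to avoid subtraction.
  pick : Choice n → Choice n → Choice n
  pick C₀ C₁ = pickBy (compareFrac (gain C₀ ⊕ loss C₁) (gain C₁ ⊕ loss C₀)) C₀ C₁

  -- Fixes the random bits of a tree so as to minimise gain - loss.  Here Ts are
  -- the trees chosen so far, and Rs consists of as many copies of R.
  choose : (Ts Rs : List (RDT n)) → Assignment n → RDT n → Choice n
  choose Ts Rs ρ (leaf p u)       =
    choice (leaf p u) (label p ⊗ sumMeans ρ Ts) (label p ⊗ sumMeans ρ Rs)
  choose Ts Rs ρ (decide i T₀ T₁) with find ρ i
  ... | nothing    = join i (choose Ts Rs ((i , false) ∷ ρ) T₀) (choose Ts Rs ((i , true) ∷ ρ) T₁)
  ... | just false = choose Ts Rs ρ T₀
  ... | just true  = choose Ts Rs ρ T₁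
  choose Ts Rs ρ (toss T₀ T₁)     = pick (choose Ts Rs ρ T₀) (choose Ts Rs ρ T₁)

  encodeTrees : List (RDT n) → Tree
  encodeTrees []       = nil
  encodeTrees (T ∷ Ts) = encodeRDT T ∙ encodeTrees Ts

  encodeChoice : Choice n → Tree
  encodeChoice C = encodeRDT (tree C) ∙ encodeFrac (gain C) ∙ encodeFrac (loss C)

  -- A digit takes at least two units of size.
  numeral-fits : ∀ a → a fits size (encodeℕᵇ a)
  numeral-fits zero     = fit (s≤s z≤n)
  numeral-fits 1+[2 a ] with numeral-fits a
  ... | fit p = fit (ℕ.≤-trans
    (ℕ.≤-trans (ℕ.≤-reflexive (sym (ℕ.*-suc 2 (toℕ a)))) (ℕ.*-monoʳ-≤ 2 p))
    (ℕ.^-monoʳ-≤ 2 (ℕ.n≤1+n (suc (size (encodeℕᵇ a))))))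
  numeral-fits 2[1+ a ] with numeral-fits a
  ... | fit p = fit (ℕ.≤-<-trans (ℕ.*-monoʳ-≤ 2 p)
    (ℕ.^-monoʳ-< 2 (s≤s (s≤s z≤n)) (ℕ.m≤n+m (suc (suc (size (encodeℕᵇ a)))) 2)))

  size-positive : ∀ t → 1 ≤ size t
  size-positive nil     = s≤s z≤n
  size-positive (_ ∙ _) = s≤s z≤n

  label-fits : ∀ p u → label p fitsᶠ descriptionLength {n} (leaf p u)
  label-fits p u = fits-mono (below₁ a b) (numeral-fits (fromℕ ∣ ↥ p ∣)) ,
                   fits-mono (below₂ a b) (numeral-fits (fromℕ (↧ₙ p)))
    where
    a = size (encodeℕ ∣ ↥ p ∣)
    b = size (encodeℕ (↧ₙ p))
    below₁ : ∀ a b → a ≤ 3 + (a + b)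
    below₁ a b = ℕ.≤-trans (ℕ.m≤m+n a b) (ℕ.m≤n+m (a + b) 3)
    below₂ : ∀ a b → b ≤ 3 + (a + b)
    below₂ a b = ℕ.≤-trans (ℕ.m≤n+m b a) (ℕ.m≤n+m (a + b) 3)

  index-fits : ∀ (i : Fin n) T₀ T₁ → index i fits descriptionLength (decide i T₀ T₁)
  index-fits i T₀ T₁ = fits-mono
    (ℕ.≤-trans (ℕ.m≤m+n (size (encodeℕ (Fin.toℕ i))) _) (ℕ.m≤n+m _ 5))
    (numeral-fits (index i))

  -- This accounting makes every bound below additive over the subtrees.
  decide-size : ∀ (i : Fin n) T₀ T₁ →
    suc (descriptionLength T₀ + descriptionLength T₁) ≤ descriptionLength (decide i T₀ T₁)
  decide-size i T₀ T₁ = ℕ.≤-trans (ℕ.m≤n+m _ (size (encodeℕ (Fin.toℕ i)))) (ℕ.m≤n+m _ 5)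

  toss-size : ∀ (T₀ T₁ : RDT n) →
    suc (descriptionLength T₀ + descriptionLength T₁) ≤ descriptionLength (toss T₀ T₁)
  toss-size T₀ T₁ = s≤s (ℕ.m≤n+m _ 6)

  left≤ : ∀ a b → a ≤ suc (a + b)
  left≤ a b = ℕ.≤-trans (ℕ.m≤m+n a b) (ℕ.n≤1+n _)

  right≤ : ∀ a b → b ≤ suc (a + b)
  right≤ a b = ℕ.≤-trans (ℕ.m≤n+m b a) (ℕ.n≤1+n _)

  decide-sizeˡ : ∀ (i : Fin n) T₀ T₁ → descriptionLength T₀ < descriptionLength (decide i T₀ T₁)
  decide-sizeˡ i T₀ T₁ = ℕ.≤-trans (s≤s (ℕ.m≤m+n _ _)) (decide-size i T₀ T₁)

  decide-sizeʳ : ∀ (i : Fin n) T₀ T₁ → descriptionLength T₁ < descriptionLength (decide i T₀ T₁)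
  decide-sizeʳ i T₀ T₁ = ℕ.≤-trans (s≤s (ℕ.m≤n+m _ (descriptionLength T₀))) (decide-size i T₀ T₁)

  toss-sizeˡ : ∀ (T₀ T₁ : RDT n) → descriptionLength T₀ < descriptionLength (toss T₀ T₁)
  toss-sizeˡ T₀ T₁ = ℕ.≤-trans (s≤s (ℕ.m≤m+n _ _)) (toss-size T₀ T₁)

  toss-sizeʳ : ∀ (T₀ T₁ : RDT n) → descriptionLength T₁ < descriptionLength (toss T₀ T₁)
  toss-sizeʳ T₀ T₁ = ℕ.≤-trans (s≤s (ℕ.m≤n+m _ (descriptionLength T₀))) (toss-size T₀ T₁)

  -- The mean of two fractions needs the digits of both and one more, which the
  -- node pays for.
  mean-fits : ∀ ρ (T : RDT n) → mean ρ T fitsᶠ descriptionLength T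
  mean-fits {n} ρ (leaf p u)   = label-fits {n} p u
  mean-fits ρ (decide i T₀ T₁) with find ρ i
  ... | nothing    = fitsᶠ-mono (decide-size i T₀ T₁) (mid-fits (mean-fits _ T₀) (mean-fits _ T₁))
  ... | just false = fitsᶠ-mono (ℕ.<⇒≤ (decide-sizeˡ i T₀ T₁)) (mean-fits ρ T₀)
  ... | just true  = fitsᶠ-mono (ℕ.<⇒≤ (decide-sizeʳ i T₀ T₁)) (mean-fits ρ T₁)
  mean-fits ρ (toss T₀ T₁)     =
    fitsᶠ-mono (toss-size T₀ T₁) (mid-fits (mean-fits ρ T₀) (mean-fits ρ T₁))

  sumMeans-fits : ∀ ρ (Ts : List (RDT n)) → sumMeans ρ Ts fitsᶠ size (encodeTrees Ts)
  sumMeans-fits ρ []       = fit (s≤s z≤n) , fit (s≤s (s≤s z≤n))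
  sumMeans-fits ρ (T ∷ Ts) = ⊕-fits (mean-fits ρ T) (sumMeans-fits ρ Ts)

  -- Bounds on the number of calls when all numbers fit into w digits and all
  -- assignments have at most H entries.  The suffix step stands for the share of
  -- one list entry or one tree node.
  find-step find-cost mean-step mean-cost sum-step sum-cost : ℕ → ℕ → ℕ
  find-step w H = 2 + w
  find-cost w H = suc (H * find-step w H)
  mean-step w H = 4 + mid-cost w + find-cost w H
  mean-cost w H = suc (w * mean-step w H)
  sum-step  w H = suc (⊕-cost w + mean-cost w H)
  sum-cost  w H = suc (w * sum-step w H)

  private
    find-eq : ∀ l w → suc (l * (2 + w)) + suc w ≡ (2 + w) + l * (2 + w)
    find-eq = solve-∀

    branch-cost : ∀ m f a b → m + suc (b * (4 + m + f)) + 1 + suc (a * (4 + m + f)) + 1 + f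
                            ≡ suc (a + b) * (4 + m + f)
    branch-cost = solve-∀

    single-cost : ∀ m f a → suc (a * (4 + m + f)) + f + (3 + m) ≡ suc a * (4 + m + f)
    single-cost = solve-∀

    toss-cost : ∀ m f a b → m + suc (b * (4 + m + f)) + suc (a * (4 + m + f)) + (2 + f)
                          ≡ suc (a + b) * (4 + m + f)
    toss-cost = solve-∀

  by-adding : ∀ {a c} b → a + b ≡ c → a ≤ c
  by-adding b refl = ℕ.m≤m+n _ b

  module TreeArithmetic {n} (x : Vec Bool n) where
    open FracArithmetic x public

    -- Derivations for the three branches of caseRDT; they make explicit which
    -- variables each branch has in scope.
    leafᵣ : ∀ {k c q v} {ρ : Vec Tree k} {t a b d} p (u : InUnit p) →
            lookup ρ t ≡ encodeRDT {n} (leaf p u) →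
            nil ∷ encodeFrac (label p) ∷ ρ ⊢ a ↦ v ⟨ c , q ⟩ →
            ρ ⊢ caseRDT t a b d ↦ v ⟨ c , q ⟩
    leafᵣ p u e r = match-consᵣ e (match-nilᵣ refl r)

    decideᵣ : ∀ {k c q v} {ρ : Vec Tree k} {t a b d} i T₀ T₁ →
              lookup ρ t ≡ encodeRDT {n} (decide i T₀ T₁) →
              encodeRDT T₀ ∷ encodeRDT T₁ ∷ encodeℕᵇ (index i) ∷ (encodeRDT T₀ ∙ encodeRDT T₁) ∷
                nil ∷ nil ∷ (nil ∙ nil) ∷ (encodeℕᵇ (index i) ∙ encodeRDT T₀ ∙ encodeRDT T₁) ∷ ρ
                ⊢ b ↦ v ⟨ c , q ⟩ →
              ρ ⊢ caseRDT t a b d ↦ v ⟨ c , q ⟩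
    decideᵣ i T₀ T₁ e r = match-consᵣ e (match-consᵣ refl (match-nilᵣ refl
                    (match-consᵣ refl (match-consᵣ refl r))))

    tossᵣ : ∀ {k c q v} {ρ : Vec Tree k} {t a b d} T₀ T₁ →
            lookup ρ t ≡ encodeRDT {n} (toss T₀ T₁) →
            encodeRDT T₀ ∷ encodeRDT T₁ ∷ nil ∷ nil ∷ nil ∷ (nil ∙ nil) ∷ (nil ∙ nil ∙ nil) ∷
              (encodeRDT T₀ ∙ encodeRDT T₁) ∷ ρ ⊢ d ↦ v ⟨ c , q ⟩ →
            ρ ⊢ caseRDT t a b d ↦ v ⟨ c , q ⟩
    tossᵣ T₀ T₁ e r = match-consᵣ e (match-consᵣ refl (match-consᵣ refl (match-consᵣ refl r)))

    find-runs : ∀ {w} ρ (i : Fin n) → index i fits w →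
                encodeAssignment ρ ∷ encodeℕᵇ (index i) ∷ [] ⊢ body FIND ↦ encodeMaybe (find ρ i)
                ⟨ length ρ * (2 + w) , 0 ⟩
    find-runs [] i p = match-nilᵣ refl varᵣ
    find-runs {w} ((j , b) ∷ ρ) i p
      with compare (index i) (index j) | compare-runs (index i) (index j) p
    ... | eq | r = at-most (ℕ.≤-trans (ℕ.n≤1+n _) (ℕ.m≤m+n (2 + w) _)) (match-consᵣ refl (match-consᵣ refl
                     (bindᵣ (callᵣ r) (match-nilᵣ refl consᵣ))))
    ... | lt | r = at-most (ℕ.≤-reflexive (find-eq (length ρ) w))
                     (match-consᵣ refl (match-consᵣ refl
                     (bindᵣ (callᵣ r) (match-consᵣ refl (callᵣ (find-runs ρ i p))))))
    ... | gt | r = at-most (ℕ.≤-reflexive (find-eq (length ρ) w))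
                     (match-consᵣ refl (match-consᵣ refl
                     (bindᵣ (callᵣ r) (match-consᵣ refl (callᵣ (find-runs ρ i p))))))

    fix0-runs : ∀ ρ (i : Fin n) → encodeAssignment ρ ∷ encodeℕᵇ (index i) ∷ [] ⊢ body FIX0 ↦
                encodeAssignment ((i , false) ∷ ρ) ⟨ 0 , 0 ⟩
    fix0-runs ρ i = bindᵣ nilᵣ (bindᵣ consᵣ consᵣ)

    fix1-runs : ∀ ρ (i : Fin n) → encodeAssignment ρ ∷ encodeℕᵇ (index i) ∷ [] ⊢ body FIX1 ↦
                encodeAssignment ((i , true) ∷ ρ) ⟨ 0 , 0 ⟩
    fix1-runs ρ i = bindᵣ nilᵣ (bindᵣ consᵣ (bindᵣ consᵣ consᵣ))

    find-call : ∀ {w H} ρ (i : Fin n) → length ρ ≤ H → index i fits w →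
                encodeAssignment ρ ∷ encodeℕᵇ (index i) ∷ [] ⊢ body FIND ↦ encodeMaybe (find ρ i)
                ⟨ H * (2 + w) , 0 ⟩
    find-call {w} ρ i l p = at-most (ℕ.*-monoˡ-≤ (2 + w) l) (find-runs ρ i p)

    -- The sum of the length of ρ and the size of T does not grow on the way down,
    -- so H bounds all assignments that occur.
    mean-runs : ∀ {w H} ρ (T : RDT n) → length ρ + descriptionLength T ≤ H → descriptionLength T ≤ w →
                encodeAssignment ρ ∷ encodeRDT T ∷ [] ⊢ body MEAN ↦ encodeFrac (mean ρ T)
                ⟨ descriptionLength T * mean-step w H , 0 ⟩
    mean-runs ρ (leaf p u) h l = at-most z≤n (leafᵣ p u refl varᵣ)
    mean-runs {w} {H} ρ (decide i T₀ T₁) h l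
      with find ρ i | find-call {w} {H} ρ i (ℕ.≤-trans (ℕ.m≤m+n _ _) h) (fits-mono l (index-fits i T₀ T₁))
    ... | nothing | r = at-most
      (ℕ.≤-trans (ℕ.≤-reflexive (branch-cost (mid-cost w) (find-cost w H) s₀ s₁))
                 (ℕ.*-monoˡ-≤ (mean-step w H) (decide-size i T₀ T₁)))
      (decideᵣ i T₀ T₁ refl
        (bindᵣ (callᵣ r)
        (match-nilᵣ refl
        (bindᵣ (callᵣ (fix0-runs ρ i))
        (bindᵣ (callᵣ (mean-runs ((i , false) ∷ ρ) T₀ (h′ (s≤s (ℕ.m≤m+n s₀ s₁))) (l′ (left≤ s₀ s₁))))
        (bindᵣ (callᵣ (fix1-runs ρ i))
        (bindᵣ (callᵣ (mean-runs ((i , true) ∷ ρ) T₁ (h′ (s≤s (ℕ.m≤n+m s₁ s₀))) (l′ (right≤ s₀ s₁))))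
        (callᵣ (mid-runs (mean _ T₀) (mean _ T₁) (mean-fits _ T₀) (mean-fits _ T₁) (l′ ℕ.≤-refl))))))))))
      where
      s₀ = descriptionLength T₀
      s₁ = descriptionLength T₁
      h′ : ∀ {s} → suc s ≤ suc (s₀ + s₁) → suc (length ρ + s) ≤ H
      h′ {s} p = ℕ.≤-trans (ℕ.≤-reflexive (sym (ℕ.+-suc (length ρ) s)))
             (ℕ.≤-trans (ℕ.+-monoʳ-≤ (length ρ) (ℕ.≤-trans p (decide-size i T₀ T₁))) h)
      l′ : ∀ {s} → s ≤ suc (s₀ + s₁) → s ≤ w
      l′ p = ℕ.≤-trans p (ℕ.≤-trans (decide-size i T₀ T₁) l)
    ... | just false | r = at-most
      (ℕ.≤-trans (by-adding _ (single-cost (mid-cost w) (find-cost w H) s₀))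
                 (ℕ.*-monoˡ-≤ (mean-step w H) s₀<))
      (decideᵣ i T₀ T₁ refl
        (bindᵣ (callᵣ r)
        (match-consᵣ refl
        (match-nilᵣ refl
        (callᵣ (mean-runs ρ T₀ (ℕ.≤-trans (ℕ.+-monoʳ-≤ (length ρ) (ℕ.<⇒≤ s₀<)) h) (ℕ.≤-trans (ℕ.<⇒≤ s₀<) l)))))))
      where
      s₀ = descriptionLength T₀
      s₀< = decide-sizeˡ i T₀ T₁
    ... | just true | r = at-most
      (ℕ.≤-trans (by-adding _ (single-cost (mid-cost w) (find-cost w H) s₁))
                 (ℕ.*-monoˡ-≤ (mean-step w H) s₁<))
      (decideᵣ i T₀ T₁ refl
        (bindᵣ (callᵣ r)
        (match-consᵣ refl
        (match-consᵣ refl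
        (callᵣ (mean-runs ρ T₁ (ℕ.≤-trans (ℕ.+-monoʳ-≤ (length ρ) (ℕ.<⇒≤ s₁<)) h) (ℕ.≤-trans (ℕ.<⇒≤ s₁<) l)))))))
      where
      s₁ = descriptionLength T₁
      s₁< = decide-sizeʳ i T₀ T₁
    mean-runs {w} {H} ρ (toss T₀ T₁) h l = at-most
      (ℕ.≤-trans (by-adding _ (toss-cost (mid-cost w) (find-cost w H) s₀ s₁))
                 (ℕ.*-monoˡ-≤ (mean-step w H) (toss-size T₀ T₁)))
      (tossᵣ T₀ T₁ refl
        (bindᵣ (callᵣ (mean-runs ρ T₀ (h′ (left≤ s₀ s₁)) (l′ (left≤ s₀ s₁))))
        (bindᵣ (callᵣ (mean-runs ρ T₁ (h′ (right≤ s₀ s₁)) (l′ (right≤ s₀ s₁))))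
        (callᵣ (mid-runs (mean _ T₀) (mean _ T₁) (mean-fits _ T₀) (mean-fits _ T₁) (l′ ℕ.≤-refl))))))
      where
      s₀ = descriptionLength T₀
      s₁ = descriptionLength T₁
      h′ : ∀ {s} → s ≤ suc (s₀ + s₁) → length ρ + s ≤ H
      h′ p = ℕ.≤-trans (ℕ.+-monoʳ-≤ (length ρ) (ℕ.≤-trans p (toss-size T₀ T₁))) h
      l′ : ∀ {s} → s ≤ suc (s₀ + s₁) → s ≤ w
      l′ p = ℕ.≤-trans p (ℕ.≤-trans (toss-size T₀ T₁) l)

  -- Choosing deterministic trees

  infix 4 _fitsᶜ_
  record _fitsᶜ_ (C : Choice n) (L : ℕ) : Set where
    constructor _,_
    field
      gain-fits : gain C fitsᶠ L
      loss-fits : loss C fitsᶠ L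

  open _fitsᶜ_ public

  fitsᶜ-mono : ∀ {C : Choice n} {L M} → L ≤ M → C fitsᶜ L → C fitsᶜ M
  fitsᶜ-mono l (p , q) = fitsᶠ-mono l p , fitsᶠ-mono l q

  pickBy-either : ∀ (P : Choice n → Set) o {C₀ C₁} → P C₀ → P C₁ → P (pickBy o C₀ C₁)
  pickBy-either P eq p q = p
  pickBy-either P lt p q = p
  pickBy-either P gt p q = q

  -- Whatever the comparison says, the result is one of the two choices, so that
  -- properties shared by both carry over.
  pick-either : ∀ (P : Choice n → Set) C₀ C₁ → P C₀ → P C₁ → P (pick C₀ C₁)
  pick-either P C₀ C₁ = pickBy-either P (compareFrac (gain C₀ ⊕ loss C₁) (gain C₁ ⊕ loss C₀))

  node-room : ∀ s₀ s₁ s Z → suc (s₀ + s₁) ≤ s → suc (s₀ * suc Z + s₁ * suc Z) ≤ s * suc Z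
  node-room s₀ s₁ s Z p = ℕ.≤-trans
    (ℕ.≤-trans (ℕ.≤-reflexive (cong suc (sym (ℕ.*-distribʳ-+ (suc Z) s₀ s₁)))) (s≤s (ℕ.m≤n+m _ Z)))
    (ℕ.*-monoˡ-≤ (suc Z) p)

  -- A leaf multiplies its label by a sum of conditional means over lists of
  -- size at most Z; so each unit of size contributes at most Z + 1 digits.
  choose-fits : ∀ {Z} (Ts Rs : List (RDT n)) → size (encodeTrees Ts) ≤ Z → size (encodeTrees Rs) ≤ Z →
                ∀ ρ T → choose Ts Rs ρ T fitsᶜ descriptionLength T * suc Z
  choose-fits {n} {Z} Ts Rs Ts≤ Rs≤ ρ (leaf p u) =
    fitsᶠ-mono (enough Ts≤) (⊗-fits (label-fits {n} p u) (sumMeans-fits ρ Ts)) ,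
    fitsᶠ-mono (enough Rs≤) (⊗-fits (label-fits {n} p u) (sumMeans-fits ρ Rs))
    where
    s = descriptionLength {n} (leaf p u)
    enough : ∀ {z} → z ≤ Z → s + z ≤ s * suc Z
    enough z≤ = ℕ.≤-trans (ℕ.+-monoʳ-≤ s (ℕ.≤-trans z≤ (ℕ.m≤m+n Z _)))
                          (ℕ.≤-reflexive (sym (ℕ.*-suc s Z)))
  choose-fits {Z = Z} Ts Rs Ts≤ Rs≤ ρ (decide i T₀ T₁) with find ρ i
  ... | nothing = fitsᶠ-mono enough (mid-fits (gain-fits c₀) (gain-fits c₁)) ,
                  fitsᶠ-mono enough (mid-fits (loss-fits c₀) (loss-fits c₁))
    where
    s₀ = descriptionLength T₀
    s₁ = descriptionLength T₁
    c₀ = choose-fits Ts Rs Ts≤ Rs≤ ((i , false) ∷ ρ) T₀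
    c₁ = choose-fits Ts Rs Ts≤ Rs≤ ((i , true) ∷ ρ) T₁
    enough = node-room s₀ s₁ (descriptionLength (decide i T₀ T₁)) Z (decide-size i T₀ T₁)
  ... | just false = fitsᶜ-mono (ℕ.*-monoˡ-≤ (suc Z) (ℕ.<⇒≤ (decide-sizeˡ i T₀ T₁)))
                                (choose-fits Ts Rs Ts≤ Rs≤ ρ T₀)
  ... | just true  = fitsᶜ-mono (ℕ.*-monoˡ-≤ (suc Z) (ℕ.<⇒≤ (decide-sizeʳ i T₀ T₁)))
                                (choose-fits Ts Rs Ts≤ Rs≤ ρ T₁)
  choose-fits {Z = Z} Ts Rs Ts≤ Rs≤ ρ (toss T₀ T₁) = pick-either (_fitsᶜ _) _ _
    (fitsᶜ-mono (ℕ.*-monoˡ-≤ (suc Z) (ℕ.<⇒≤ (toss-sizeˡ T₀ T₁))) (choose-fits Ts Rs Ts≤ Rs≤ ρ T₀))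
    (fitsᶜ-mono (ℕ.*-monoˡ-≤ (suc Z) (ℕ.<⇒≤ (toss-sizeʳ T₀ T₁))) (choose-fits Ts Rs Ts≤ Rs≤ ρ T₁))

  encodeUnary : ℕ → Tree
  encodeUnary zero    = nil
  encodeUnary (suc j) = nil ∙ encodeUnary j

  -- The greedy loop: Rs grows along with Ts, so that both have the same length.
  select : ℕ → RDT n → (Ts Rs : List (RDT n)) → List (RDT n)
  select zero    R Ts Rs = Ts
  select (suc j) R Ts Rs = select j R (tree (choose Ts Rs [] R) ∷ Ts) (R ∷ Rs)

  -- The branch taken at a toss is a default: run is applied to deterministic trees.
  run : Vec Bool n → RDT n → Frac
  run x (leaf p _)       = label p
  run x (decide i T₀ T₁) = if lookup x i then run x T₁ else run x T₀
  run x (toss T₀ T₁)     = run x T₀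

  runAll : Vec Bool n → List (RDT n) → Frac
  runAll x []       = 0ᶠ
  runAll x (T ∷ Ts) = run x T ⊕ runAll x Ts

  run-fits : ∀ x (T : RDT n) → run x T fitsᶠ descriptionLength T
  run-fits {n} x (leaf p u)   = label-fits {n} p u
  run-fits x (decide i T₀ T₁) with lookup x i
  ... | false = fitsᶠ-mono (ℕ.<⇒≤ (decide-sizeˡ i T₀ T₁)) (run-fits x T₀)
  ... | true  = fitsᶠ-mono (ℕ.<⇒≤ (decide-sizeʳ i T₀ T₁)) (run-fits x T₁)
  run-fits x (toss T₀ T₁)     =
    fitsᶠ-mono (ℕ.<⇒≤ (toss-sizeˡ T₀ T₁)) (run-fits x T₀)

  runAll-fits : ∀ x (Ts : List (RDT n)) → runAll x Ts fitsᶠ size (encodeTrees Ts)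
  runAll-fits x []       = fit (s≤s z≤n) , fit (s≤s (s≤s z≤n))
  runAll-fits x (T ∷ Ts) = ⊕-fits (run-fits x T) (runAll-fits x Ts)

  -- Choosing only removes nodes, so the trees selected obey the bounds that
  -- hold for R.
  choose-size : ∀ Ts Rs ρ (T : RDT n) →
                descriptionLength (tree (choose Ts Rs ρ T)) ≤ descriptionLength T
  choose-size Ts Rs ρ (leaf p u)       = ℕ.≤-refl
  choose-size Ts Rs ρ (decide i T₀ T₁) with find ρ i
  ... | nothing    = s≤s (ℕ.+-monoʳ-≤ 3 (s≤s (ℕ.+-monoʳ-≤ (size (encodeℕᵇ (index i)))
                       (s≤s (ℕ.+-mono-≤ (choose-size Ts Rs _ T₀) (choose-size Ts Rs _ T₁))))))
  ... | just false = ℕ.≤-trans (choose-size Ts Rs ρ T₀) (ℕ.<⇒≤ (decide-sizeˡ i T₀ T₁))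
  ... | just true  = ℕ.≤-trans (choose-size Ts Rs ρ T₁) (ℕ.<⇒≤ (decide-sizeʳ i T₀ T₁))
  choose-size Ts Rs ρ (toss T₀ T₁) = pick-either (λ C → descriptionLength (tree C) ≤ _) (choose Ts Rs ρ T₀) (choose Ts Rs ρ T₁)
    (ℕ.≤-trans (choose-size Ts Rs ρ T₀) (ℕ.<⇒≤ (toss-sizeˡ T₀ T₁)))
    (ℕ.≤-trans (choose-size Ts Rs ρ T₁) (ℕ.<⇒≤ (toss-sizeʳ T₀ T₁)))

  choose-queries : ∀ Ts Rs ρ (T : RDT n) →
                   queryComplexity (tree (choose Ts Rs ρ T)) ≤ queryComplexity T
  choose-queries Ts Rs ρ (leaf p u)       = ℕ.≤-refl
  choose-queries Ts Rs ρ (decide i T₀ T₁) with find ρ i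
  ... | nothing    = s≤s (ℕ.⊔-mono-≤ (choose-queries Ts Rs _ T₀) (choose-queries Ts Rs _ T₁))
  ... | just false = ℕ.≤-trans (choose-queries Ts Rs ρ T₀) (ℕ.≤-trans (ℕ.m≤m⊔n _ _) (ℕ.n≤1+n _))
  ... | just true  = ℕ.≤-trans (choose-queries Ts Rs ρ T₁)
                       (ℕ.≤-trans (ℕ.m≤n⊔m (queryComplexity T₀) _) (ℕ.n≤1+n _))
  choose-queries Ts Rs ρ (toss T₀ T₁) = pick-either (λ C → queryComplexity (tree C) ≤ _) (choose Ts Rs ρ T₀) (choose Ts Rs ρ T₁)
    (ℕ.≤-trans (choose-queries Ts Rs ρ T₀) (ℕ.m≤m⊔n _ _))
    (ℕ.≤-trans (choose-queries Ts Rs ρ T₁) (ℕ.m≤n⊔m (queryComplexity T₀) _))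

  -- Bounds on the number of calls; w and H also have to leave room for the lists
  -- of trees.
  join-cost pick-cost unary-step runAll-step : ℕ → ℕ
  join-cost   w = suc (mid-cost w + mid-cost w)
  pick-cost   w = suc (fcmp-cost w + ⊕-cost w + ⊕-cost w)
  unary-step  w = 2 + w
  runAll-step w = 2 + ⊕-cost w

  leaf-cost choose-step choose-cost select-step : ℕ → ℕ → ℕ
  leaf-cost   w H = ⊗-cost w + sum-cost w H + ⊗-cost w + sum-cost w H
  choose-step w H = 4 + (join-cost w + pick-cost w + leaf-cost w H) + find-cost w H
  choose-cost w H = suc (w * choose-step w H)
  select-step w H = 1 + choose-cost w H

  private
    sum-eq : ∀ p m s → p + suc (s * suc (p + m)) + m ≡ suc (p + m) + s * suc (p + m)
    sum-eq = solve-∀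

    branch-eq : ∀ j p l f a b → let X = 4 + (j + p + l) + f in
      j + suc (b * X) + 1 + suc (a * X) + 1 + f + (p + l) ≡ suc (a + b) * X
    branch-eq = solve-∀

    single-eq : ∀ j p l f a → let X = 4 + (j + p + l) + f in
      suc (a * X) + f + (3 + (j + p + l)) ≡ suc a * X
    single-eq = solve-∀

    toss-eq : ∀ j p l f a b → let X = 4 + (j + p + l) + f in
      p + suc (b * X) + suc (a * X) + (2 + j + l + f) ≡ suc (a + b) * X
    toss-eq = solve-∀

    leaf-eq : ∀ j p l f → l + (4 + (j + p) + f) ≡ 4 + (j + p + l) + f
    leaf-eq = solve-∀

    runAll-eq : ∀ p t s → let X = 2 + p in
      p + suc (s * X) + suc t + (t + t * p) ≡ suc (t + s) * X
    runAll-eq = solve-∀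

  module Algorithm {n} (x : Vec Bool n) where
    open TreeArithmetic x public

    zero-runs : ∀ {k} {ρ : Vec Tree k} → ρ ⊢ returnZero ↦ encodeFrac 0ᶠ ⟨ 0 , 0 ⟩
    zero-runs = bindᵣ nilᵣ (bindᵣ consᵣ consᵣ)

    sumMeans-runs : ∀ {w H} ρ (Ts : List (RDT n)) →
      length ρ + size (encodeTrees Ts) ≤ H → size (encodeTrees Ts) ≤ w →
      encodeAssignment ρ ∷ encodeTrees Ts ∷ [] ⊢ body SUM ↦ encodeFrac (sumMeans ρ Ts)
      ⟨ size (encodeTrees Ts) * sum-step w H , 0 ⟩
    sumMeans-runs ρ [] h l = at-most z≤n (match-nilᵣ refl zero-runs)
    sumMeans-runs {w} {H} ρ (T ∷ Ts) h l = at-most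
      (ℕ.≤-trans (ℕ.≤-reflexive (sum-eq (⊕-cost w) (mean-cost w H) s))
                 (ℕ.*-monoˡ-≤ (sum-step w H) (s≤s (ℕ.m≤n+m s t))))
      (match-consᵣ refl
        (bindᵣ (callᵣ (at-most (ℕ.*-monoˡ-≤ (mean-step w H) (ℕ.≤-trans (left≤ t s) l))
                 (mean-runs ρ T (h′ (left≤ t s)) (ℕ.≤-trans (left≤ t s) l))))
        (bindᵣ (callᵣ (sumMeans-runs ρ Ts (h′ (right≤ t s)) (ℕ.≤-trans (right≤ t s) l)))
        (callᵣ (⊕-runs (mean ρ T) (sumMeans ρ Ts) (mean-fits ρ T) (sumMeans-fits ρ Ts) l)))))
      where
      t = descriptionLength T
      s = size (encodeTrees Ts)
      h′ : ∀ {a} → a ≤ suc (t + s) → length ρ + a ≤ H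
      h′ p = ℕ.≤-trans (ℕ.+-monoʳ-≤ (length ρ) p) h

    sum-call : ∀ {w H} ρ (Ts : List (RDT n)) →
      length ρ + size (encodeTrees Ts) ≤ H → size (encodeTrees Ts) ≤ w →
      encodeAssignment ρ ∷ encodeTrees Ts ∷ [] ⊢ body SUM ↦ encodeFrac (sumMeans ρ Ts)
      ⟨ w * sum-step w H , 0 ⟩
    sum-call {w} {H} ρ Ts h l = at-most (ℕ.*-monoˡ-≤ (sum-step w H) l) (sumMeans-runs ρ Ts h l)

    join-runs : ∀ {w L M} (i : Fin n) C₀ C₁ → C₀ fitsᶜ L → C₁ fitsᶜ M → L + M < w →
      (nil ∙ nil) ∷ encodeℕᵇ (index i) ∷ encodeChoice C₀ ∷ encodeChoice C₁ ∷ [] ⊢ body JOIN ↦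
      encodeChoice (join i C₀ C₁) ⟨ mid-cost w + mid-cost w , 0 ⟩
    join-runs i (choice T₀ P₀ Q₀) (choice T₁ P₁ Q₁) (p₀ , q₀) (p₁ , q₁) l =
      match-consᵣ refl (match-consᵣ refl (match-consᵣ refl (match-consᵣ refl
        (bindᵣ (callᵣ (mid-runs P₀ P₁ p₀ p₁ l))
        (bindᵣ (callᵣ (mid-runs Q₀ Q₁ q₀ q₁ l))
        (bindᵣ consᵣ (bindᵣ consᵣ (bindᵣ consᵣ (bindᵣ consᵣ consᵣ)))))))))

    -- The two sums compared have suc (L + M) and suc (M + L) digits, and the cross
    -- multiplication needs the digits of both.
    pick-runs : ∀ {w L M} (C₀ C₁ : Choice n) → C₀ fitsᶜ L → C₁ fitsᶜ M → suc (L + M) + suc (M + L) ≤ w →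
      encodeChoice C₀ ∷ encodeChoice C₁ ∷ [] ⊢ body PICK ↦ encodeChoice (pick C₀ C₁)
      ⟨ fcmp-cost w + ⊕-cost w + ⊕-cost w , 0 ⟩
    pick-runs {w} {L} {M} C₀ C₁ (p₀ , q₀) (p₁ , q₁) l =
      match-consᵣ refl (match-consᵣ refl (match-consᵣ refl (match-consᵣ refl
        (bindᵣ (callᵣ (⊕-runs (gain C₀) (loss C₁) p₀ q₁ l′))
        (bindᵣ (callᵣ (⊕-runs (gain C₁) (loss C₀) p₁ q₀ l″))
        (bindᵣ (callᵣ (compareFrac-runs (gain C₀ ⊕ loss C₁) (gain C₁ ⊕ loss C₀) (⊕-fits p₀ q₁) (⊕-fits p₁ q₀) l))
        (outcome (compareFrac (gain C₀ ⊕ loss C₁) (gain C₁ ⊕ loss C₀)) refl refl)))))))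
      where
      l′ : L + M < w
      l′ = ℕ.≤-trans (ℕ.m≤m+n _ _) l
      l″ : M + L < w
      l″ = ℕ.≤-trans (ℕ.m≤n+m _ (suc (L + M))) l
      outcome : ∀ {k} {ρ : Vec Tree k} {i j} o →
        lookup ρ i ≡ encodeChoice C₀ → lookup ρ j ≡ encodeChoice C₁ →
        encodeOrder o ∷ ρ ⊢ match v0 (var (suc i))
                                     (match v1 (var (suc (suc (suc i))))
                                               (var (suc (suc (suc (suc (suc j)))))))
          ↦ encodeChoice (pickBy o C₀ C₁) ⟨ 0 , 0 ⟩
      outcome eq p q = match-nilᵣ refl (var≡ᵣ p)
      outcome lt p q = match-consᵣ refl (match-nilᵣ refl (var≡ᵣ p))
      outcome gt p q = match-consᵣ refl (match-consᵣ refl (var≡ᵣ q))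

  -- The selection loop and the main expression

  unary-bound : ∀ {a b M} → a ≤ M → a ≤ b → suc a + suc (a * unary-step M) ≤ suc b * unary-step M
  unary-bound {a} {b} {M} a≤M a≤b = ℕ.≤-trans (ℕ.≤-reflexive (cong suc (ℕ.+-suc a _)))
    (s≤s (s≤s (ℕ.+-mono-≤ a≤M (ℕ.*-monoˡ-≤ (unary-step M) a≤b))))

  suc≤2^ : ∀ k → suc k ≤ 2 ℕ.^ k
  suc≤2^ zero    = s≤s z≤n
  suc≤2^ (suc k) = ℕ.≤-trans (ℕ.+-mono-≤ (ℕ.m^n>0 2 k) (suc≤2^ k))
    (ℕ.≤-reflexive (cong (2 ℕ.^ k +_) (sym (ℕ.+-identityʳ _))))

  -- With M bounding both the size of R and the number of samples: the size of a
  -- list of chosen trees, the number of digits of all numbers, the length of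
  -- assignments plus the sizes of the trees traversed, and the total of calls.
  lists word path main-cost : ℕ → ℕ
  lists M = suc (M * suc M)
  word  M = M * suc (lists M) + M * suc (lists M) + (lists M + M)
  path  M = M + lists M
  main-cost M = mul-cost (word M) + suc (word M * runAll-step (word M))
              + suc (M * select-step (word M) (path M)) + 0 + suc (M * unary-step M) + suc (word M)

  module Selection {n} (x : Vec Bool n) where
    open Algorithm x public

    module _ {w H Z : ℕ} (Ts Rs : List (RDT n))
             (Ts≤ : size (encodeTrees Ts) ≤ Z) (Rs≤ : size (encodeTrees Rs) ≤ Z) (Z≤w : Z ≤ w) where

      -- Two copies of the digits of a subtree have to fit into w because the final
      -- comparison at a toss multiplies the results of both subtrees crosswise.
      choose-runs : ∀ ρ T → length ρ + (descriptionLength T + Z) ≤ H →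
        descriptionLength T * suc Z + descriptionLength T * suc Z ≤ w →
        encodeAssignment ρ ∷ encodeRDT T ∷ encodeTrees Ts ∷ encodeTrees Rs ∷ [] ⊢ body CHOOSE ↦
        encodeChoice (choose Ts Rs ρ T) ⟨ descriptionLength T * choose-step w H , 0 ⟩
      choose-runs ρ (leaf p u) h l = at-most
        (ℕ.≤-trans (by-adding _ (leaf-eq (join-cost w) (pick-cost w) (leaf-cost w H) (find-cost w H)))
                   (ℕ.m≤m+n (choose-step w H) _))
        (leafᵣ p u refl
          (bindᵣ (callᵣ (sum-call ρ Ts (h′ Ts≤) (ℕ.≤-trans Ts≤ Z≤w)))
          (bindᵣ (callᵣ (⊗-runs (label p) (sumMeans ρ Ts) (label-fits {n} p u) (sumMeans-fits ρ Ts) (l′ Ts≤)))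
          (bindᵣ (callᵣ (sum-call ρ Rs (h′ Rs≤) (ℕ.≤-trans Rs≤ Z≤w)))
          (bindᵣ (callᵣ (⊗-runs (label p) (sumMeans ρ Rs) (label-fits {n} p u) (sumMeans-fits ρ Rs) (l′ Rs≤)))
          (bindᵣ consᵣ consᵣ))))))
        where
        s = descriptionLength {n} (leaf p u)
        h′ : ∀ {z} → z ≤ Z → length ρ + z ≤ H
        h′ p = ℕ.≤-trans (ℕ.+-monoʳ-≤ (length ρ) (ℕ.≤-trans p (ℕ.m≤n+m Z s))) h
        l′ : ∀ {z} → z ≤ Z → s + z ≤ w
        l′ p = ℕ.≤-trans (ℕ.+-mono-≤ (ℕ.m≤m*n s (suc Z)) (ℕ.≤-trans p (ℕ.≤-trans (ℕ.n≤1+n Z) (ℕ.m≤n*m (suc Z) s)))) l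
      choose-runs ρ (decide i T₀ T₁) h l
        with find ρ i | find-call {w} {H} ρ i (ℕ.≤-trans (ℕ.m≤m+n _ _) h)
                          (fits-mono (ℕ.≤-trans (ℕ.m≤m*n _ (suc Z)) (ℕ.≤-trans (ℕ.m≤m+n _ _) l)) (index-fits i T₀ T₁))
      ... | nothing | r = at-most
        (ℕ.≤-trans (by-adding _ (branch-eq (join-cost w) (pick-cost w) (leaf-cost w H) (find-cost w H) s₀ s₁))
                   (ℕ.*-monoˡ-≤ (choose-step w H) (decide-size i T₀ T₁)))
        (decideᵣ i T₀ T₁ refl
          (bindᵣ (callᵣ r)
          (match-nilᵣ refl
          (bindᵣ (callᵣ (fix0-runs ρ i))
          (bindᵣ (callᵣ (choose-runs ((i , false) ∷ ρ) T₀ (h′ (decide-sizeˡ i T₀ T₁)) (l′ (decide-sizeˡ i T₀ T₁))))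
          (bindᵣ (callᵣ (fix1-runs ρ i))
          (bindᵣ (callᵣ (choose-runs ((i , true) ∷ ρ) T₁ (h′ (decide-sizeʳ i T₀ T₁)) (l′ (decide-sizeʳ i T₀ T₁))))
          (callᵣ (join-runs i (choose Ts Rs ((i , false) ∷ ρ) T₀) (choose Ts Rs ((i , true) ∷ ρ) T₁)
            (choose-fits Ts Rs Ts≤ Rs≤ ((i , false) ∷ ρ) T₀)
            (choose-fits Ts Rs Ts≤ Rs≤ ((i , true) ∷ ρ) T₁)
            (ℕ.≤-trans (node-room s₀ s₁ s Z (decide-size i T₀ T₁)) (ℕ.≤-trans (ℕ.m≤m+n _ _) l)))))))))))
        where
        s  = descriptionLength (decide i T₀ T₁)
        s₀ = descriptionLength T₀
        s₁ = descriptionLength T₁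
        h′ : ∀ {t} → t < s → suc (length ρ) + (t + Z) ≤ H
        h′ {t} p = ℕ.≤-trans (ℕ.≤-reflexive (sym (ℕ.+-suc (length ρ) (t + Z))))
                     (ℕ.≤-trans (ℕ.+-monoʳ-≤ (length ρ) (ℕ.+-monoˡ-≤ Z p)) h)
        l′ : ∀ {t} → t < s → t * suc Z + t * suc Z ≤ w
        l′ p = ℕ.≤-trans (ℕ.+-mono-≤ (ℕ.*-monoˡ-≤ (suc Z) (ℕ.<⇒≤ p)) (ℕ.*-monoˡ-≤ (suc Z) (ℕ.<⇒≤ p))) l
      ... | just false | r = at-most
        (ℕ.≤-trans (by-adding _ (single-eq (join-cost w) (pick-cost w) (leaf-cost w H) (find-cost w H) (descriptionLength T₀)))
                   (ℕ.*-monoˡ-≤ (choose-step w H) t<))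
        (decideᵣ i T₀ T₁ refl
          (bindᵣ (callᵣ r)
          (match-consᵣ refl
          (match-nilᵣ refl
          (callᵣ (choose-runs ρ T₀
            (ℕ.≤-trans (ℕ.+-monoʳ-≤ (length ρ) (ℕ.+-monoˡ-≤ Z (ℕ.<⇒≤ t<))) h)
            (ℕ.≤-trans (ℕ.+-mono-≤ (ℕ.*-monoˡ-≤ (suc Z) (ℕ.<⇒≤ t<)) (ℕ.*-monoˡ-≤ (suc Z) (ℕ.<⇒≤ t<))) l)))))))
        where t< = decide-sizeˡ i T₀ T₁
      ... | just true | r = at-most
        (ℕ.≤-trans (by-adding _ (single-eq (join-cost w) (pick-cost w) (leaf-cost w H) (find-cost w H) (descriptionLength T₁)))
                   (ℕ.*-monoˡ-≤ (choose-step w H) t<))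
        (decideᵣ i T₀ T₁ refl
          (bindᵣ (callᵣ r)
          (match-consᵣ refl
          (match-consᵣ refl
          (callᵣ (choose-runs ρ T₁
            (ℕ.≤-trans (ℕ.+-monoʳ-≤ (length ρ) (ℕ.+-monoˡ-≤ Z (ℕ.<⇒≤ t<))) h)
            (ℕ.≤-trans (ℕ.+-mono-≤ (ℕ.*-monoˡ-≤ (suc Z) (ℕ.<⇒≤ t<)) (ℕ.*-monoˡ-≤ (suc Z) (ℕ.<⇒≤ t<))) l)))))))
        where t< = decide-sizeʳ i T₀ T₁
      choose-runs ρ (toss T₀ T₁) h l = at-most
        (ℕ.≤-trans (by-adding _ (toss-eq (join-cost w) (pick-cost w) (leaf-cost w H) (find-cost w H) s₀ s₁))
                   (ℕ.*-monoˡ-≤ (choose-step w H) (toss-size T₀ T₁)))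
        (tossᵣ T₀ T₁ refl
          (bindᵣ (callᵣ (choose-runs ρ T₀ (h′ (toss-sizeˡ T₀ T₁)) (l′ (toss-sizeˡ T₀ T₁))))
          (bindᵣ (callᵣ (choose-runs ρ T₁ (h′ (toss-sizeʳ T₀ T₁)) (l′ (toss-sizeʳ T₀ T₁))))
          (callᵣ (pick-runs (choose Ts Rs ρ T₀) (choose Ts Rs ρ T₁)
            (choose-fits Ts Rs Ts≤ Rs≤ ρ T₀)
            (choose-fits Ts Rs Ts≤ Rs≤ ρ T₁)
            (ℕ.≤-trans (ℕ.+-mono-≤ (node-room s₀ s₁ s Z (toss-size T₀ T₁))
                                   (node-room s₁ s₀ s Z (ℕ.≤-trans (ℕ.≤-reflexive (cong suc (ℕ.+-comm s₁ s₀))) (toss-size T₀ T₁)))) l))))))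
        where
        s  = descriptionLength (toss T₀ T₁)
        s₀ = descriptionLength T₀
        s₁ = descriptionLength T₁
        h′ : ∀ {t} → t < s → length ρ + (t + Z) ≤ H
        h′ p = ℕ.≤-trans (ℕ.+-monoʳ-≤ (length ρ) (ℕ.+-monoˡ-≤ Z (ℕ.<⇒≤ p))) h
        l′ : ∀ {t} → t < s → t * suc Z + t * suc Z ≤ w
        l′ p = ℕ.≤-trans (ℕ.+-mono-≤ (ℕ.*-monoˡ-≤ (suc Z) (ℕ.<⇒≤ p)) (ℕ.*-monoˡ-≤ (suc Z) (ℕ.<⇒≤ p))) l

    dup-runs : ∀ j → encodeUnary j ∷ [] ⊢ body DUP ↦ encodeUnary (j * 2) ⟨ j , 0 ⟩
    dup-runs zero    = match-nilᵣ refl varᵣ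
    dup-runs (suc j) = match-consᵣ refl (bindᵣ (callᵣ (dup-runs j)) (bindᵣ consᵣ consᵣ))

    -- Doubling a unary number takes time proportional to it, so conversion is
    -- polynomial only in the value.  The value here is about 1/ε.
    unary-runs : ∀ {M} a → toℕ a ≤ M →
      encodeℕᵇ a ∷ [] ⊢ body UNARY ↦ encodeUnary (toℕ a) ⟨ toℕ a * unary-step M , 0 ⟩
    unary-runs zero _ = match-nilᵣ refl varᵣ
    unary-runs {M} 1+[2 a ] l = at-most (unary-bound (ℕ.≤-trans a≤ (ℕ.<⇒≤ l)) a≤)
      (returning (cong (λ j → encodeUnary (suc j)) (ℕ.*-comm (toℕ a) 2))
        (match-consᵣ refl
          (bindᵣ (callᵣ (unary-runs a (ℕ.≤-trans a≤ (ℕ.<⇒≤ l))))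
          (bindᵣ (callᵣ (dup-runs (toℕ a)))
          (match-nilᵣ refl consᵣ)))))
      where
      a≤ : toℕ a ≤ 2 * toℕ a
      a≤ = ℕ.m≤n*m (toℕ a) 2
    unary-runs {M} 2[1+ a ] l = at-most (unary-bound (ℕ.≤-trans a≤ (ℕ.<⇒≤ l)) a≤)
      (returning (cong encodeUnary (ℕ.*-comm (suc (toℕ a)) 2))
        (match-consᵣ refl
          (bindᵣ (callᵣ (unary-runs a (ℕ.≤-trans a≤ (ℕ.<⇒≤ l))))
          (bindᵣ (callᵣ (dup-runs (toℕ a)))
          (match-consᵣ refl (bindᵣ consᵣ consᵣ))))))
      where
      a≤ : toℕ a ≤ toℕ a + suc (toℕ a + 0)
      a≤ = ℕ.m≤m+n (toℕ a) _

    run-runs : ∀ T → encodeRDT T ∷ [] ⊢ body RUN ↦ encodeFrac (run x T)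
               ⟨ descriptionLength T , queryComplexity T ⟩
    run-runs (leaf p u) = at-most z≤n (leafᵣ p u refl varᵣ)
    run-runs (decide i T₀ T₁) = decideᵣ i T₀ T₁ refl
      (at-most (ℕ.≤-reflexive (ℕ.+-identityʳ _)) (bindᵣ (queryᵣ refl) branch))
      where
      branch : encodeBool (lookup x i) ∷ _ ⊢ match v0 (call RUN (v1 ∷ [])) (call RUN (v4 ∷ [])) ↦
               encodeFrac (run x (decide i T₀ T₁))
               ⟨ descriptionLength (decide i T₀ T₁) , queryComplexity T₀ ℕ.⊔ queryComplexity T₁ ⟩
      branch with lookup x i
      ... | false = weaken (decide-sizeˡ i T₀ T₁) (ℕ.m≤m⊔n _ _)
                      (match-nilᵣ refl (callᵣ (run-runs T₀)))
      ... | true  = weaken (decide-sizeʳ i T₀ T₁) (ℕ.m≤n⊔m (queryComplexity T₀) _)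
                      (match-consᵣ refl (callᵣ (run-runs T₁)))
    run-runs (toss T₀ T₁) = weaken (toss-sizeˡ T₀ T₁) (ℕ.m≤m⊔n _ _)
      (tossᵣ T₀ T₁ refl (callᵣ (run-runs T₀)))

    runAll-runs : ∀ {w q} Ts → All (λ T → queryComplexity T ≤ q) Ts → size (encodeTrees Ts) ≤ w →
      encodeTrees Ts ∷ [] ⊢ body RUNALL ↦ encodeFrac (runAll x Ts)
      ⟨ size (encodeTrees Ts) * runAll-step w , length Ts * q ⟩
    runAll-runs []       []       l = at-most z≤n (match-nilᵣ refl zero-runs)
    runAll-runs {w} {q} (T ∷ Ts) (p ∷ ps) l = weaken
      (by-adding _ (runAll-eq (⊕-cost w) t s)) (ℕ.+-mono-≤ p (ℕ.≤-reflexive (ℕ.+-identityʳ _)))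
      (match-consᵣ refl
        (bindᵣ (callᵣ (run-runs T))
        (bindᵣ (callᵣ (runAll-runs Ts ps (ℕ.≤-trans (right≤ t s) l)))
        (callᵣ (⊕-runs (run x T) (runAll x Ts) (run-fits x T) (runAll-fits x Ts) l)))))
      where
      t = descriptionLength T
      s = size (encodeTrees Ts)

    -- The bounds on the sizes of the lists refer to the lists at the end of the
    -- loop, which makes them invariant.
    select-runs : ∀ {w H Z} j R Ts Rs →
      j * suc (descriptionLength R) + size (encodeTrees Ts) ≤ Z →
      j * suc (descriptionLength R) + size (encodeTrees Rs) ≤ Z →
      Z ≤ w → descriptionLength R + Z ≤ H →
      descriptionLength R * suc Z + descriptionLength R * suc Z ≤ w →
      encodeUnary j ∷ encodeRDT R ∷ encodeTrees Ts ∷ encodeTrees Rs ∷ [] ⊢ body LOOP ↦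
      encodeTrees (select j R Ts Rs) ⟨ j * select-step w H , 0 ⟩
    select-runs zero R Ts Rs _ _ _ _ _ = match-nilᵣ refl varᵣ
    select-runs {w} {H} {Z} (suc j) R Ts Rs t r z h l = at-most
      (ℕ.≤-reflexive (loop-eq (j * select-step w H) (choose-cost w H)))
      (match-consᵣ refl
        (bindᵣ (callᵣ (at-most (ℕ.*-monoˡ-≤ (choose-step w H) (ℕ.≤-trans (ℕ.m≤m*n s (suc Z)) (ℕ.≤-trans (ℕ.m≤m+n _ _) l)))
                 (choose-runs Ts Rs (ℕ.≤-trans (ℕ.m≤n+m _ (suc j * suc s)) t)
                              (ℕ.≤-trans (ℕ.m≤n+m _ (suc j * suc s)) r) z [] R h l)))
        (match-consᵣ refl
        (bindᵣ consᵣ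
        (bindᵣ consᵣ
        (callᵣ (select-runs j R (tree (choose Ts Rs [] R) ∷ Ts) (R ∷ Rs)
          (ℕ.≤-trans (ℕ.+-monoʳ-≤ (j * suc s) (s≤s (ℕ.+-monoˡ-≤ _ (choose-size Ts Rs [] R))))
            (ℕ.≤-trans (ℕ.≤-reflexive (move s j (size (encodeTrees Ts)))) t))
          (ℕ.≤-trans (ℕ.≤-reflexive (move s j (size (encodeTrees Rs)))) r) z h l)))))))
      where
      s = descriptionLength R
      move : ∀ s j a → j * suc s + suc (s + a) ≡ suc j * suc s + a
      move = solve-∀
      loop-eq : ∀ c m → suc c + 0 + 0 + m ≡ suc m + c
      loop-eq = solve-∀

    module _ {M q : ℕ} (R : RDT n) (k : ℕ) (R≤M : descriptionLength R ≤ M) (k<M : k < M)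
             (R≤q : queryComplexity R ≤ q) where

      private
        w = word M
        Z = lists M

      samples : List (RDT n)
      samples = select (suc k) R [] []

      total : Frac
      total = runAll x samples

      lists≤ : suc k * suc (descriptionLength R) + 1 ≤ Z
      lists≤ = ℕ.≤-trans (ℕ.≤-reflexive (ℕ.+-comm _ 1)) (s≤s (ℕ.*-mono-≤ k<M (s≤s R≤M)))

      Z+M≤w : Z + M ≤ w
      Z+M≤w = ℕ.m≤n+m _ _

      Z≤w : Z ≤ w
      Z≤w = ℕ.≤-trans (ℕ.m≤m+n _ _) Z+M≤w

      M≤w : M ≤ w
      M≤w = ℕ.≤-trans (ℕ.m≤n+m _ _) Z+M≤w

      suc-k : toℕ (B.suc (fromℕ k)) ≡ suc k
      suc-k = trans (B.toℕ-suc (fromℕ k)) (cong suc (B.toℕ-fromℕ k))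

      -- The number k is the integer part of 1/ε; the program takes k + 1 samples,
      -- sums their values as a fraction and multiplies its denominator by k + 1.
      main-runs : ∀ rest →
        All (λ T → queryComplexity T ≤ q) samples → size (encodeTrees samples) ≤ Z →
        encodeRDT R ∷ (encodeℕ k ∙ rest) ∷ [] ⊢ Program.main program ↦
        encodeℕᵇ (num total) ∙ encodeℕᵇ (mul (den total) (B.suc (fromℕ k)))
        ⟨ main-cost M , length samples * q + 0 ⟩
      main-runs rest samples≤q samples≤Z =
        match-consᵣ refl
        (bindᵣ (callᵣ (suc-runs (fromℕ k) (fits-mono (ℕ.≤-trans (ℕ.<⇒≤ k<M) M≤w) k-fits₀)))
        (bindᵣ (callᵣ (returning (cong encodeUnary suc-k) (at-most (ℕ.*-monoˡ-≤ (unary-step M) k′≤) (unary-runs (B.suc (fromℕ k)) k′≤))))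
        (bindᵣ nilᵣ
        (bindᵣ (callᵣ (at-most (ℕ.*-monoˡ-≤ (select-step w (path M)) k<M)
                 (select-runs (suc k) R [] [] lists≤ lists≤ Z≤w (ℕ.+-monoˡ-≤ Z R≤M) 
                   (ℕ.≤-trans (ℕ.+-mono-≤ (ℕ.*-monoˡ-≤ (suc Z) R≤M) (ℕ.*-monoˡ-≤ (suc Z) R≤M)) (ℕ.m≤m+n _ _)))))
        (bindᵣ (callᵣ (at-most (ℕ.*-monoˡ-≤ (runAll-step w) (ℕ.≤-trans samples≤Z Z≤w))
                 (runAll-runs samples samples≤q (ℕ.≤-trans samples≤Z Z≤w))))
        (match-consᵣ refl
        (bindᵣ (callᵣ (mul-call (den total) (B.suc (fromℕ k))
                 (fits-mono samples≤Z (den-fits (runAll-fits x samples))) k-fits Z+M≤w))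
        consᵣ)))))))
        where
        k′≤ : toℕ (B.suc (fromℕ k)) ≤ M
        k′≤ = ℕ.≤-trans (ℕ.≤-reflexive suc-k) k<M
        k-fits : B.suc (fromℕ k) fits M
        k-fits = fits-mono k<M (fit (subst (_< 2 ℕ.^ suc k) (sym suc-k) (suc≤2^ (suc k))))
        k-fits₀ : fromℕ k fits k
        k-fits₀ = fit (subst (_< 2 ℕ.^ k) (sym (B.toℕ-fromℕ k)) (suc≤2^ k))

open Computation

module Analysis where

  open import Data.Rational.Base using (_+_; _*_; _-_; _≤_)

  -- Natural numbers among the rationals

  private
    toℚᵘ-ℕ : ∀ k → ℚ.toℚᵘ (ℕ→ℚ k) ℚᵘ.≃ mkℚᵘ (ℤ.+ k) 0
    toℚᵘ-ℕ k = ℚ.toℚᵘ-fromℚᵘ (mkℚᵘ (ℤ.+ k) 0)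

  ℕ→ℚ-+ : ∀ a b → ℕ→ℚ (a ℕ.+ b) ≡ ℕ→ℚ a + ℕ→ℚ b
  ℕ→ℚ-+ a b = ℚ.toℚᵘ-injective (begin
    ℚ.toℚᵘ (ℕ→ℚ (a ℕ.+ b))                     ≈⟨ toℚᵘ-ℕ (a ℕ.+ b) ⟩
    mkℚᵘ (ℤ.+ (a ℕ.+ b)) 0                       ≈⟨ *≡* (cong (ℤ._* ℤ.+ 1) (cong₂ ℤ._+_ (sym (ℤ.*-identityʳ (ℤ.+ a))) (sym (ℤ.*-identityʳ (ℤ.+ b))))) ⟩
    mkℚᵘ (ℤ.+ a) 0 ℚᵘ.+ mkℚᵘ (ℤ.+ b) 0             ≈⟨ ℚᵘ.+-cong (toℚᵘ-ℕ a) (toℚᵘ-ℕ b) ⟨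
    ℚ.toℚᵘ (ℕ→ℚ a) ℚᵘ.+ ℚ.toℚᵘ (ℕ→ℚ b)         ≈⟨ ℚ.toℚᵘ-homo-+ (ℕ→ℚ a) (ℕ→ℚ b) ⟨
    ℚ.toℚᵘ (ℕ→ℚ a + ℕ→ℚ b)                     ∎)
    where open ℚᵘ.≃-Reasoning

  ℕ→ℚ-* : ∀ a b → ℕ→ℚ (a ℕ.* b) ≡ ℕ→ℚ a * ℕ→ℚ b
  ℕ→ℚ-* a b = ℚ.toℚᵘ-injective (begin
    ℚ.toℚᵘ (ℕ→ℚ (a ℕ.* b))                     ≈⟨ toℚᵘ-ℕ (a ℕ.* b) ⟩
    mkℚᵘ (ℤ.+ (a ℕ.* b)) 0                       ≈⟨ *≡* (cong (ℤ._* ℤ.+ 1) (ℤ.pos-* a b)) ⟩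
    mkℚᵘ (ℤ.+ a) 0 ℚᵘ.* mkℚᵘ (ℤ.+ b) 0             ≈⟨ ℚᵘ.*-cong (toℚᵘ-ℕ a) (toℚᵘ-ℕ b) ⟨
    ℚ.toℚᵘ (ℕ→ℚ a) ℚᵘ.* ℚ.toℚᵘ (ℕ→ℚ b)         ≈⟨ ℚ.toℚᵘ-homo-* (ℕ→ℚ a) (ℕ→ℚ b) ⟨
    ℚ.toℚᵘ (ℕ→ℚ a * ℕ→ℚ b)                     ∎)
    where open ℚᵘ.≃-Reasoning

  ℕ→ℚ-mono : ∀ {a b} → a ℕ.≤ b → ℕ→ℚ a ≤ ℕ→ℚ b
  ℕ→ℚ-mono {a} {b} a≤b = ℚ.toℚᵘ-cancel-≤ (begin
    ℚ.toℚᵘ (ℕ→ℚ a)  ≃⟨ toℚᵘ-ℕ a ⟩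
    mkℚᵘ (ℤ.+ a) 0    ≤⟨ *≤* (ℤ.*-monoʳ-≤-nonNeg (ℤ.+ 1) (ℤ.+≤+ a≤b)) ⟩
    mkℚᵘ (ℤ.+ b) 0    ≃⟨ toℚᵘ-ℕ b ⟨
    ℚ.toℚᵘ (ℕ→ℚ b)  ∎)
    where open ℚᵘ.≤-Reasoning

  0≤ℕ→ℚ : ∀ a → 0ℚ ≤ ℕ→ℚ a
  0≤ℕ→ℚ a = ℕ→ℚ-mono {0} {a} ℕ.z≤n

  ℕ→ℚ-nonNeg : ∀ a → NonNegative (ℕ→ℚ a)
  ℕ→ℚ-nonNeg a = ℚ.nonNegative (0≤ℕ→ℚ a)

  ℕ→ℚ-pos : ∀ {a} → 0 ℕ.< a → Positive (ℕ→ℚ a)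
  ℕ→ℚ-pos {a} 0<a = ℚ.positive (ℚ.<-≤-trans (ℚ.positive⁻¹ 1ℚ) (ℕ→ℚ-mono {1} {a} 0<a))

  fraction : ∀ a b → (ℤ.+ a ℚ./ suc b) * ℕ→ℚ (suc b) ≡ ℕ→ℚ a
  fraction a b = ℚ.toℚᵘ-injective (begin
    ℚ.toℚᵘ ((ℤ.+ a ℚ./ suc b) * ℕ→ℚ (suc b))             ≈⟨ ℚ.toℚᵘ-homo-* (ℤ.+ a ℚ./ suc b) (ℕ→ℚ (suc b)) ⟩
    ℚ.toℚᵘ (ℤ.+ a ℚ./ suc b) ℚᵘ.* ℚ.toℚᵘ (ℕ→ℚ (suc b))   ≈⟨ ℚᵘ.*-cong (ℚ.toℚᵘ-fromℚᵘ (mkℚᵘ (ℤ.+ a) b)) (toℚᵘ-ℕ (suc b)) ⟩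
    mkℚᵘ (ℤ.+ a) b ℚᵘ.* mkℚᵘ (ℤ.+ suc b) 0                 ≈⟨ *≡* (trans (ℤ.*-identityʳ (ℤ.+ a ℤ.* ℤ.+ suc b)) (cong (λ k → ℤ.+ a ℤ.* ℤ.+ suc k) (sym (ℕ.*-identityʳ b)))) ⟩
    mkℚᵘ (ℤ.+ a) 0                                       ≈⟨ toℚᵘ-ℕ a ⟨
    ℚ.toℚᵘ (ℕ→ℚ a)                                     ∎)
    where open ℚᵘ.≃-Reasoning

  nonNeg-fraction : ∀ p → 0ℚ ≤ p → ℕ→ℚ ∣ ↥ p ∣ ≡ p * ℕ→ℚ (↧ₙ p)
  nonNeg-fraction p@(mkℚ (ℤ.+ a) b _) _ =
    trans (sym (fraction a b)) (cong (_* ℕ→ℚ (suc b)) (ℚ.fromℚᵘ-toℚᵘ p))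
  nonNeg-fraction (mkℚ ℤ.-[1+ _ ] _ _) (ℚ.*≤* ())

  *-cancelʳ-pos : ∀ r → .{{Positive r}} → ∀ {p q} → p * r ≡ q * r → p ≡ q
  *-cancelʳ-pos r e = ℚ.≤-antisym
    (ℚ.*-cancelʳ-≤-pos r (ℚ.≤-reflexive e)) (ℚ.*-cancelʳ-≤-pos r (ℚ.≤-reflexive (sym e)))

  -- Expectation over the cube

  avg : ℚ → ℚ → ℚ
  avg p q = ½ * (p + q)

  avg-interchange : ∀ a b c d → avg (avg a b) (avg c d) ≡ avg (avg a c) (avg b d)
  avg-interchange = solve 4 (λ a b c d →
    con ½ :* (con ½ :* (a :+ b) :+ con ½ :* (c :+ d)) :=
    con ½ :* (con ½ :* (a :+ c) :+ con ½ :* (b :+ d))) refl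

  -- The recursion on which the proofs about expectations rest.
  𝔼-suc : (f : Vec Bool (suc n) → ℚ) → 𝔼 f ≡ avg (𝔼 (f ∘ (false ∷_))) (𝔼 (f ∘ (true ∷_)))
  𝔼-suc {n} f = solve 4 (λ h w a b → (h :* w) :* (a :+ b) := h :* (w :* a :+ w :* b)) refl
    ½ (½ ^ n) (∑ (f ∘ (false ∷_))) (∑ (f ∘ (true ∷_)))

  ∑-cong : {f g : Vec Bool n → ℚ} → (∀ x → f x ≡ g x) → ∑ f ≡ ∑ g
  ∑-cong {zero}  e = e []
  ∑-cong {suc n} e = cong₂ _+_ (∑-cong (λ x → e (false ∷ x))) (∑-cong (λ x → e (true ∷ x)))

  𝔼-cong : {f g : Vec Bool n → ℚ} → (∀ x → f x ≡ g x) → 𝔼 f ≡ 𝔼 g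
  𝔼-cong {n} e = cong (½ ^ n *_) (∑-cong e)

  𝔼-const : ∀ c → 𝔼 {n} (λ _ → c) ≡ c
  𝔼-const {zero}  c = ℚ.*-identityˡ c
  𝔼-const {suc n} c = trans (𝔼-suc {n} (λ _ → c))
    (trans (cong₂ avg (𝔼-const {n} c) (𝔼-const {n} c))
           (solve 1 (λ c → con ½ :* (c :+ c) := c) refl c))

  𝔼-+ : (f g : Vec Bool n → ℚ) → 𝔼 (λ x → f x + g x) ≡ 𝔼 f + 𝔼 g
  𝔼-+ {zero}  f g = ℚ.*-distribˡ-+ 1ℚ (f []) (g [])
  𝔼-+ {suc n} f g = trans (𝔼-suc {n} (λ x → f x + g x)) (trans
    (cong₂ avg (𝔼-+ {n} (f ∘ (false ∷_)) (g ∘ (false ∷_))) (𝔼-+ {n} (f ∘ (true ∷_)) (g ∘ (true ∷_))))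
    (trans (solve 5 (λ h a b c d → h :* ((a :+ b) :+ (c :+ d)) := h :* (a :+ c) :+ h :* (b :+ d)) refl ½
              (𝔼 (f ∘ (false ∷_))) (𝔼 (g ∘ (false ∷_))) (𝔼 (f ∘ (true ∷_))) (𝔼 (g ∘ (true ∷_))))
           (sym (cong₂ _+_ (𝔼-suc {n} f) (𝔼-suc {n} g)))))

  𝔼-* : ∀ c (f : Vec Bool n → ℚ) → 𝔼 (λ x → c * f x) ≡ c * 𝔼 f
  𝔼-* {zero}  c f = solve 3 (λ o c a → o :* (c :* a) := c :* (o :* a)) refl 1ℚ c (f [])
  𝔼-* {suc n} c f = trans (𝔼-suc {n} (λ x → c * f x)) (trans
    (cong₂ avg (𝔼-* {n} c (f ∘ (false ∷_))) (𝔼-* {n} c (f ∘ (true ∷_))))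
    (trans (solve 4 (λ h c a b → h :* (c :* a :+ c :* b) := c :* (h :* (a :+ b))) refl ½ c
              (𝔼 (f ∘ (false ∷_))) (𝔼 (f ∘ (true ∷_))))
           (sym (cong (c *_) (𝔼-suc {n} f)))))

  𝔼-mono : {f g : Vec Bool n → ℚ} → (∀ x → f x ≤ g x) → 𝔼 f ≤ 𝔼 g
  𝔼-mono {zero}  f≤g = ℚ.*-monoˡ-≤-nonNeg 1ℚ (f≤g [])
  𝔼-mono {suc n} {f} {g} f≤g = subst₂ _≤_ (sym (𝔼-suc {n} f)) (sym (𝔼-suc {n} g))
    (ℚ.*-monoˡ-≤-nonNeg ½ (ℚ.+-mono-≤ (𝔼-mono {n} (λ x → f≤g (false ∷ x))) (𝔼-mono {n} (λ x → f≤g (true ∷ x)))))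

  𝔼-avg : (f g : Vec Bool n → ℚ) → 𝔼 (λ x → avg (f x) (g x)) ≡ avg (𝔼 f) (𝔼 g)
  𝔼-avg {n} f g = trans (𝔼-* {n} ½ (λ x → f x + g x)) (cong (½ *_) (𝔼-+ {n} f g))

  -- The law of total expectation for a single bit, stated for overwritten inputs
  -- so that it can be iterated along an assignment.
  𝔼-update : ∀ (i : Fin n) (f : Vec Bool n → ℚ) →
             𝔼 f ≡ avg (𝔼 (λ x → f (x [ i ]≔ false))) (𝔼 (λ x → f (x [ i ]≔ true)))
  𝔼-update {suc n} zero f = trans (𝔼-suc {n} f)
    (cong₂ avg (fixed (f ∘ (false ∷_))) (fixed (f ∘ (true ∷_))))
    where
    fixed : (g : Vec Bool n → ℚ) → 𝔼 g ≡ 𝔼 {suc n} (λ { (_ ∷ x) → g x })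
    fixed g = sym (trans (𝔼-suc {n} (λ { (_ ∷ x) → g x })) (solve 1 (λ c → con ½ :* (c :+ c) := c) refl (𝔼 g)))
  𝔼-update {suc n} (suc i) f = trans (𝔼-suc {n} f) (trans
    (cong₂ avg (𝔼-update i (f ∘ (false ∷_))) (𝔼-update i (f ∘ (true ∷_))))
    (trans (avg-interchange (𝔼 (λ x → f (false ∷ x [ i ]≔ false))) (𝔼 (λ x → f (false ∷ x [ i ]≔ true)))
                            (𝔼 (λ x → f (true ∷ x [ i ]≔ false))) (𝔼 (λ x → f (true ∷ x [ i ]≔ true))))
           (sym (cong₂ avg (𝔼-suc {n} (λ x → f (x [ suc i ]≔ false))) (𝔼-suc {n} (λ x → f (x [ suc i ]≔ true)))))))

  -- Trees as functions of restricted inputs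

  -- The expectation over the random bits, computed locally: different tosses on
  -- a path use different bits, and bits in the two subtrees of a node are never
  -- both relevant, so they need not be independent.
  val : RDT n → Vec Bool n → ℚ
  val (leaf p _)       x = p
  val (decide i T₀ T₁) x = if lookup x i then val T₁ x else val T₀ x
  val (toss T₀ T₁)     x = avg (val T₀ x) (val T₁ x)

  𝔼-eval : ∀ {m} (T : RDT n) (h : randomness T ℕ.≤ m) x → 𝔼 {m} (eval T h x) ≡ val T x
  𝔼-eval {m = m} (leaf p _) h x = 𝔼-const {m} p
  𝔼-eval {m = m} (decide i T₀ T₁) h x with lookup x i
  ... | true  = 𝔼-eval {m = m} T₁ (ℕ.m⊔n≤o⇒n≤o (randomness T₀) (randomness T₁) h) x
  ... | false = 𝔼-eval {m = m} T₀ (ℕ.m⊔n≤o⇒m≤o (randomness T₀) (randomness T₁) h) x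
  𝔼-eval {m = suc m} (toss T₀ T₁) h x = trans (𝔼-suc {m} (eval (toss T₀ T₁) h x))
    (cong₂ avg (𝔼-eval {m = m} T₀ (ℕ.m⊔n≤o⇒m≤o (randomness T₀) (randomness T₁) (ℕ.s≤s⁻¹ h)) x)
               (𝔼-eval {m = m} T₁ (ℕ.m⊔n≤o⇒n≤o (randomness T₀) (randomness T₁) (ℕ.s≤s⁻¹ h)) x))

  val-decide : ∀ (i : Fin n) T₀ T₁ x {b} → lookup x i ≡ b →
               val (decide i T₀ T₁) x ≡ val (if b then T₁ else T₀) x
  val-decide i T₀ T₁ x {true}  e rewrite e = refl
  val-decide i T₀ T₁ x {false} e rewrite e = refl

  val-InUnit : ∀ (T : RDT n) x → InUnit (val T x)
  val-InUnit (leaf p u)       x = u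
  val-InUnit (decide i T₀ T₁) x with lookup x i
  ... | true  = val-InUnit T₁ x
  ... | false = val-InUnit T₀ x
  val-InUnit (toss T₀ T₁)     x with val-InUnit T₀ x | val-InUnit T₁ x
  ... | 0≤p , p≤1 | 0≤q , q≤1 =
    ℚ.*-monoˡ-≤-nonNeg ½ (ℚ.+-mono-≤ 0≤p 0≤q) , ℚ.*-monoˡ-≤-nonNeg ½ (ℚ.+-mono-≤ p≤1 q≤1)

  -- A uniformly random input that agrees with ρ is obtained from a uniformly
  -- random input by overwriting it with ρ.
  override : Assignment n → Vec Bool n → Vec Bool n
  override []            x = x
  override ((i , b) ∷ ρ) x = override ρ x [ i ]≔ b

  index-injective : ∀ {i j : Fin n} → index i ≡ index j → i ≡ j
  index-injective e = Fin.toℕ-injective (B.fromℕ-injective e)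

  compare-index : ∀ (i j : Fin n) → compare (index i) (index j) ≡ eq → i ≡ j
  compare-index i j e with compare (index i) (index j) | compare-means (index i) (index j)
  compare-index i j refl | eq | p = index-injective (B.toℕ-injective p)

  compare-refl : ∀ a → compare a a ≡ eq
  compare-refl zero = refl
  compare-refl 1+[2 a ] rewrite compare-refl a = refl
  compare-refl 2[1+ a ] rewrite compare-refl a = refl

  find-first : ∀ ρ (i : Fin n) b → find ((i , b) ∷ ρ) i ≡ just b
  find-first ρ i b rewrite compare-refl (index i) = refl

  find-later : ∀ ρ {i j : Fin n} b → i ≢ j → find ((j , b) ∷ ρ) i ≡ find ρ i
  find-later ρ {i} {j} b i≢j with compare (index i) (index j) | compare-index i j
  ... | eq | f = ⊥-elim (i≢j (f refl))
  ... | lt | _ = refl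
  ... | gt | _ = refl

  find-just : ∀ ρ (i : Fin n) {b} → find ρ i ≡ just b → ∀ x → lookup (override ρ x) i ≡ b
  find-just ((j , c) ∷ ρ) i e x with i Fin.≟ j
  ... | no i≢j = trans (Vec.lookup∘update′ i≢j (override ρ x) c)
                       (find-just ρ i (trans (sym (find-later ρ c i≢j)) e) x)
  ... | yes refl with trans (sym (find-first ρ i c)) e
  ... | refl = Vec.lookup∘update i (override ρ x) c

  find-nothing : ∀ ρ (i : Fin n) → find ρ i ≡ nothing → ∀ x b →
                 override ρ (x [ i ]≔ b) ≡ override ρ x [ i ]≔ b
  find-nothing []            i e x b = refl
  find-nothing ((j , c) ∷ ρ) i e x b with i Fin.≟ j
  ... | no i≢j = trans (cong (_[ j ]≔ c) (find-nothing ρ i (trans (sym (find-later ρ c i≢j)) e) x b))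
                       (Vec.[]≔-commutes (override ρ x) i j i≢j)
  ... | yes refl with trans (sym (find-first ρ i c)) e
  ... | ()

  -- The expectation conditional on agreement with ρ.
  𝔼[_∣_] : (Vec Bool n → ℚ) → Assignment n → ℚ
  𝔼[ g ∣ ρ ] = 𝔼 (g ∘ override ρ)

  𝔼-split : ∀ ρ (i : Fin n) → find ρ i ≡ nothing → ∀ g →
            𝔼[ g ∣ ρ ] ≡ avg 𝔼[ g ∣ (i , false) ∷ ρ ] 𝔼[ g ∣ (i , true) ∷ ρ ]
  𝔼-split ρ i e g = trans (𝔼-update i (g ∘ override ρ))
    (cong₂ avg (𝔼-cong (λ x → cong g (find-nothing ρ i e x false)))
               (𝔼-cong (λ x → cong g (find-nothing ρ i e x true))))

  -- The function h allows for the value of the tree to be combined with that of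
  -- other functions of the input.
  𝔼-decide : ∀ (h : Vec Bool n → ℚ → ℚ) ρ i → find ρ i ≡ nothing → ∀ T₀ T₁ →
    𝔼[ (λ x → h x (val (decide i T₀ T₁) x)) ∣ ρ ] ≡
    avg 𝔼[ (λ x → h x (val T₀ x)) ∣ (i , false) ∷ ρ ] 𝔼[ (λ x → h x (val T₁ x)) ∣ (i , true) ∷ ρ ]
  𝔼-decide h ρ i e T₀ T₁ = trans (𝔼-split ρ i e (λ x → h x (val (decide i T₀ T₁) x)))
    (cong₂ avg
      (𝔼-cong (λ x → let y = override ρ x [ i ]≔ false in
        cong (h y) (val-decide i T₀ T₁ y (Vec.lookup∘update i (override ρ x) false))))
      (𝔼-cong (λ x → let y = override ρ x [ i ]≔ true in
        cong (h y) (val-decide i T₀ T₁ y (Vec.lookup∘update i (override ρ x) true)))))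

  𝔼-decided : ∀ (h : Vec Bool n → ℚ → ℚ) ρ i {b} → find ρ i ≡ just b → ∀ T₀ T₁ →
    𝔼[ (λ x → h x (val (decide i T₀ T₁) x)) ∣ ρ ] ≡
    𝔼[ (λ x → h x (val (if b then T₁ else T₀) x)) ∣ ρ ]
  𝔼-decided h ρ i e T₀ T₁ =
    𝔼-cong (λ x → cong (h (override ρ x)) (val-decide i T₀ T₁ (override ρ x) (find-just ρ i e x)))

  𝔼-toss : ∀ (g : Vec Bool n → ℚ) ρ T₀ T₁ →
    𝔼[ (λ x → g x * val (toss T₀ T₁) x) ∣ ρ ] ≡
    avg 𝔼[ (λ x → g x * val T₀ x) ∣ ρ ] 𝔼[ (λ x → g x * val T₁ x) ∣ ρ ]
  𝔼-toss g ρ T₀ T₁ = trans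
    (𝔼-cong (λ x → solve 4 (λ h g a b → g :* (h :* (a :+ b)) := h :* (g :* a :+ g :* b)) refl
                     ½ (g (override ρ x)) (val T₀ (override ρ x)) (val T₁ (override ρ x))))
    (𝔼-avg (λ x → g (override ρ x) * val T₀ (override ρ x)) (λ x → g (override ρ x) * val T₁ (override ρ x)))

  infix 4 _≐_
  -- Exactness of the fractions

  -- The fraction f has the exact value p.  Stated without division, it is
  -- preserved by the operations because of ring identities.
  record _≐_ (f : Frac) (p : ℚ) : Set where
    constructor _,_
    field
      ratio   : ℕ→ℚ (toℕ (num f)) ≡ p * ℕ→ℚ (toℕ (den f))
      den-pos : 0 ℕ.< toℕ (den f)

  open _≐_ public

  private
    ℕ→ℚ-mul : ∀ a b → ℕ→ℚ (toℕ (mul a b)) ≡ ℕ→ℚ (toℕ a) * ℕ→ℚ (toℕ b)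
    ℕ→ℚ-mul a b = trans (cong ℕ→ℚ (toℕ-mul a b)) (ℕ→ℚ-* (toℕ a) (toℕ b))

    mul-pos : ∀ a b → 0 ℕ.< toℕ a → 0 ℕ.< toℕ b → 0 ℕ.< toℕ (mul a b)
    mul-pos a b p q = subst (0 ℕ.<_) (sym (toℕ-mul a b)) (ℕ.*-mono-< p q)

  ≐-resp : ∀ {f p q} → p ≡ q → f ≐ p → f ≐ q
  ≐-resp refl e = e

  ⊕-≐ : ∀ {f g p q} → f ≐ p → g ≐ q → f ⊕ g ≐ p + q
  ⊕-≐ {a / b} {c / d} {p} {q} (e , b>0) (e′ , d>0) = ratio′ , mul-pos b d b>0 d>0
    where
    open ≡-Reasoning
    A = ℕ→ℚ (toℕ a)
    B = ℕ→ℚ (toℕ b)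
    C = ℕ→ℚ (toℕ c)
    D = ℕ→ℚ (toℕ d)
    algebra : ∀ p q B D → (p * B) * D + (q * D) * B ≡ (p + q) * (B * D)
    algebra = solve 4 (λ p q b d → (p :* b) :* d :+ (q :* d) :* b := (p :+ q) :* (b :* d)) refl
    ratio′ : ℕ→ℚ (toℕ (mul a d B.+ mul c b)) ≡ (p + q) * ℕ→ℚ (toℕ (mul b d))
    ratio′ = begin
      ℕ→ℚ (toℕ (mul a d B.+ mul c b))               ≡⟨ cong ℕ→ℚ (B.toℕ-homo-+ (mul a d) (mul c b)) ⟩
      ℕ→ℚ (toℕ (mul a d) ℕ.+ toℕ (mul c b))         ≡⟨ ℕ→ℚ-+ (toℕ (mul a d)) (toℕ (mul c b)) ⟩
      ℕ→ℚ (toℕ (mul a d)) + ℕ→ℚ (toℕ (mul c b))     ≡⟨ cong₂ _+_ (ℕ→ℚ-mul a d) (ℕ→ℚ-mul c b) ⟩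
      A * D + C * B                                 ≡⟨ cong₂ (λ u v → u * D + v * B) e e′ ⟩
      (p * B) * D + (q * D) * B                     ≡⟨ algebra p q B D ⟩
      (p + q) * (B * D)                             ≡⟨ cong ((p + q) *_) (ℕ→ℚ-mul b d) ⟨
      (p + q) * ℕ→ℚ (toℕ (mul b d))                 ∎

  ⊗-≐ : ∀ {f g p q} → f ≐ p → g ≐ q → f ⊗ g ≐ p * q
  ⊗-≐ {a / b} {c / d} {p} {q} (e , b>0) (e′ , d>0) = ratio′ , mul-pos b d b>0 d>0
    where
    open ≡-Reasoning
    A = ℕ→ℚ (toℕ a)
    B = ℕ→ℚ (toℕ b)
    C = ℕ→ℚ (toℕ c)
    D = ℕ→ℚ (toℕ d)
    algebra : ∀ p q B D → (p * B) * (q * D) ≡ (p * q) * (B * D)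
    algebra = solve 4 (λ p q b d → (p :* b) :* (q :* d) := (p :* q) :* (b :* d)) refl
    ratio′ : ℕ→ℚ (toℕ (mul a c)) ≡ (p * q) * ℕ→ℚ (toℕ (mul b d))
    ratio′ = begin
      ℕ→ℚ (toℕ (mul a c))             ≡⟨ ℕ→ℚ-mul a c ⟩
      A * C                           ≡⟨ cong₂ _*_ e e′ ⟩
      (p * B) * (q * D)               ≡⟨ algebra p q B D ⟩
      (p * q) * (B * D)               ≡⟨ cong ((p * q) *_) (ℕ→ℚ-mul b d) ⟨
      (p * q) * ℕ→ℚ (toℕ (mul b d))   ∎

  mid-≐ : ∀ {f g p q} → f ≐ p → g ≐ q → mid f g ≐ avg p q
  mid-≐ {f} {g} {p} {q} u v = ratio′ ,
    subst (0 ℕ.<_) (sym (B.toℕ-double (den (f ⊕ g)))) (ℕ.*-mono-< {0} {2} (ℕ.s≤s ℕ.z≤n) (den-pos s))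
    where
    open ≡-Reasoning
    s = ⊕-≐ u v
    D = ℕ→ℚ (toℕ (den (f ⊕ g)))
    algebra : ∀ s d → s * d ≡ (½ * s) * (ℕ→ℚ 2 * d)
    algebra = solve 2 (λ s d → s :* d := (con ½ :* s) :* (con (ℕ→ℚ 2) :* d)) refl
    ratio′ : ℕ→ℚ (toℕ (num (f ⊕ g))) ≡ avg p q * ℕ→ℚ (toℕ (B.double (den (f ⊕ g))))
    ratio′ = begin
      ℕ→ℚ (toℕ (num (f ⊕ g)))                          ≡⟨ ratio s ⟩
      (p + q) * D                                      ≡⟨ algebra (p + q) D ⟩
      avg p q * (ℕ→ℚ 2 * D)                            ≡⟨ cong (avg p q *_) (ℕ→ℚ-* 2 (toℕ (den (f ⊕ g)))) ⟨
      avg p q * ℕ→ℚ (2 ℕ.* toℕ (den (f ⊕ g)))          ≡⟨ cong (λ k → avg p q * ℕ→ℚ k) (B.toℕ-double (den (f ⊕ g))) ⟨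
      avg p q * ℕ→ℚ (toℕ (B.double (den (f ⊕ g))))     ∎

  label-≐ : ∀ p → 0ℚ ≤ p → label p ≐ p
  label-≐ p 0≤p =
    trans (cong ℕ→ℚ (B.toℕ-fromℕ ∣ ↥ p ∣))
      (trans (nonNeg-fraction p 0≤p) (cong (λ k → p * ℕ→ℚ k) (sym (B.toℕ-fromℕ (↧ₙ p))))) ,
    subst (0 ℕ.<_) (sym (B.toℕ-fromℕ (↧ₙ p))) (ℕ.s≤s ℕ.z≤n)

  cross-≤ : ∀ {f g p q} → f ≐ p → g ≐ q →
            toℕ (mul (num f) (den g)) ℕ.≤ toℕ (mul (num g) (den f)) → p ≤ q
  cross-≤ {a / b} {c / d} {p} {q} (e , b>0) (e′ , d>0) l =
    ℚ.*-cancelʳ-≤-pos B {{ℕ→ℚ-pos b>0}} (ℚ.*-cancelʳ-≤-pos D {{ℕ→ℚ-pos d>0}} (begin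
      (p * B) * D             ≡⟨ cong (_* D) e ⟨
      ℕ→ℚ (toℕ a) * D         ≡⟨ ℕ→ℚ-mul a d ⟨
      ℕ→ℚ (toℕ (mul a d))     ≤⟨ ℕ→ℚ-mono l ⟩
      ℕ→ℚ (toℕ (mul c b))     ≡⟨ ℕ→ℚ-mul c b ⟩
      ℕ→ℚ (toℕ c) * B         ≡⟨ cong (_* B) e′ ⟩
      (q * D) * B             ≡⟨ algebra q D B ⟩
      (q * B) * D             ∎))
    where
    open ℚ.≤-Reasoning
    B = ℕ→ℚ (toℕ b)
    D = ℕ→ℚ (toℕ d)
    algebra : ∀ q d b → (q * d) * b ≡ (q * b) * d
    algebra = solve 3 (λ q d b → (q :* d) :* b := (q :* b) :* d) refl

  -- The greedy choice

  sumVals : List (RDT n) → Vec Bool n → ℚ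
  sumVals []       x = 0ℚ
  sumVals (T ∷ Ts) x = val T x + sumVals Ts x

  0ᶠ-≐ : 0ᶠ ≐ 0ℚ
  0ᶠ-≐ = refl , ℕ.s≤s ℕ.z≤n

  mean-≐ : ∀ ρ (T : RDT n) → mean ρ T ≐ 𝔼[ val T ∣ ρ ]
  mean-≐ {n} ρ (leaf p (0≤p , _)) = ≐-resp (sym (𝔼-const {n} p)) (label-≐ p 0≤p)
  mean-≐ ρ (decide i T₀ T₁) with find ρ i in e
  ... | nothing    = ≐-resp (sym (𝔼-decide (λ _ v → v) ρ i e T₀ T₁))
                       (mid-≐ (mean-≐ ((i , false) ∷ ρ) T₀) (mean-≐ ((i , true) ∷ ρ) T₁))
  ... | just false = ≐-resp (sym (𝔼-decided (λ _ v → v) ρ i e T₀ T₁)) (mean-≐ ρ T₀)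
  ... | just true  = ≐-resp (sym (𝔼-decided (λ _ v → v) ρ i e T₀ T₁)) (mean-≐ ρ T₁)
  mean-≐ ρ (toss T₀ T₁) = ≐-resp (sym (𝔼-avg (val T₀ ∘ override ρ) (val T₁ ∘ override ρ)))
    (mid-≐ (mean-≐ ρ T₀) (mean-≐ ρ T₁))

  sumMeans-≐ : ∀ ρ (Ts : List (RDT n)) → sumMeans ρ Ts ≐ 𝔼[ sumVals Ts ∣ ρ ]
  sumMeans-≐ {n} ρ []   = ≐-resp (sym (𝔼-const {n} 0ℚ)) 0ᶠ-≐
  sumMeans-≐ ρ (T ∷ Ts) = ≐-resp (sym (𝔼-+ (val T ∘ override ρ) (sumVals Ts ∘ override ρ)))
    (⊕-≐ (mean-≐ ρ T) (sumMeans-≐ ρ Ts))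

  cancel-+ : ∀ {a b} c → a + c ≤ b + c → a ≤ b
  cancel-+ {a} {b} c l = subst₂ _≤_ (algebra a c) (algebra b c) (ℚ.+-monoˡ-≤ (ℚ.- c) l)
    where
    algebra : ∀ a c → (a + c) + ℚ.- c ≡ a
    algebra = solve 2 (λ a c → (a :+ c) :+ (:- c) := a) refl

  module _ (Ts Rs : List (RDT n)) where

    -- The function D = S - F, where S and F are the sums over Ts and Rs.
    excess : Vec Bool n → ℚ
    excess x = sumVals Ts x - sumVals Rs x

    correlation : (Vec Bool n → ℚ) → Assignment n → RDT n → ℚ
    correlation g ρ T = 𝔼[ (λ x → g x * val T x) ∣ ρ ]

    -- What gain - loss stands for.
    correlation-excess : ∀ ρ T →
      correlation excess ρ T + correlation (sumVals Rs) ρ T ≡ correlation (sumVals Ts) ρ T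
    correlation-excess ρ T = trans
      (sym (𝔼-+ (λ x → excess (override ρ x) * val T (override ρ x))
                (λ x → sumVals Rs (override ρ x) * val T (override ρ x))))
      (𝔼-cong (λ x → algebra (sumVals Ts (override ρ x)) (sumVals Rs (override ρ x)) (val T (override ρ x))))
      where
      algebra : ∀ s r v → (s - r) * v + r * v ≡ s * v
      algebra = solve 3 (λ s r v → (s :- r) :* v :+ r :* v := s :* v) refl

    correlation-leaf : ∀ g ρ p u → correlation g ρ (leaf p u) ≡ p * 𝔼[ g ∣ ρ ]
    correlation-leaf g ρ p u = trans
      (𝔼-cong (λ x → ℚ.*-comm (g (override ρ x)) p)) (𝔼-* p (g ∘ override ρ))

    record Exact (ρ : Assignment n) (C : Choice n) : Set where
      constructor _,_
      field
        gain-≐ : gain C ≐ correlation (sumVals Ts) ρ (tree C)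
        loss-≐ : loss C ≐ correlation (sumVals Rs) ρ (tree C)

    pickBy-least : ∀ {ρ C₀ C₁} o {a b} → Means o a b →
      (a ℕ.≤ b → correlation excess ρ (tree C₀) ≤ correlation excess ρ (tree C₁)) →
      (b ℕ.≤ a → correlation excess ρ (tree C₁) ≤ correlation excess ρ (tree C₀)) →
      correlation excess ρ (tree (pickBy o C₀ C₁)) ≤ correlation excess ρ (tree C₀) ×
      correlation excess ρ (tree (pickBy o C₀ C₁)) ≤ correlation excess ρ (tree C₁)
    pickBy-least eq m l r = ℚ.≤-refl , l (ℕ.≤-reflexive m)
    pickBy-least lt m l r = ℚ.≤-refl , l (ℕ.<⇒≤ m)
    pickBy-least gt m l r = r (ℕ.<⇒≤ m) , ℚ.≤-refl

    cross⇒≤ : ∀ {ρ C₀ C₁} → Exact ρ C₀ → Exact ρ C₁ →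
      toℕ (mul (num (gain C₀ ⊕ loss C₁)) (den (gain C₁ ⊕ loss C₀))) ℕ.≤
      toℕ (mul (num (gain C₁ ⊕ loss C₀)) (den (gain C₀ ⊕ loss C₁))) →
      correlation excess ρ (tree C₀) ≤ correlation excess ρ (tree C₁)
    cross⇒≤ {ρ} {C₀} {C₁} (p₀ , q₀) (p₁ , q₁) l = cancel-+ (Q₀ + Q₁) (begin
      d₀ + (Q₀ + Q₁)    ≡⟨ ℚ.+-assoc d₀ Q₀ Q₁ ⟨
      (d₀ + Q₀) + Q₁    ≡⟨ cong (_+ Q₁) (correlation-excess ρ (tree C₀)) ⟩
      P₀ + Q₁           ≤⟨ cross-≤ (⊕-≐ p₀ q₁) (⊕-≐ p₁ q₀) l ⟩
      P₁ + Q₀           ≡⟨ cong (_+ Q₀) (correlation-excess ρ (tree C₁)) ⟨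
      (d₁ + Q₁) + Q₀    ≡⟨ algebra d₁ Q₁ Q₀ ⟩
      d₁ + (Q₀ + Q₁)    ∎)
      where
      open ℚ.≤-Reasoning
      d₀ = correlation excess ρ (tree C₀)
      d₁ = correlation excess ρ (tree C₁)
      P₀ = correlation (sumVals Ts) ρ (tree C₀)
      P₁ = correlation (sumVals Ts) ρ (tree C₁)
      Q₀ = correlation (sumVals Rs) ρ (tree C₀)
      Q₁ = correlation (sumVals Rs) ρ (tree C₁)
      algebra : ∀ d a b → (d + a) + b ≡ d + (b + a)
      algebra = solve 3 (λ d a b → (d :+ a) :+ b := d :+ (b :+ a)) refl

    pick-least : ∀ {ρ} C₀ C₁ → Exact ρ C₀ → Exact ρ C₁ →
      correlation excess ρ (tree (pick C₀ C₁)) ≤ correlation excess ρ (tree C₀) ×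
      correlation excess ρ (tree (pick C₀ C₁)) ≤ correlation excess ρ (tree C₁)
    pick-least {ρ} C₀ C₁ x₀ x₁ = pickBy-least {ρ} {C₀} {C₁} (compareFrac f g)
      (compare-means (mul (num f) (den g)) (mul (num g) (den f)))
      (cross⇒≤ {ρ} {C₀} {C₁} x₀ x₁) (cross⇒≤ {ρ} {C₁} {C₀} x₁ x₀)
      where
      f = gain C₀ ⊕ loss C₁
      g = gain C₁ ⊕ loss C₀

    choose-exact : ∀ ρ T → Exact ρ (choose Ts Rs ρ T)
    choose-exact ρ (leaf p u@(0≤p , _)) =
      ≐-resp (sym (correlation-leaf (sumVals Ts) ρ p u)) (⊗-≐ (label-≐ p 0≤p) (sumMeans-≐ ρ Ts)) ,
      ≐-resp (sym (correlation-leaf (sumVals Rs) ρ p u)) (⊗-≐ (label-≐ p 0≤p) (sumMeans-≐ ρ Rs))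
    choose-exact ρ (decide i T₀ T₁) with find ρ i in e
    ... | nothing with choose-exact ((i , false) ∷ ρ) T₀ | choose-exact ((i , true) ∷ ρ) T₁
    ... | p₀ , q₀ | p₁ , q₁ =
      ≐-resp (sym (𝔼-decide (λ x v → sumVals Ts x * v) ρ i e U₀ U₁)) (mid-≐ p₀ p₁) ,
      ≐-resp (sym (𝔼-decide (λ x v → sumVals Rs x * v) ρ i e U₀ U₁)) (mid-≐ q₀ q₁)
      where
      U₀ = tree (choose Ts Rs ((i , false) ∷ ρ) T₀)
      U₁ = tree (choose Ts Rs ((i , true) ∷ ρ) T₁)
    choose-exact ρ (decide i T₀ T₁) | just false = choose-exact ρ T₀
    choose-exact ρ (decide i T₀ T₁) | just true  = choose-exact ρ T₁
    choose-exact ρ (toss T₀ T₁) = pick-either (Exact ρ) (choose Ts Rs ρ T₀) (choose Ts Rs ρ T₁)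
      (choose-exact ρ T₀) (choose-exact ρ T₁)

    avg-least : ∀ {s a b} → s ≤ a → s ≤ b → s ≤ avg a b
    avg-least {s} {a} {b} s≤a s≤b = subst (_≤ avg a b) (algebra s) (ℚ.*-monoˡ-≤-nonNeg ½ (ℚ.+-mono-≤ s≤a s≤b))
      where
      algebra : ∀ s → ½ * (s + s) ≡ s
      algebra = solve 1 (λ s → con ½ :* (s :+ s) := s) refl

    -- Conditional expectations: the score of a decision node is the average of the
    -- scores of its subtrees, and at a toss node, where the original score is the
    -- average as well, the smaller of the two is at most this average.
    choose-improves : ∀ ρ T →
      correlation excess ρ (tree (choose Ts Rs ρ T)) ≤ correlation excess ρ T
    choose-improves ρ (leaf p u) = ℚ.≤-refl
    choose-improves ρ (decide i T₀ T₁) with find ρ i in e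
    ... | nothing = subst₂ _≤_
      (sym (𝔼-decide (λ x v → excess x * v) ρ i e (tree (choose Ts Rs ((i , false) ∷ ρ) T₀)) (tree (choose Ts Rs ((i , true) ∷ ρ) T₁))))
      (sym (𝔼-decide (λ x v → excess x * v) ρ i e T₀ T₁))
      (ℚ.*-monoˡ-≤-nonNeg ½ (ℚ.+-mono-≤ (choose-improves ((i , false) ∷ ρ) T₀) (choose-improves ((i , true) ∷ ρ) T₁)))
    ... | just false = subst (correlation excess ρ (tree (choose Ts Rs ρ T₀)) ≤_) (sym (𝔼-decided (λ x v → excess x * v) ρ i e T₀ T₁)) (choose-improves ρ T₀)
    ... | just true  = subst (correlation excess ρ (tree (choose Ts Rs ρ T₁)) ≤_) (sym (𝔼-decided (λ x v → excess x * v) ρ i e T₀ T₁)) (choose-improves ρ T₁)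
    choose-improves ρ (toss T₀ T₁) = ℚ.≤-trans
      (avg-least (ℚ.≤-trans (proj₁ least) (choose-improves ρ T₀)) (ℚ.≤-trans (proj₂ least) (choose-improves ρ T₁)))
      (ℚ.≤-reflexive (sym (𝔼-toss excess ρ T₀ T₁)))
      where
      least = pick-least {ρ} (choose Ts Rs ρ T₀) (choose Ts Rs ρ T₁) (choose-exact ρ T₀) (choose-exact ρ T₁)

  -- Energy of the selected sample

  data Deterministic {n} : RDT n → Set where
    leaf   : ∀ {p u} → Deterministic (leaf p u)
    decide : ∀ {i T₀ T₁} → Deterministic T₀ → Deterministic T₁ → Deterministic (decide i T₀ T₁)

  choose-deterministic : ∀ Ts Rs ρ (T : RDT n) → Deterministic (tree (choose Ts Rs ρ T))
  choose-deterministic Ts Rs ρ (leaf p u)       = leaf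
  choose-deterministic Ts Rs ρ (decide i T₀ T₁) with find ρ i
  ... | nothing    = decide (choose-deterministic Ts Rs ((i , false) ∷ ρ) T₀) (choose-deterministic Ts Rs ((i , true) ∷ ρ) T₁)
  ... | just false = choose-deterministic Ts Rs ρ T₀
  ... | just true  = choose-deterministic Ts Rs ρ T₁
  choose-deterministic Ts Rs ρ (toss T₀ T₁)     =
    pick-either (Deterministic ∘ tree) (choose Ts Rs ρ T₀) (choose Ts Rs ρ T₁)
      (choose-deterministic Ts Rs ρ T₀) (choose-deterministic Ts Rs ρ T₁)

  run-≐ : ∀ x {T : RDT n} → Deterministic T → run x T ≐ val T x
  run-≐ x {leaf p (0≤p , _)} leaf = label-≐ p 0≤p
  run-≐ x {decide i T₀ T₁} (decide d₀ d₁) with lookup x i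
  ... | true  = run-≐ x d₁
  ... | false = run-≐ x d₀

  runAll-≐ : ∀ x {Ts : List (RDT n)} → All Deterministic Ts → runAll x Ts ≐ sumVals Ts x
  runAll-≐ x []       = 0ᶠ-≐
  runAll-≐ x (d ∷ ds) = ⊕-≐ (run-≐ x d) (runAll-≐ x ds)

  select-all : ∀ {P : RDT n → Set} R → (∀ Ts Rs → P (tree (choose Ts Rs [] R))) →
               ∀ j Ts Rs → All P Ts → All P (select j R Ts Rs)
  select-all R p zero    Ts Rs ps = ps
  select-all R p (suc j) Ts Rs ps = select-all R p j _ _ (p Ts Rs ∷ ps)

  length-select : ∀ (R : RDT n) j Ts Rs → length (select j R Ts Rs) ≡ j ℕ.+ length Ts
  length-select R zero    Ts Rs = refl
  length-select R (suc j) Ts Rs = trans (length-select R j _ _) (ℕ.+-suc j (length Ts))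

  size-trees : ∀ {s} (Ts : List (RDT n)) → All (λ T → descriptionLength T ℕ.≤ s) Ts →
               size (encodeTrees Ts) ℕ.≤ suc (length Ts ℕ.* suc s)
  size-trees []       []       = ℕ.≤-refl
  size-trees {s = s} (T ∷ Ts) (p ∷ ps) = ℕ.s≤s (ℕ.≤-trans (ℕ.+-mono-≤ p (size-trees Ts ps))
    (ℕ.≤-reflexive (ℕ.+-suc s _)))

  energy : (Ts Rs : List (RDT n)) → ℚ
  energy Ts Rs = 𝔼 (λ x → excess Ts Rs x * excess Ts Rs x)

  0≤-* : ∀ {p q} → 0ℚ ≤ p → 0ℚ ≤ q → 0ℚ ≤ p * q
  0≤-* {p} {q} 0≤p 0≤q = subst (_≤ p * q) (ℚ.*-zeroʳ p)
    (ℚ.*-monoˡ-≤-nonNeg p {{ℚ.nonNegative 0≤p}} 0≤q)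

  0≤-difference : ∀ {p q} → p ≤ q → 0ℚ ≤ q - p
  0≤-difference {p} {q} p≤q = subst (_≤ q - p) (ℚ.+-inverseʳ p) (ℚ.+-monoˡ-≤ (ℚ.- p) p≤q)

  -- 1 - (t - r)² factors as (1 - t + r) (1 + t - r).
  square-difference≤1 : ∀ {t r} → InUnit t → InUnit r → (t - r) * (t - r) ≤ 1ℚ
  square-difference≤1 {t} {r} (0≤t , t≤1) (0≤r , r≤1) = begin
    (t - r) * (t - r)                  ≡⟨ ℚ.+-identityˡ _ ⟨
    0ℚ + (t - r) * (t - r)             ≤⟨ ℚ.+-monoˡ-≤ _ (0≤-* (ℚ.+-mono-≤ (0≤-difference t≤1) 0≤r) (ℚ.+-mono-≤ (0≤-difference r≤1) 0≤t)) ⟩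
    (1ℚ - t + r) * (1ℚ - r + t) + (t - r) * (t - r)   ≡⟨ algebra t r ⟩
    1ℚ                                 ∎
    where
    open ℚ.≤-Reasoning
    algebra : ∀ t r → (1ℚ - t + r) * (1ℚ - r + t) + (t - r) * (t - r) ≡ 1ℚ
    algebra = solve 2 (λ t r → (con 1ℚ :- t :+ r) :* (con 1ℚ :- r :+ t) :+ (t :- r) :* (t :- r) := con 1ℚ) refl

  -- Expanding the square, the mixed term 2 𝔼[D (T - R)] is at most 0 by
  -- hypothesis.  To avoid signs, 2 𝔼[D R] is added to both sides.
  energy-step : ∀ Ts Rs (T R : RDT n) →
    correlation Ts Rs (excess Ts Rs) [] T ≤ correlation Ts Rs (excess Ts Rs) [] R →
    energy (T ∷ Ts) (R ∷ Rs) ≤ energy Ts Rs + 1ℚ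
  energy-step {n} Ts Rs T R improves = cancel-+ (2ℚ * 𝔼 Dr) (begin
    energy (T ∷ Ts) (R ∷ Rs) + 2ℚ * 𝔼 Dr        ≡⟨ cong (energy (T ∷ Ts) (R ∷ Rs) +_) (𝔼-* 2ℚ Dr) ⟨
    energy (T ∷ Ts) (R ∷ Rs) + 𝔼 (λ x → 2ℚ * Dr x)   ≡⟨ 𝔼-+ (λ x → excess (T ∷ Ts) (R ∷ Rs) x * excess (T ∷ Ts) (R ∷ Rs) x) (λ x → 2ℚ * Dr x) ⟨
    𝔼 (λ x → excess (T ∷ Ts) (R ∷ Rs) x * excess (T ∷ Ts) (R ∷ Rs) x + 2ℚ * Dr x)   ≤⟨ 𝔼-mono pointwise ⟩
    𝔼 (λ x → D x * D x + 1ℚ + 2ℚ * Dt x)        ≡⟨ 𝔼-+ (λ x → D x * D x + 1ℚ) (λ x → 2ℚ * Dt x) ⟩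
    𝔼 (λ x → D x * D x + 1ℚ) + 𝔼 (λ x → 2ℚ * Dt x)   ≡⟨ cong₂ _+_ (trans (𝔼-+ (λ x → D x * D x) (λ _ → 1ℚ)) (cong (energy Ts Rs +_) (𝔼-const {n} 1ℚ))) (𝔼-* 2ℚ Dt) ⟩
    energy Ts Rs + 1ℚ + 2ℚ * 𝔼 Dt               ≤⟨ ℚ.+-monoʳ-≤ (energy Ts Rs + 1ℚ) (ℚ.*-monoˡ-≤-nonNeg 2ℚ improves) ⟩
    energy Ts Rs + 1ℚ + 2ℚ * 𝔼 Dr               ∎)
    where
    open ℚ.≤-Reasoning
    2ℚ : ℚ
    2ℚ = ℕ→ℚ 2
    D Dt Dr : Vec Bool n → ℚ
    D  x = excess Ts Rs x
    Dt x = D x * val T x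
    Dr x = D x * val R x
    algebra : ∀ s f t r → ((t + s) - (r + f)) * ((t + s) - (r + f)) + 2ℚ * ((s - f) * r)
                        ≡ ((s - f) * (s - f) + (t - r) * (t - r)) + 2ℚ * ((s - f) * t)
    algebra = solve 4 (λ s f t r →
      ((t :+ s) :- (r :+ f)) :* ((t :+ s) :- (r :+ f)) :+ con 2ℚ :* ((s :- f) :* r) :=
      ((s :- f) :* (s :- f) :+ (t :- r) :* (t :- r)) :+ con 2ℚ :* ((s :- f) :* t)) refl
    pointwise : ∀ x → excess (T ∷ Ts) (R ∷ Rs) x * excess (T ∷ Ts) (R ∷ Rs) x + 2ℚ * Dr x
                    ≤ D x * D x + 1ℚ + 2ℚ * Dt x
    pointwise x = subst (_≤ D x * D x + 1ℚ + 2ℚ * Dt x)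
      (sym (algebra (sumVals Ts x) (sumVals Rs x) (val T x) (val R x)))
      (ℚ.+-monoˡ-≤ (2ℚ * Dt x) (ℚ.+-monoʳ-≤ (D x * D x) (square-difference≤1 (val-InUnit T x) (val-InUnit R x))))

  ℕ→ℚ-suc : ∀ k → ℕ→ℚ (suc k) ≡ ℕ→ℚ k + 1ℚ
  ℕ→ℚ-suc k = trans (ℕ→ℚ-+ 1 k) (ℚ.+-comm 1ℚ (ℕ→ℚ k))

  -- Each round adds at most 1 to the energy, and the list of subtracted trees
  -- stays a list of copies of R.
  select-energy : ∀ (R : RDT n) j Ts Rs →
    energy Ts Rs ≤ ℕ→ℚ (length Ts) → (∀ x → sumVals Rs x ≡ ℕ→ℚ (length Ts) * val R x) →
    𝔼 (λ x → (sumVals (select j R Ts Rs) x - ℕ→ℚ (length (select j R Ts Rs)) * val R x) *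
             (sumVals (select j R Ts Rs) x - ℕ→ℚ (length (select j R Ts Rs)) * val R x))
      ≤ ℕ→ℚ (length (select j R Ts Rs))
  select-energy R zero    Ts Rs e≤ copies = subst (_≤ ℕ→ℚ (length Ts))
    (𝔼-cong (λ x → cong (λ f → (sumVals Ts x - f) * (sumVals Ts x - f)) (copies x))) e≤
  select-energy R (suc j) Ts Rs e≤ copies = select-energy R j (T ∷ Ts) (R ∷ Rs)
    (ℚ.≤-trans (energy-step Ts Rs T R (choose-improves Ts Rs [] R))
      (ℚ.≤-trans (ℚ.+-monoˡ-≤ 1ℚ e≤) (ℚ.≤-reflexive (sym (ℕ→ℚ-suc (length Ts))))))
    (λ x → trans (cong (val R x +_) (copies x))
      (trans (algebra (val R x) (ℕ→ℚ (length Ts))) (cong (_* val R x) (sym (ℕ→ℚ-suc (length Ts))))))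
    where
    T = tree (choose Ts Rs [] R)
    algebra : ∀ r l → r + l * r ≡ (l + 1ℚ) * r
    algebra = solve 2 (λ r l → r :+ l :* r := (l :+ con 1ℚ) :* r) refl

  sumVals-bounds : ∀ (Ts : List (RDT n)) x → 0ℚ ≤ sumVals Ts x × sumVals Ts x ≤ ℕ→ℚ (length Ts)
  sumVals-bounds []       x = ℚ.≤-refl , ℚ.≤-refl
  sumVals-bounds (T ∷ Ts) x with val-InUnit T x | sumVals-bounds Ts x
  ... | 0≤p , p≤1 | 0≤s , s≤l = ℚ.+-mono-≤ 0≤p 0≤s ,
    ℚ.≤-trans (ℚ.+-mono-≤ p≤1 s≤l) (ℚ.≤-reflexive (sym (ℕ→ℚ-+ 1 (length Ts))))

  -- Polynomial bounds

  record Poly (f : ℕ → ℕ) : Set where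
    field
      coefficient degree : ℕ
      bound : ∀ M → 1 ℕ.≤ M → f M ℕ.≤ coefficient ℕ.* M ℕ.^ degree

  open Poly

  const : ∀ k → Poly (λ _ → k)
  const k = record { coefficient = k ; degree = 0 ; bound = λ _ _ → ℕ.≤-reflexive (sym (ℕ.*-identityʳ k)) }

  identity : Poly (λ M → M)
  identity = record { coefficient = 1 ; degree = 1
    ; bound = λ M _ → ℕ.≤-reflexive (sym (trans (ℕ.+-identityʳ (M ℕ.* 1)) (ℕ.*-identityʳ M))) }

  infixl 6 _⟨+⟩_
  infixl 7 _⟨*⟩_

  -- Adding the degrees instead of taking their maximum is wasteful but treats
  -- sums like products.
  _⟨+⟩_ : ∀ {f g} → Poly f → Poly g → Poly (λ M → f M ℕ.+ g M)
  _⟨+⟩_ {f} {g} p q = record { coefficient = a ℕ.+ b ; degree = d ℕ.+ e ; bound = λ M 1≤M → begin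
      f M ℕ.+ g M                                   ≤⟨ ℕ.+-mono-≤ (bound p M 1≤M) (bound q M 1≤M) ⟩
      a ℕ.* M ℕ.^ d ℕ.+ b ℕ.* M ℕ.^ e               ≤⟨ ℕ.+-mono-≤
        (ℕ.*-monoʳ-≤ a (ℕ.^-monoʳ-≤ M {{ℕ.>-nonZero 1≤M}} (ℕ.m≤m+n d e)))
        (ℕ.*-monoʳ-≤ b (ℕ.^-monoʳ-≤ M {{ℕ.>-nonZero 1≤M}} (ℕ.m≤n+m e d))) ⟩
      a ℕ.* M ℕ.^ (d ℕ.+ e) ℕ.+ b ℕ.* M ℕ.^ (d ℕ.+ e)   ≡⟨ ℕ.*-distribʳ-+ (M ℕ.^ (d ℕ.+ e)) a b ⟨
      (a ℕ.+ b) ℕ.* M ℕ.^ (d ℕ.+ e)                 ∎ }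
    where
    open ℕ.≤-Reasoning
    a = coefficient p
    b = coefficient q
    d = degree p
    e = degree q

  _⟨*⟩_ : ∀ {f g} → Poly f → Poly g → Poly (λ M → f M ℕ.* g M)
  _⟨*⟩_ {f} {g} p q = record { coefficient = a ℕ.* b ; degree = d ℕ.+ e ; bound = λ M 1≤M → begin
      f M ℕ.* g M                                   ≤⟨ ℕ.*-mono-≤ (bound p M 1≤M) (bound q M 1≤M) ⟩
      (a ℕ.* M ℕ.^ d) ℕ.* (b ℕ.* M ℕ.^ e)           ≡⟨ ℕ.[m*n]*[o*p]≡[m*o]*[n*p] a (M ℕ.^ d) b (M ℕ.^ e) ⟩
      (a ℕ.* b) ℕ.* (M ℕ.^ d ℕ.* M ℕ.^ e)           ≡⟨ cong (a ℕ.* b ℕ.*_) (ℕ.^-distribˡ-+-* M d e) ⟨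
      (a ℕ.* b) ℕ.* M ℕ.^ (d ℕ.+ e)                 ∎ }
    where
    open ℕ.≤-Reasoning
    a = coefficient p
    b = coefficient q
    d = degree p
    e = degree q

  time-bound : ℕ → ℕ
  time-bound M = weight (Program.main program) ℕ.+ 50 ℕ.* main-cost M

  module _ {w : ℕ → ℕ} (W : Poly w) where

    add-poly : Poly (λ M → add-cost (w M))
    add-poly = const 1 ⟨+⟩ W ⟨*⟩ (const 2 ⟨+⟩ W)

    mul-poly : Poly (λ M → mul-cost (w M))
    mul-poly = const 1 ⟨+⟩ W ⟨*⟩ (const 1 ⟨+⟩ (add-poly ⟨+⟩ (const 1 ⟨+⟩ W)))

    ⊕-poly : Poly (λ M → ⊕-cost (w M))
    ⊕-poly = const 1 ⟨+⟩ (mul-poly ⟨+⟩ add-poly ⟨+⟩ mul-poly ⟨+⟩ mul-poly)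

    ⊗-poly : Poly (λ M → ⊗-cost (w M))
    ⊗-poly = const 1 ⟨+⟩ (mul-poly ⟨+⟩ mul-poly)

    mid-poly : Poly (λ M → mid-cost (w M))
    mid-poly = const 1 ⟨+⟩ ((const 1 ⟨+⟩ W) ⟨+⟩ ⊕-poly)

    join-poly : Poly (λ M → join-cost (w M))
    join-poly = const 1 ⟨+⟩ (mid-poly ⟨+⟩ mid-poly)

    pick-poly : Poly (λ M → pick-cost (w M))
    pick-poly = const 1 ⟨+⟩ (const 1 ⟨+⟩ ((const 1 ⟨+⟩ W) ⟨+⟩ mul-poly ⟨+⟩ mul-poly) ⟨+⟩ ⊕-poly ⟨+⟩ ⊕-poly)

    module _ {h : ℕ → ℕ} (H : Poly h) where

      find-poly : Poly (λ M → find-cost (w M) (h M))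
      find-poly = const 1 ⟨+⟩ H ⟨*⟩ (const 2 ⟨+⟩ W)

      mean-poly : Poly (λ M → mean-cost (w M) (h M))
      mean-poly = const 1 ⟨+⟩ W ⟨*⟩ (const 4 ⟨+⟩ mid-poly ⟨+⟩ find-poly)

      sum-poly : Poly (λ M → sum-cost (w M) (h M))
      sum-poly = const 1 ⟨+⟩ W ⟨*⟩ (const 1 ⟨+⟩ (⊕-poly ⟨+⟩ mean-poly))

      choose-poly : Poly (λ M → choose-cost (w M) (h M))
      choose-poly = const 1 ⟨+⟩ W ⟨*⟩
        (const 4 ⟨+⟩ (join-poly ⟨+⟩ pick-poly ⟨+⟩ (⊗-poly ⟨+⟩ sum-poly ⟨+⟩ ⊗-poly ⟨+⟩ sum-poly)) ⟨+⟩ find-poly)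

  lists-poly : Poly lists
  lists-poly = const 1 ⟨+⟩ identity ⟨*⟩ (const 1 ⟨+⟩ identity)

  word-poly : Poly word
  word-poly = identity ⟨*⟩ (const 1 ⟨+⟩ lists-poly) ⟨+⟩ identity ⟨*⟩ (const 1 ⟨+⟩ lists-poly) ⟨+⟩ (lists-poly ⟨+⟩ identity)

  main-poly : Poly main-cost
  main-poly = mul-poly word-poly
    ⟨+⟩ (const 1 ⟨+⟩ word-poly ⟨*⟩ (const 2 ⟨+⟩ ⊕-poly word-poly))
    ⟨+⟩ (const 1 ⟨+⟩ identity ⟨*⟩ (const 1 ⟨+⟩ choose-poly word-poly (identity ⟨+⟩ lists-poly)))
    ⟨+⟩ const 0 ⟨+⟩ (const 1 ⟨+⟩ identity ⟨*⟩ (const 2 ⟨+⟩ identity)) ⟨+⟩ (const 1 ⟨+⟩ word-poly)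

  abstract
    -- Abstract, to keep the type checker from evaluating coefficient and degree.
    time-bound-poly : Poly time-bound
    time-bound-poly = const (weight (Program.main program)) ⟨+⟩ const 50 ⟨*⟩ main-poly

  -- Accuracy and resources

  represents : ∀ a b p → ℕ→ℚ (toℕ a) ≡ p * ℕ→ℚ (toℕ b) → 0 ℕ.< toℕ b →
               (encodeℕᵇ a ∙ encodeℕᵇ b) Represents p
  represents a b p e 0<b with toℕ b in eb
  represents a b p e (ℕ.s≤s _) | suc b′ = toℕ a , b′ ,
    cong₂ _∙_ (cong encodeℕᵇ (sym (B.fromℕ-toℕ a)))
              (cong encodeℕᵇ (trans (sym (B.fromℕ-toℕ b)) (cong fromℕ eb))) ,
    *-cancelʳ-pos (ℕ→ℚ (suc b′)) {{ℕ→ℚ-pos {suc b′} (ℕ.s≤s ℕ.z≤n)}} (trans (sym e) (sym (fraction (toℕ a) b′)))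

  power-bound : ∀ {M X} d → ℕ→ℚ M ≤ ℕ→ℚ 2 * X → 0ℚ ≤ X → ℕ→ℚ (M ℕ.^ d) ≤ ℕ→ℚ (2 ℕ.^ d) * X ^ d
  power-bound zero    _ _ = ℚ.≤-refl
  power-bound {M} {X} (suc d) M≤ 0≤X = begin
    ℕ→ℚ (M ℕ.* M ℕ.^ d)                       ≡⟨ ℕ→ℚ-* M (M ℕ.^ d) ⟩
    ℕ→ℚ M * ℕ→ℚ (M ℕ.^ d)                     ≤⟨ ℚ.*-monoʳ-≤-nonNeg (ℕ→ℚ (M ℕ.^ d)) {{ℕ→ℚ-nonNeg (M ℕ.^ d)}} M≤ ⟩
    (ℕ→ℚ 2 * X) * ℕ→ℚ (M ℕ.^ d)               ≤⟨ ℚ.*-monoˡ-≤-nonNeg (ℕ→ℚ 2 * X) {{ℚ.nonNegative (0≤-* (0≤ℕ→ℚ 2) 0≤X)}} (power-bound {M} {X} d M≤ 0≤X) ⟩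
    (ℕ→ℚ 2 * X) * (ℕ→ℚ (2 ℕ.^ d) * X ^ d)     ≡⟨ algebra (ℕ→ℚ 2) X (ℕ→ℚ (2 ℕ.^ d)) (X ^ d) ⟩
    (ℕ→ℚ 2 * ℕ→ℚ (2 ℕ.^ d)) * (X * X ^ d)     ≡⟨ cong (_* (X * X ^ d)) (ℕ→ℚ-* 2 (2 ℕ.^ d)) ⟨
    ℕ→ℚ (2 ℕ.* 2 ℕ.^ d) * (X * X ^ d)         ∎
    where
    open ℚ.≤-Reasoning
    algebra : ∀ t x u y → (t * x) * (u * y) ≡ (t * u) * (x * y)
    algebra = solve 4 (λ t x u y → (t :* x) :* (u :* y) := (t :* u) :* (x :* y)) refl

  module _ (ε : ℚ) .{{ε>0 : Positive ε}} where

    -- The integer part of 1/ε, the first component of the encoding of ε.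
    quotient : ℕ
    quotient = ℕ._/_ (↧ₙ ε) ∣ ↥ ε ∣ {{↥-nonZero ε}}

    private
      a = ∣ ↥ ε ∣
      b = ↧ₙ ε
      instance
        a≢0 : ℕ.NonZero a
        a≢0 = ↥-nonZero ε
        b>0 : Positive (ℕ→ℚ b)
        b>0 = ℕ→ℚ-pos {b} (ℕ.s≤s ℕ.z≤n)

      a≡εb : ℕ→ℚ a ≡ ε * ℕ→ℚ b
      a≡εb = nonNeg-fraction ε (ℚ.<⇒≤ (ℚ.positive⁻¹ ε))

      multiple : ∀ k → ℕ→ℚ (k ℕ.* a) ≡ (ℕ→ℚ k * ε) * ℕ→ℚ b
      multiple k = trans (ℕ→ℚ-* k a) (trans (cong (ℕ→ℚ k *_) a≡εb) (sym (ℚ.*-assoc (ℕ→ℚ k) ε (ℕ→ℚ b))))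

    1≤[1+quotient]ε : 1ℚ ≤ ℕ→ℚ (suc quotient) * ε
    1≤[1+quotient]ε = ℚ.*-cancelʳ-≤-pos (ℕ→ℚ b) (begin
      1ℚ * ℕ→ℚ b                           ≡⟨ ℚ.*-identityˡ (ℕ→ℚ b) ⟩
      ℕ→ℚ b                                ≤⟨ ℕ→ℚ-mono {b} {suc quotient ℕ.* a} b≤ ⟩
      ℕ→ℚ (suc quotient ℕ.* a)             ≡⟨ multiple (suc quotient) ⟩
      (ℕ→ℚ (suc quotient) * ε) * ℕ→ℚ b     ∎)
      where
      open ℚ.≤-Reasoning
      b≤ : b ℕ.≤ suc quotient ℕ.* a
      b≤ = subst (ℕ._≤ suc quotient ℕ.* a) (sym (ℕ.m≡m%n+[m/n]*n b a))
        (ℕ.+-monoˡ-≤ (quotient ℕ.* a) (ℕ.<⇒≤ (ℕ.m%n<n b a)))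

    quotientε≤1 : ℕ→ℚ quotient * ε ≤ 1ℚ
    quotientε≤1 = ℚ.*-cancelʳ-≤-pos (ℕ→ℚ b) (begin
      (ℕ→ℚ quotient * ε) * ℕ→ℚ b   ≡⟨ multiple quotient ⟨
      ℕ→ℚ (quotient ℕ.* a)         ≤⟨ ℕ→ℚ-mono {quotient ℕ.* a} {b} (ℕ.m/n*n≤m b a) ⟩
      ℕ→ℚ b                        ≡⟨ ℚ.*-identityˡ (ℕ→ℚ b) ⟨
      1ℚ * ℕ→ℚ b                   ∎)
      where open ℚ.≤-Reasoning

    0≤ε⁻¹ : 0ℚ ≤ ε ⁻¹
    0≤ε⁻¹ = ℚ.*-cancelʳ-≤-pos ε (subst₂ _≤_ (sym (ℚ.*-zeroˡ ε)) (sym (ℚ.*-inverseˡ ε {{ℚ.pos⇒nonZero ε}})) (ℚ.nonNegative⁻¹ 1ℚ))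

    module _ (ε≤1 : ε ≤ 1ℚ) where

      1≤ε⁻¹ : 1ℚ ≤ ε ⁻¹
      1≤ε⁻¹ = ℚ.*-cancelʳ-≤-pos ε (subst₂ _≤_ (sym (ℚ.*-identityˡ ε)) (sym (ℚ.*-inverseˡ ε {{ℚ.pos⇒nonZero ε}})) ε≤1)

      1+quotient≤2ε⁻¹ : ℕ→ℚ (suc quotient) ≤ ℕ→ℚ 2 * ε ⁻¹
      1+quotient≤2ε⁻¹ = ℚ.*-cancelʳ-≤-pos ε (begin
        ℕ→ℚ (suc quotient) * ε             ≡⟨ cong (_* ε) (ℕ→ℚ-suc quotient) ⟩
        (ℕ→ℚ quotient + 1ℚ) * ε            ≡⟨ ℚ.*-distribʳ-+ ε (ℕ→ℚ quotient) 1ℚ ⟩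
        ℕ→ℚ quotient * ε + 1ℚ * ε          ≤⟨ ℚ.+-mono-≤ quotientε≤1 (ℚ.≤-trans (ℚ.≤-reflexive (ℚ.*-identityˡ ε)) ε≤1) ⟩
        ℕ→ℚ 2 * 1ℚ                         ≡⟨ cong (ℕ→ℚ 2 *_) (ℚ.*-inverseˡ ε {{ℚ.pos⇒nonZero ε}}) ⟨
        ℕ→ℚ 2 * (ε ⁻¹ * ε)                 ≡⟨ ℚ.*-assoc (ℕ→ℚ 2) (ε ⁻¹) ε ⟨
        (ℕ→ℚ 2 * ε ⁻¹) * ε                 ∎)
        where open ℚ.≤-Reasoning

  module Online {n} (R : RDT n) (q : ℕ) (R≤q : queryComplexity R ℕ.≤ q)
                (ε : ℚ) .{{ε>0 : Positive ε}} (ε<½ : ε ℚ.< ½) where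

    k K M : ℕ
    k = quotient ε
    K = suc k
    M = descriptionLength R ℕ.+ K

    trees : List (RDT n)
    trees = select K R [] []

    κ : ℚ
    κ = ℤ.+ 1 ℚ./ K

    output : Vec Bool n → ℚ
    output x = sumVals trees x * κ

    ε≤1 : ε ≤ 1ℚ
    ε≤1 = ℚ.≤-trans (ℚ.<⇒≤ ε<½) (ℚ.toℚᵘ-cancel-≤ (*≤* (ℤ.+≤+ (ℕ.s≤s ℕ.z≤n))))

    κK≡1 : κ * ℕ→ℚ K ≡ 1ℚ
    κK≡1 = fraction 1 k

    instance
      K>0 : Positive (ℕ→ℚ K)
      K>0 = ℕ→ℚ-pos {K} (ℕ.s≤s ℕ.z≤n)

    0≤κ : 0ℚ ≤ κ
    0≤κ = ℚ.*-cancelʳ-≤-pos (ℕ→ℚ K) (subst₂ _≤_ (sym (ℚ.*-zeroˡ (ℕ→ℚ K))) (sym κK≡1) (ℚ.nonNegative⁻¹ 1ℚ))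

    κ≤ε : κ ≤ ε
    κ≤ε = ℚ.*-cancelʳ-≤-pos (ℕ→ℚ K) (begin
      κ * ℕ→ℚ K   ≡⟨ κK≡1 ⟩
      1ℚ          ≤⟨ 1≤[1+quotient]ε ε ⟩
      ℕ→ℚ K * ε   ≡⟨ ℚ.*-comm (ℕ→ℚ K) ε ⟩
      ε * ℕ→ℚ K   ∎)
      where open ℚ.≤-Reasoning

    length-trees : length trees ≡ K
    length-trees = trans (length-select R K [] []) (ℕ.+-identityʳ K)

    trees-deterministic : All Deterministic trees
    trees-deterministic = select-all R (λ Ts Rs → choose-deterministic Ts Rs [] R) K [] [] []

    trees≤q : All (λ T → queryComplexity T ℕ.≤ q) trees
    trees≤q = select-all R (λ Ts Rs → ℕ.≤-trans (choose-queries Ts Rs [] R) R≤q) K [] [] []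

    trees-size : size (encodeTrees trees) ℕ.≤ lists M
    trees-size = ℕ.≤-trans
      (size-trees trees (select-all R (λ Ts Rs → choose-size Ts Rs [] R) K [] [] []))
      (ℕ.s≤s (ℕ.*-mono-≤ (ℕ.≤-trans (ℕ.≤-reflexive length-trees) (ℕ.m≤n+m K (descriptionLength R)))
                         (ℕ.s≤s (ℕ.m≤m+n (descriptionLength R) K))))

    output-InUnit : ∀ x → InUnit (output x)
    output-InUnit x = 0≤-* (proj₁ bounds) 0≤κ , (begin
      sumVals trees x * κ          ≤⟨ ℚ.*-monoʳ-≤-nonNeg κ {{ℚ.nonNegative 0≤κ}} (proj₂ bounds) ⟩
      ℕ→ℚ (length trees) * κ       ≡⟨ cong (λ l → ℕ→ℚ l * κ) length-trees ⟩
      ℕ→ℚ K * κ                    ≡⟨ ℚ.*-comm (ℕ→ℚ K) κ ⟩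
      κ * ℕ→ℚ K                    ≡⟨ κK≡1 ⟩
      1ℚ                           ∎)
      where
      open ℚ.≤-Reasoning
      bounds = sumVals-bounds trees x

    output-represented : ∀ x →
      (encodeℕᵇ (num (runAll x trees)) ∙ encodeℕᵇ (mul (den (runAll x trees)) (B.suc (fromℕ k))))
        Represents output x
    output-represented x = represents (num f) (mul (den f) K′) (output x)
      (begin
        ℕ→ℚ (toℕ (num f))                          ≡⟨ ratio exact ⟩
        S * D                                      ≡⟨ cong (_* D) (ℚ.*-identityʳ S) ⟨
        (S * 1ℚ) * D                               ≡⟨ cong (λ u → (S * u) * D) κK≡1 ⟨
        (S * (κ * ℕ→ℚ K)) * D                      ≡⟨ algebra S κ (ℕ→ℚ K) D ⟩
        (S * κ) * (D * ℕ→ℚ K)                      ≡⟨ cong ((S * κ) *_) (ℕ→ℚ-* (toℕ (den f)) K) ⟨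
        (S * κ) * ℕ→ℚ (toℕ (den f) ℕ.* K)          ≡⟨ cong (λ l → (S * κ) * ℕ→ℚ l) value ⟨
        (S * κ) * ℕ→ℚ (toℕ (mul (den f) K′))       ∎)
      (subst (0 ℕ.<_) (sym value) (ℕ.*-mono-< {0} {_} {0} (den-pos exact) (ℕ.s≤s (ℕ.z≤n {k}))))
      where
      open ≡-Reasoning
      f = runAll x trees
      K′ = B.suc (fromℕ k)
      S = sumVals trees x
      D = ℕ→ℚ (toℕ (den f))
      exact : f ≐ S
      exact = runAll-≐ x trees-deterministic
      value : toℕ (mul (den f) K′) ≡ toℕ (den f) ℕ.* K
      value = trans (toℕ-mul (den f) K′)
        (cong (toℕ (den f) ℕ.*_) (trans (B.toℕ-suc (fromℕ k)) (cong suc (B.toℕ-fromℕ k))))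
      algebra : ∀ s κ K d → (s * (κ * K)) * d ≡ (s * κ) * (d * K)
      algebra = solve 4 (λ s κ K d → (s :* (κ :* K)) :* d := (s :* κ) :* (d :* K)) refl

    -- With e = S - K f, the error is κ² 𝔼[e²] ≤ κ² K = κ ≤ ε.
    error : 𝔼 (λ x → (output x - 𝔼 (⟦ R ⟧ x)) ^ 2) ≤ ε
    error = begin
      𝔼 (λ x → (output x - 𝔼 (⟦ R ⟧ x)) ^ 2)   ≡⟨ 𝔼-cong pointwise ⟩
      𝔼 (λ x → (κ * κ) * (e x * e x))          ≡⟨ 𝔼-* (κ * κ) (λ x → e x * e x) ⟩
      (κ * κ) * 𝔼 (λ x → e x * e x)            ≤⟨ ℚ.*-monoˡ-≤-nonNeg (κ * κ) {{ℚ.nonNegative (0≤-* 0≤κ 0≤κ)}} energy≤ ⟩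
      (κ * κ) * ℕ→ℚ K                          ≡⟨ ℚ.*-assoc κ κ (ℕ→ℚ K) ⟩
      κ * (κ * ℕ→ℚ K)                          ≡⟨ cong (κ *_) κK≡1 ⟩
      κ * 1ℚ                                   ≡⟨ ℚ.*-identityʳ κ ⟩
      κ                                        ≤⟨ κ≤ε ⟩
      ε                                        ∎
      where
      open ℚ.≤-Reasoning
      e : Vec Bool n → ℚ
      e x = sumVals trees x - ℕ→ℚ K * val R x
      energy≤ : 𝔼 (λ x → e x * e x) ≤ ℕ→ℚ K
      energy≤ = subst (λ l → 𝔼 (λ x → (sumVals trees x - ℕ→ℚ l * val R x) * (sumVals trees x - ℕ→ℚ l * val R x)) ≤ ℕ→ℚ l)
        length-trees
        (select-energy R K [] [] (ℚ.≤-reflexive (𝔼-const {n} 0ℚ)) (λ x → sym (ℚ.*-zeroˡ (val R x))))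
      algebra : ∀ s κ K v → (s * κ - (κ * K) * v) ^ 2 ≡ (κ * κ) * ((s - K * v) * (s - K * v))
      algebra = solve 4 (λ s κ K v →
        (s :* κ :- (κ :* K) :* v) :* ((s :* κ :- (κ :* K) :* v) :* con 1ℚ) :=
        (κ :* κ) :* ((s :- K :* v) :* (s :- K :* v))) refl
      pointwise : ∀ x → (output x - 𝔼 (⟦ R ⟧ x)) ^ 2 ≡ (κ * κ) * (e x * e x)
      pointwise x = trans
        (cong (λ v → (output x - v) ^ 2) (trans (𝔼-eval R ℕ.≤-refl x)
          (trans (sym (ℚ.*-identityˡ (val R x))) (cong (_* val R x) (sym κK≡1)))))
        (algebra (sumVals trees x) κ (ℕ→ℚ K) (val R x))

    q≤q² : ℕ→ℚ q ≤ ℕ→ℚ q ^ 2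
    q≤q² = subst (ℕ→ℚ q ≤_) (trans (ℕ→ℚ-* q q) (cong (ℕ→ℚ q *_) (sym (ℚ.*-identityʳ (ℕ→ℚ q)))))
      (ℕ→ℚ-mono (square q))
      where
      square : ∀ q → q ℕ.≤ q ℕ.* q
      square zero    = ℕ.z≤n
      square (suc q) = ℕ.m≤m*n (suc q) (suc q)

    ε⁻¹≤ε⁻³ : ε ⁻¹ ≤ (ε ⁻¹) ^ 3
    ε⁻¹≤ε⁻³ = subst (_≤ (ε ⁻¹) ^ 3) (ℚ.*-identityʳ (ε ⁻¹))
      (ℚ.*-monoˡ-≤-nonNeg (ε ⁻¹) {{E≥0}} (begin
        1ℚ                    ≤⟨ 1≤ε⁻¹ ε ε≤1 ⟩
        ε ⁻¹                  ≡⟨ ℚ.*-identityʳ (ε ⁻¹) ⟨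
        ε ⁻¹ * 1ℚ             ≤⟨ ℚ.*-monoˡ-≤-nonNeg (ε ⁻¹) {{E≥0}} (1≤ε⁻¹ ε ε≤1) ⟩
        ε ⁻¹ * ε ⁻¹           ≡⟨ cong (ε ⁻¹ *_) (ℚ.*-identityʳ (ε ⁻¹)) ⟨
        ε ⁻¹ * (ε ⁻¹ * 1ℚ)    ∎))
      where
      open ℚ.≤-Reasoning
      E≥0 : NonNegative (ε ⁻¹)
      E≥0 = ℚ.nonNegative (0≤ε⁻¹ ε)

    -- K q ≤ 2 q / ε, which is at most the required bound as q ≤ q² and 1/ε ≥ 1.
    queries-bound : ∀ {r} → r ℕ.≤ length trees ℕ.* q ℕ.+ 0 →
      ℕ→ℚ r ≤ ℕ→ℚ 2 * (ℕ→ℚ q ^ 2 * (ε ⁻¹) ^ 3)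
    queries-bound {r} r≤ = begin
      ℕ→ℚ r                                  ≤⟨ ℕ→ℚ-mono r≤Kq ⟩
      ℕ→ℚ (K ℕ.* q)                          ≡⟨ ℕ→ℚ-* K q ⟩
      ℕ→ℚ K * ℕ→ℚ q                          ≤⟨ ℚ.*-monoʳ-≤-nonNeg (ℕ→ℚ q) {{ℕ→ℚ-nonNeg q}} (1+quotient≤2ε⁻¹ ε ε≤1) ⟩
      (ℕ→ℚ 2 * ε ⁻¹) * ℕ→ℚ q                 ≤⟨ ℚ.*-monoˡ-≤-nonNeg (ℕ→ℚ 2 * ε ⁻¹) {{ℚ.nonNegative (0≤-* (0≤ℕ→ℚ 2) (0≤ε⁻¹ ε))}} q≤q² ⟩
      (ℕ→ℚ 2 * ε ⁻¹) * ℕ→ℚ q ^ 2             ≡⟨ algebra (ℕ→ℚ 2) (ε ⁻¹) (ℕ→ℚ q ^ 2) ⟩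
      (ℕ→ℚ 2 * ℕ→ℚ q ^ 2) * ε ⁻¹             ≤⟨ ℚ.*-monoˡ-≤-nonNeg (ℕ→ℚ 2 * ℕ→ℚ q ^ 2) {{ℚ.nonNegative (0≤-* (0≤ℕ→ℚ 2) (ℚ.≤-trans (0≤ℕ→ℚ q) q≤q²))}} ε⁻¹≤ε⁻³ ⟩
      (ℕ→ℚ 2 * ℕ→ℚ q ^ 2) * (ε ⁻¹) ^ 3       ≡⟨ ℚ.*-assoc (ℕ→ℚ 2) (ℕ→ℚ q ^ 2) ((ε ⁻¹) ^ 3) ⟩
      ℕ→ℚ 2 * (ℕ→ℚ q ^ 2 * (ε ⁻¹) ^ 3)       ∎
      where
      open ℚ.≤-Reasoning
      r≤Kq : r ℕ.≤ K ℕ.* q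
      r≤Kq = ℕ.≤-trans r≤ (ℕ.≤-reflexive (trans (ℕ.+-identityʳ (length trees ℕ.* q)) (cong (ℕ._* q) length-trees)))
      algebra : ∀ t e s → (t * e) * s ≡ (t * s) * e
      algebra = solve 3 (λ t e s → (t :* e) :* s := (t :* s) :* e) refl

    -- The quantity in which the running time has to be polynomial.
    X : ℚ
    X = ℕ→ℚ (descriptionLength R ℕ.+ q) + ε ⁻¹

    0≤X : 0ℚ ≤ X
    0≤X = ℚ.+-mono-≤ (0≤ℕ→ℚ (descriptionLength R ℕ.+ q)) (0≤ε⁻¹ ε)

    M≤2X : ℕ→ℚ M ≤ ℕ→ℚ 2 * X
    M≤2X = begin
      ℕ→ℚ (N ℕ.+ K)                          ≡⟨ ℕ→ℚ-+ N K ⟩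
      ℕ→ℚ N + ℕ→ℚ K                          ≤⟨ ℚ.+-mono-≤ (ℕ→ℚ-mono N≤) (1+quotient≤2ε⁻¹ ε ε≤1) ⟩
      ℕ→ℚ (2 ℕ.* (N ℕ.+ q)) + ℕ→ℚ 2 * ε ⁻¹   ≡⟨ cong (_+ ℕ→ℚ 2 * ε ⁻¹) (ℕ→ℚ-* 2 (N ℕ.+ q)) ⟩
      ℕ→ℚ 2 * ℕ→ℚ (N ℕ.+ q) + ℕ→ℚ 2 * ε ⁻¹   ≡⟨ ℚ.*-distribˡ-+ (ℕ→ℚ 2) (ℕ→ℚ (N ℕ.+ q)) (ε ⁻¹) ⟨
      ℕ→ℚ 2 * X                              ∎
      where
      open ℚ.≤-Reasoning
      N = descriptionLength R
      N≤ : N ℕ.≤ 2 ℕ.* (N ℕ.+ q)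
      N≤ = ℕ.≤-trans (ℕ.m≤m+n N q) (ℕ.m≤n*m (N ℕ.+ q) 2)

    open Poly time-bound-poly renaming (coefficient to c₀; degree to d₀; bound to time-bound≤)

    time-in-X : ∀ {s} → s ℕ.≤ time-bound M → ℕ→ℚ s ≤ ℕ→ℚ (c₀ ℕ.* 2 ℕ.^ d₀) * X ^ d₀
    time-in-X {s} s≤ = begin
      ℕ→ℚ s                                 ≤⟨ ℕ→ℚ-mono (ℕ.≤-trans s≤ (time-bound≤ M 1≤M)) ⟩
      ℕ→ℚ (c₀ ℕ.* M ℕ.^ d₀)                 ≡⟨ ℕ→ℚ-* c₀ (M ℕ.^ d₀) ⟩
      ℕ→ℚ c₀ * ℕ→ℚ (M ℕ.^ d₀)               ≤⟨ ℚ.*-monoˡ-≤-nonNeg (ℕ→ℚ c₀) {{ℕ→ℚ-nonNeg c₀}} (power-bound {M} {X} d₀ M≤2X 0≤X) ⟩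
      ℕ→ℚ c₀ * (ℕ→ℚ (2 ℕ.^ d₀) * X ^ d₀)    ≡⟨ ℚ.*-assoc (ℕ→ℚ c₀) (ℕ→ℚ (2 ℕ.^ d₀)) (X ^ d₀) ⟨
      (ℕ→ℚ c₀ * ℕ→ℚ (2 ℕ.^ d₀)) * X ^ d₀    ≡⟨ cong (_* X ^ d₀) (ℕ→ℚ-* c₀ (2 ℕ.^ d₀)) ⟨
      ℕ→ℚ (c₀ ℕ.* 2 ℕ.^ d₀) * X ^ d₀        ∎
      where
      open ℚ.≤-Reasoning
      1≤M : 1 ℕ.≤ M
      1≤M = ℕ.≤-trans (ℕ.s≤s ℕ.z≤n) (ℕ.m≤n+m K (descriptionLength R))

    module _ (x : Vec Bool n) where
      open Selection x

      execution = main-runs {M} {q} R k (ℕ.m≤m+n (descriptionLength R) K) (ℕ.m≤n+m K (descriptionLength R)) R≤q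
        (encodeℕ (ℕ._%_ (↧ₙ ε) ∣ ↥ ε ∣ {{↥-nonZero ε}}) ∙ encodeℕ ∣ ↥ ε ∣) trees≤q trees-size

      open _⊢_↦_⟨_,_⟩ execution using (steps; queries; derivation; steps≤; queries≤)

      guarantee : InUnit (output x) × ∃[ time ] ∃[ queries ]
        Returns program R ε x (output x) time queries
        × ℕ→ℚ time ≤ ℕ→ℚ (c₀ ℕ.* 2 ℕ.^ d₀) * X ^ d₀
        × ℕ→ℚ queries ≤ ℕ→ℚ 2 * (ℕ→ℚ q ^ 2 * (ε ⁻¹) ^ 3)
      guarantee = output-InUnit x , steps , queries ,
        (_ , derivation , output-represented x) , time-in-X steps≤ , queries-bound queries≤

open Analysis

open import Data.Nat.Base using (_≤_; _+_)

theorem4 : Σ[ A-Online ∈ Program ] ∃[ C ] ∃[ c ] ∃[ d ]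
    (∀ {n} (R : RDT n) (q : ℕ) → queryComplexity R ≤ q →
    (ε : ℚ) .{{_ : ℚ.Positive ε}} → ε ℚ.< ½ →
    Σ[ A ∈ (Vec Bool n → ℚ) ]
    (∀ x → InUnit (A x) ×
    ∃[ time ] ∃[ queries ]
    Returns A-Online R ε x (A x) time queries
    × ℕ→ℚ time ℚ.≤ ℕ→ℚ c ℚ.* (ℕ→ℚ (descriptionLength R + q) ℚ.+ ε ⁻¹) ^ d
    × ℕ→ℚ queries ℚ.≤ ℕ→ℚ C ℚ.* (ℕ→ℚ q ^ 2 ℚ.* (ε ⁻¹) ^ 3))
    × 𝔼 (λ x → (A x ℚ.- 𝔼 (⟦ R ⟧ x)) ^ 2) ℚ.≤ ε)
theorem4 = program , 2 , Poly.coefficient time-bound-poly ℕ.* 2 ℕ.^ Poly.degree time-bound-poly ,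
  Poly.degree time-bound-poly ,
  λ R q R≤q ε ε<½ → let open Online R q R≤q ε ε<½ in output , guarantee , error
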